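{- There is a $6.311$-competitive non-adaptive algorithm for laminar matroid prophet inequalities; that is, for every laminar matroid prophet inequality instance there is a non-adaptive algorithm $\mathrm{ALG}$ with $\mathbb{E}[\mathrm{OPT}]\le 6.311\cdot\mathbb{E}[\mathrm{ALG}]$.
   Context: Matroid prophet inequality instance: a matroid $M=([n],\mathcal I)$ together with independent nonnegative random variables $X_1,\dots,X_n$ with known distributions ($X_i$ is the value of item $i$). Items arrive in the known order $1,2,\dots,n$; when item $i$ arrives its realized value is observed and the algorithm must immediately and irrevocably accept or reject it, keeping the accepted set independent in $M$. $\mathbb{E}[\mathrm{ALG}]$ is the expected total value of accepted items and $\mathbb{E}[\mathrm{OPT}]=\mathbb{E}[\max_{I\in\mathcal I}\sum_{i\in I}X_i]$. Non-adaptive algorithm: thresholds $T_1,\dots,T_n\in[0,+\infty]$ (possibly different for different items) are fixed before any value is realized, depending only on the distributions, the matroid and the arrival order; when item $i$ arrives it is accepted if and only if $X_i\ge T_i$ and adding $i$ keeps the accepted set independent. Convention: distributions are taken to be continuous, so that for each $q\in[0,1]$ there is a threshold exceeded by $X_i$ with probability exactly $q$; for distributions with atoms, independent randomized tie-breaking at the threshold is allowed (when $X_i=T_i$ the item is considered above its threshold with a prescribed probability) so as to achieve probability exactly $q$. Laminar matroid: a family $\mathcal L\subseteq 2^N$ is laminar if for all $A,B\in\mathcal L$, either $A\cap B=\varnothing$, $A\subseteq B$, or $B\subseteq A$. A laminar matroid is specified by a laminar family $\mathcal L$ and integer ranks $(r_S)_{S\in\mathcal L}$ (with $r_A\le r_B$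 whenever $A\subseteq B$); a set $I\subseteq N$ is independent iff $|I\cap S|\le r_S$ for every $S\in\mathcal L$. -}

module Defs where

open import Level using (0ℓ) renaming (suc to lsuc)
open import Algebra.Bundles using (CommutativeRing)
import Algebra.Definitions.RawMonoid as RawMonoid
import Algebra.Properties.CommutativeMonoid.Sum as CMSum
open import Axiom.ExcludedMiddle using (ExcludedMiddle)
open import Data.Bool.Base using (Bool; true; false; if_then_else_; not; _∧_; _∨_)
open import Data.Fin.Base using (Fin; toℕ)
open import Data.Fin.Subset as Sub using (Subset; inside; outside; ⁅_⁆; ∣_∣)
open import Data.List.Base as List using (List; allFin; filter; foldl; foldr)
import Data.List.Extrema as Extrema
open import Data.List.Membership.Propositional renaming (_∈_ to _∈ˡ_)
open import Data.List.Relation.Unary.All using (All; all?)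
open import Data.Nat.Base as ℕ using (ℕ; zero; suc)
import Data.Nat.Properties as ℕ
open import Data.Product.Base using (∃; _,_; proj₁)
open import Data.Sum.Base using (_⊎_)
open import Data.Vec.Base using ([]; _∷_; lookup)
open import Relation.Binary.Bundles using (TotalOrder)
open import Relation.Binary.Core using (Rel)
import Relation.Binary.Construct.Add.Supremum.NonStrict as AddSupremum
open import Relation.Binary.PropositionalEquality.Core using (_≡_; _≢_)
open import Relation.Binary.Structures using (IsTotalOrder)
open import Relation.Nullary using (¬_; Dec; yes; no; does)
open import Relation.Nullary.Construct.Add.Supremum using (_⁺; [_]; ⊤⁺)
open import Relation.Unary
  using (Pred; _∈_; _⊢_; _≐_; _⊥_; ∁; U; ⋃; ⋂; Satisfiable)

module _ {C : Set} (_≤_ : Rel C 0ℓ) where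

  IsUpperBound : ∀ {ℓ} → Pred C ℓ → Pred C ℓ
  IsUpperBound A u = ∀ x → x ∈ A → x ≤ u

  record IsLUB {ℓ} (A : Pred C ℓ) (s : C) : Set ℓ where
    field
      upper : IsUpperBound A s
      least : ∀ u → IsUpperBound A u → s ≤ u

-- The real numbers, axiomatised as a Dedekind-complete ordered field;
-- classically this determines them up to isomorphism.  Equality is a
-- setoid equality.  As is usual, the inverse is total and unconstrained
-- at zero.  Completeness is for predicates one level up because the sets
-- of lower sums used below quantify over events.

record CompleteOrderedField : Set (lsuc (lsuc 0ℓ)) where
  infix  4 _≤_
  infix  8 _⁻¹
  field
    commutativeRing : CommutativeRing 0ℓ 0ℓ
  open CommutativeRing commutativeRing public
  field
    _≤_          : Rel Carrier 0ℓ
    isTotalOrder : IsTotalOrder _≈_ _≤_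
    +-monoˡ-≤    : ∀ {x y} z → x ≤ y → (x + z) ≤ (y + z)
    *-nonneg     : ∀ {x y} → 0# ≤ x → 0# ≤ y → 0# ≤ (x * y)
    0≉1          : ¬ (0# ≈ 1#)
    _⁻¹          : Carrier → Carrier
    *-inverseʳ   : ∀ x → ¬ (x ≈ 0#) → (x * x ⁻¹) ≈ 1#

  field
    complete : (A : Pred Carrier (lsuc 0ℓ)) → Satisfiable A →
               Satisfiable (IsUpperBound _≤_ A) → Satisfiable (IsLUB _≤_ A)

  totalOrder : TotalOrder 0ℓ 0ℓ 0ℓ
  totalOrder = record { isTotalOrder = isTotalOrder }

  open CMSum +-commutativeMonoid public using (sum)
  open CMSum *-commutativeMonoid public using () renaming (sum to prod)
  open RawMonoid +-rawMonoid using (_×_)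
  open AddSupremum _≤_ public using (_≤⁺_)

  fromℕ : ℕ → Carrier
  fromℕ k = k × 1#

  -- Multiplication of an element of ℝ ∪ {∞} by a positive real.
  infixr 7 _·_
  _·_ : Carrier → Carrier ⁺ → Carrier ⁺
  c · [ x ] = [ c * x ]
  c · ⊤⁺    = ⊤⁺

  6·311 : Carrier
  6·311 = fromℕ 6311 * fromℕ 1000 ⁻¹

-- Only the ranks of members of the family matter.
record LaminarMatroid (n : ℕ) : Set where
  field
    family  : List (Subset n)
    laminar : ∀ {A B} → A ∈ˡ family → B ∈ˡ family →
              Sub.Empty (A Sub.∩ B) ⊎ (A Sub.⊆ B ⊎ B Sub.⊆ A)
    rank    : Subset n → ℕ
    rank-mono : ∀ {A B} → A ∈ˡ family → B ∈ˡ family →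
                A Sub.⊆ B → rank A ℕ.≤ rank B

  Independent : Pred (Subset n) 0ℓ
  Independent I = All (λ S → ∣ I Sub.∩ S ∣ ℕ.≤ rank S) family

  independent? : ∀ I → Dec (Independent I)
  independent? I = all? (λ S → ∣ I Sub.∩ S ∣ ℕ.≤? rank S) family

allSubsets : ∀ n → List (Subset n)
allSubsets zero    = [] List.∷ List.[]
allSubsets (suc n) = List.map (inside ∷_) (allSubsets n) List.++
                     List.map (outside ∷_) (allSubsets n)

-- Excluded middle makes order, equality and membership tests decidable and
-- suprema total; it is used throughout as in ordinary mathematics.
module Prophet (lem : ∀ {ℓ} → ExcludedMiddle ℓ) (R : CompleteOrderedField) where

  open CompleteOrderedField R renaming (Carrier to ℝ) public
  open Extrema totalOrder using (max)

  ⟦_⟧ : Set → Bool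
  ⟦ P ⟧ = does (lem {P = P})

  𝟙 : Set → ℝ
  𝟙 P = if ⟦ P ⟧ then 1# else 0#

  -- Supremum in [0,∞]; the empty set has supremum 0.
  sup : Pred ℝ (lsuc 0ℓ) → ℝ ⁺
  sup A with lem {P = Satisfiable A} | lem {P = Satisfiable (IsUpperBound _≤_ A)}
  ... | no  _  | _       = [ 0# ]
  ... | yes _  | no  _   = ⊤⁺
  ... | yes ne | yes bdd = [ proj₁ (complete A ne bdd) ]

  data Borel : Pred (Pred ℝ 0ℓ) (lsuc 0ℓ) where
    ray  : ∀ t → Borel (_≤ t)
    compl : ∀ {A} → Borel A → Borel (∁ A)
    union : {A : ℕ → Pred ℝ 0ℓ} → (∀ k → Borel (A k)) → Borel (⋃ ℕ A)
    resp  : ∀ {A B} → A ≐ B → Borel A → Borel B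

  -- 𝐏 is a total function, but it is constrained only on events.
  record ProbabilitySpace : Set (lsuc (lsuc 0ℓ)) where
    field
      Ω     : Set
      Event : Pred (Pred Ω 0ℓ) (lsuc 0ℓ)
      Event-U    : Event U
      Event-∁    : ∀ {A} → Event A → Event (∁ A)
      Event-⋃    : {A : ℕ → Pred Ω 0ℓ} → (∀ k → Event (A k)) → Event (⋃ ℕ A)
      Event-resp : ∀ {A B} → A ≐ B → Event A → Event B

      𝐏        : Pred Ω 0ℓ → ℝ
      𝐏-resp   : ∀ {A B} → A ≐ B → Event A → 𝐏 A ≈ 𝐏 B
      𝐏-nonneg : ∀ {A} → Event A → 0# ≤ 𝐏 A
      𝐏-U      : 𝐏 U ≈ 1#
      -- The sum of a series of nonnegative terms is the least upper bound
      -- of its partial sums.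
      𝐏-⋃      : {A : ℕ → Pred Ω 0ℓ} → (∀ k → Event (A k)) →
                 (∀ {j k} → j ≢ k → A j ⊥ A k) →
                 IsLUB _≤_ (λ s → ∃ λ N → s ≈ sum {N} (λ k → 𝐏 (A (toℕ k))))
                           (𝐏 (⋃ ℕ A))

    -- s is the integral of a nonnegative simple function Σⱼ aⱼ 𝟙(Aⱼ)
    -- that lies below f.
    record IsLowerSum (f : Ω → ℝ) (s : ℝ) : Set (lsuc 0ℓ) where
      field
        size     : ℕ
        a        : Fin size → ℝ
        A        : Fin size → Pred Ω 0ℓ
        a-nonneg : ∀ j → 0# ≤ a j
        A-event  : ∀ j → Event (A j)
        below    : ∀ ω → sum (λ j → a j * 𝟙 (ω ∈ A j)) ≤ f ω
        integral : s ≈ sum (λ j → a j * 𝐏 (A j))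

    -- Lebesgue integral of a nonnegative measurable function, in [0,∞].
    𝐄 : (Ω → ℝ) → ℝ ⁺
    𝐄 f = sup (IsLowerSum f)

  record IndependentValues (n : ℕ) : Set (lsuc (lsuc 0ℓ)) where
    field
      space : ProbabilitySpace
    open ProbabilitySpace space public
    field
      X           : Fin n → Ω → ℝ
      X-nonneg    : ∀ i ω → 0# ≤ X i ω
      X-measurable : ∀ i {B} → Borel B → Event (X i ⊢ B)
      X-independent : (B : Fin n → Pred ℝ 0ℓ) → (∀ i → Borel (B i)) →
                      𝐏 (⋂ (Fin n) (λ i → X i ⊢ B i)) ≈ prod (λ i → 𝐏 (X i ⊢ B i))

  -- Item i has a threshold in [0,∞]; a value equal to it counts as being
  -- above it with probability tie i, independently of everything else.
  record NonAdaptive (n : ℕ) : Set where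
    field
      threshold        : Fin n → ℝ ⁺
      threshold-nonneg : ∀ i → [ 0# ] ≤⁺ threshold i
      tie              : Fin n → ℝ
      0≤tie            : ∀ i → 0# ≤ tie i
      tie≤1            : ∀ i → tie i ≤ 1#

  value : ∀ {n} → Subset n → (Fin n → ℝ) → ℝ
  value I x = sum (λ i → if lookup I i then x i else 0#)

  isAbove : ℝ ⁺ → Bool → ℝ → Bool
  isAbove [ t ] heads x = not ⟦ x ≤ t ⟧ ∨ (⟦ x ≈ t ⟧ ∧ heads)
  isAbove ⊤⁺    heads x = false

  module _ {n} (M : LaminarMatroid n) where
    open LaminarMatroid M

    -- The empty set is independent and has value 0.
    opt : (Fin n → ℝ) → ℝ
    opt x = max 0# (List.map (λ I → value I x) (filter independent? (allSubsets n)))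

    module _ (𝒜 : NonAdaptive n) where
      open NonAdaptive 𝒜

      -- heads is the set of items whose tie-breaking coin shows heads.
      accepted : Subset n → (Fin n → ℝ) → Subset n
      accepted heads x = foldl step Sub.⊥ (allFin n)
        where
        step : Subset n → Fin n → Subset n
        step I i =
          if isAbove (threshold i) (lookup heads i) (x i)
             ∧ does (independent? (I Sub.∪ ⁅ i ⁆))
          then I Sub.∪ ⁅ i ⁆ else I

      coinProbability : Subset n → ℝ
      coinProbability heads =
        prod (λ i → if lookup heads i then tie i else 1# - tie i)

      -- The value accepted on x, averaged over the tie-breaking coins.
      -- Since the coins are independent of the values, averaging this over
      -- the values is the expectation over the product space.
      alg : (Fin n → ℝ) → ℝ
      alg x = foldr _+_ 0#
        (List.map (λ heads → coinProbability heads * value (accepted heads x) x)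
                  (allSubsets n))

    module _ (V : IndependentValues n) where
      open IndependentValues V

      𝐄[OPT] : ℝ ⁺
      𝐄[OPT] = 𝐄 (λ ω → opt (λ i → X i ω))

      𝐄[ALG] : NonAdaptive n → ℝ ⁺
      𝐄[ALG] 𝒜 = 𝐄 (λ ω → alg 𝒜 (λ i → X i ω))

{-# OPTIONS --safe #-}
{-
Round every value down to a finite grid.  Let qᵢ be the probability that item i
lies in an optimal independent set and vᵢ its expected contribution there, so
that the qᵢ lie in the matroid polytope and Σ vᵢ = E[OPT] up to rounding.  Since
raising a chosen value does not change the optimal set, the probability of being
chosen is monotone in the value; hence an independent random threshold for each
item makes it active with odds yᵢ = α qᵢ and, when it is always accepted, earns
α vᵢ / (1 + yᵢ) from it.

Item i is accepted whenever every set S ∋ i of the family has fewer than r_S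
other active items.  The sets containing i form a chain, so for each rank r only
the largest such set S_r matters, and y(S_r) ≤ α r.  The factor 1/(1 + yᵢ) is
the probability that i is inactive; with it, i earns α vᵢ times the probability
that S_1 has no active item and every S_r, r ≥ 2, has fewer than r.  A sum of
independent indicators with total odds μ is dominated, in the likelihood ratio
order, by a Poisson variable of mean μ.  So the latter probability is at least
(1 - b₁)(1 - Σ_{r≥2} bᵣ) with bᵣ = P[Poisson(α r) ≥ r]: the first factor is the
probability of missing S_1, and conditionally on it a union bound applies.  For
α = 7/25 this gives E[ALG] ≥ (4/25) E[OPT], and 25/4 = 6.25 < 6.311 leaves room
for the rounding.  Some fixed choice of thresholds does as well as the random one.

If E[OPT] is infinite, then some single item that is not a loop has infinite
expectation, and accepting only that item suffices.
-}
module Submission where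

open import Algebra.Bundles using (RawRing)
import Algebra.Properties.AbelianGroup as AbelianGroupProperties
import Algebra.Properties.CommutativeSemigroup as CommutativeSemigroupProperties
import Algebra.Properties.CommutativeSemiring.Binomial as Binomial
import Algebra.Properties.Ring as RingProperties
import Algebra.Properties.Semiring.Exp as Exp
import Algebra.Properties.Semiring.Mult as Mult
import Algebra.Properties.Semiring.Mult.TCOptimised as Mult′
import Algebra.Properties.Semiring.Sum as Sum
import Algebra.Solver.Ring as RingSolver
open import Algebra.Solver.Ring.AlmostCommutativeRing
  using (fromCommutativeRing; _-Raw-AlmostCommutative⟶_)
open import Axiom.ExcludedMiddle using (ExcludedMiddle)
open import Data.Bool.Base using (Bool; true; false; if_then_else_; _∧_; not) renaming (T to True)
open import Data.Bool.Properties using (∧-zeroʳ)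
open import Data.Empty using (⊥)
open import Data.Fin.Base using (Fin; zero; suc; toℕ; fromℕ<)
open import Data.Fin.Properties as Fin using (toℕ-fromℕ<)
open import Data.Fin.Subset as Sub using (Subset; inside; outside; ∣_∣; ⁅_⁆)
open import Data.Fin.Subset.Properties
  using (∣p∣≤n; ∣⊥∣≡0; ∣⁅x⁆∣≡1; ∉⊥; x∈⁅x⁆; x∈⁅y⁆⇒x≡y; p⊆q⇒∣p∣≤∣q∣; x∈p∩q⁺; x∈p∩q⁻; p⊆p∪q; q⊆p∪q; x∈p∪q⁻; ∪-identityʳ; ∣p∩q∣≤∣p∣; _∈?_)
open import Data.Integer.Base as ℤ using (ℤ; +_; -[1+_])
import Data.Integer.Properties as ℤ
open import Data.List.Base as List using (List; []; _∷_; foldl; allFin; filter; _++_; length; foldr)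
import Data.List.Extrema as Extrema
open import Data.List.Membership.Propositional using () renaming (_∈_ to _∈ˡ_)
open import Data.List.Membership.Propositional.Properties
  using (∈-allFin; ∈-lookup; ∈-++⁺ˡ; ∈-++⁺ʳ; ∈-map⁺; ∈-filter⁺; ∈-filter⁻)
open import Data.List.Relation.Unary.All as All using (All; []; _∷_)
open import Data.List.Relation.Unary.All.Properties as All using (all-filter)
open import Data.List.Relation.Unary.Any using (here; there)
open import Data.Maybe.Base using (Maybe; just; nothing)
open import Data.Nat.Base as ℕ using (ℕ; zero; suc; _∸_; _!; _<ᵇ_)
import Data.Nat.Properties as ℕ
open import Data.Product.Base using (∃; _,_; proj₁; proj₂; _×_)
open import Data.Sum.Base using (_⊎_; inj₁; inj₂)
open import Data.Unit.Base using (tt)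
open import Data.Vec.Base as Vec using (Vec; []; _∷_; _[_]≔_; zipWith; lookup)
open import Data.Vec.Properties
  using (lookup∘update; []=⇒lookup; lookup⇒[]=; []≔-minimal; []≔-idempotent; lookup∘update′; []≔-lookup; lookup-replicate; lookup-zipWith)
open import Function.Base using (_∘_)
open import Level using (0ℓ; Lift; lift; lower) renaming (suc to lsuc)
open import Relation.Binary.Bundles using (TotalOrder; Poset)
open import Relation.Binary.Construct.Add.Supremum.NonStrict using ([_]; _≤⊤⁺)
open import Relation.Binary.Definitions using (tri<; tri≈; tri>)
open import Relation.Binary.PropositionalEquality.Core as ≡ using (_≡_; _≢_)
import Relation.Binary.Reasoning.PartialOrder as PosetReasoning
import Relation.Binary.Reasoning.Setoid as SetoidReasoning
open import Relation.Nullary using (¬_; yes; no; contradiction; Dec; does)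
open import Relation.Nullary.Construct.Add.Supremum using (_⁺; [_]; ⊤⁺)
open import Relation.Nullary.Decidable using (dec-true; decidable-stable)
open import Relation.Unary using (Pred; _∈_; _≐_; ∁; U; ⋃; _∩_; Satisfiable)
open import Defs

-- The expectations are suprema of lower sums, and neither `opt` nor `alg` is shown to be
-- measurable. Only two one-sided comparisons link them to a finite mean over grid levels: every
-- lower sum for OPT is at most such a mean plus a rounding error, and such a mean is itself a lower
-- sum for ALG. A finite grid suffices for unbounded values because a lower sum belongs to a simple
-- function, which is bounded.
--
-- Rounding is strict, so exceeding a grid threshold is a comparison of integers, and the average
-- over random grid thresholds supplies whatever probability is wanted.
--
-- Rank 1 has to be treated apart: at `α = 7/25` these tail bounds, subtracted from 1 all at once,
-- leave about 0.52, short of the required 4/7, while the product of the two factors is about 0.577.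
-- The product is available because missing `S_1` merely switches its items off, so that the
-- conditioned active set is again a product distribution with no larger odds.

-- Arithmetic in a complete ordered field

module OrderedField (R : CompleteOrderedField) where
  open CompleteOrderedField R hiding (zero) renaming (Carrier to ℝ)
  open RingProperties ring using (-‿distribˡ-*; -‿distribʳ-*; -‿involutive; -0#≈0#)
  open AbelianGroupProperties +-abelianGroup using (⁻¹-∙-comm)
  open Mult semiring using (×-homo-+; ×1-homo-*)
  private module M′ = Mult′ semiring
  open Sum semiring public using (sum-cong-≋; ∑-distrib-+; sum-replicate-zero; *-distribˡ-sum)

  module IntegerCoefficients where
    open SetoidReasoning setoid

    -- Integer coefficients give the ring solver a decidable equality. With the optimised multiple,
    -- the images of `+ 0` and `+ 1` compute to `0#` and `1#`, so `con (+ 1)` stands for `1#` in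
    -- solver goals.
    ⟦_⟧ᶻ : ℤ → ℝ
    ⟦ + n ⟧ᶻ      = n M′.× 1#
    ⟦ -[1+ n ] ⟧ᶻ = - (suc n M′.× 1#)

    private
      1+× : ∀ n → suc n M′.× 1# ≈ 1# + n M′.× 1#
      1+× n = M′.1+× n 1#

      cancel : ∀ a b → (1# + a) - (1# + b) ≈ a - b
      cancel a b = begin
        (1# + a) + - (1# + b)     ≈⟨ +-cong (+-comm 1# a) (sym (⁻¹-∙-comm 1# b)) ⟩
        (a + 1#) + (- 1# + - b)   ≈⟨ +-assoc a 1# _ ⟩
        a + (1# + (- 1# + - b))   ≈⟨ +-congˡ (+-assoc 1# (- 1#) (- b)) ⟨
        a + ((1# + - 1#) + - b)   ≈⟨ +-congˡ (+-congʳ (-‿inverseʳ 1#)) ⟩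
        a + (0# + - b)            ≈⟨ +-congˡ (+-identityˡ _) ⟩
        a + - b                   ∎

    ⊖-homo : ∀ m n → ⟦ m ℤ.⊖ n ⟧ᶻ ≈ m M′.× 1# - n M′.× 1#
    ⊖-homo m zero = begin
      m M′.× 1#        ≈⟨ +-identityʳ _ ⟨
      m M′.× 1# + 0#   ≈⟨ +-congˡ -0#≈0# ⟨
      m M′.× 1# - 0#   ∎
    ⊖-homo zero (suc n) = sym (+-identityˡ _)
    ⊖-homo (suc m) (suc n) = begin
      ⟦ suc m ℤ.⊖ suc n ⟧ᶻ                ≡⟨ ≡.cong ⟦_⟧ᶻ (ℤ.[1+m]⊖[1+n]≡m⊖n m n) ⟩
      ⟦ m ℤ.⊖ n ⟧ᶻ                        ≈⟨ ⊖-homo m n ⟩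
      m M′.× 1# - n M′.× 1#               ≈⟨ cancel _ _ ⟨
      (1# + m M′.× 1#) - (1# + n M′.× 1#) ≈⟨ +-cong (1+× m) (-‿cong (1+× n)) ⟨
      suc m M′.× 1# - suc n M′.× 1#       ∎

    +-homo : ∀ i j → ⟦ i ℤ.+ j ⟧ᶻ ≈ ⟦ i ⟧ᶻ + ⟦ j ⟧ᶻ
    +-homo (+ m) (+ n)           = M′.×-homo-+ 1# m n
    +-homo (+ m) -[1+ n ]        = ⊖-homo m (suc n)
    +-homo -[1+ m ] (+ n)        = trans (⊖-homo n (suc m)) (+-comm _ _)
    +-homo -[1+ m ] -[1+ n ]     = begin
      - (suc (suc (m ℕ.+ n)) M′.× 1#)            ≡⟨ ≡.cong (λ k → - (suc k M′.× 1#)) (ℕ.+-suc m n) ⟨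
      - ((suc m ℕ.+ suc n) M′.× 1#)              ≈⟨ -‿cong (M′.×-homo-+ 1# (suc m) (suc n)) ⟩
      - (suc m M′.× 1# + suc n M′.× 1#)          ≈⟨ ⁻¹-∙-comm _ _ ⟨
      - (suc m M′.× 1#) + - (suc n M′.× 1#)      ∎

    -‿homo : ∀ i → ⟦ ℤ.- i ⟧ᶻ ≈ - ⟦ i ⟧ᶻ
    -‿homo (+ zero)   = sym -0#≈0#
    -‿homo (+ suc n)  = refl
    -‿homo -[1+ n ]   = sym (-‿involutive _)

    *-homo⁺ : ∀ m j → ⟦ + m ℤ.* j ⟧ᶻ ≈ ⟦ + m ⟧ᶻ * ⟦ j ⟧ᶻ
    *-homo⁺ m (+ n) = begin
      ⟦ + m ℤ.* + n ⟧ᶻ       ≡⟨ ≡.cong ⟦_⟧ᶻ (ℤ.pos-* m n) ⟨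
      (m ℕ.* n) M′.× 1#      ≈⟨ M′.×1-homo-* m n ⟩
      ⟦ + m ⟧ᶻ * ⟦ + n ⟧ᶻ    ∎
    *-homo⁺ m -[1+ n ] = begin
      ⟦ + m ℤ.* -[1+ n ] ⟧ᶻ       ≡⟨ ≡.cong ⟦_⟧ᶻ (ℤ.neg-distribʳ-* (+ m) (+ suc n)) ⟨
      ⟦ ℤ.- (+ m ℤ.* + suc n) ⟧ᶻ  ≈⟨ -‿homo (+ m ℤ.* + suc n) ⟩
      - ⟦ + m ℤ.* + suc n ⟧ᶻ      ≈⟨ -‿cong (*-homo⁺ m (+ suc n)) ⟩
      - (⟦ + m ⟧ᶻ * ⟦ + suc n ⟧ᶻ) ≈⟨ -‿distribʳ-* _ _ ⟩
      ⟦ + m ⟧ᶻ * ⟦ -[1+ n ] ⟧ᶻ    ∎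

    *-homo : ∀ i j → ⟦ i ℤ.* j ⟧ᶻ ≈ ⟦ i ⟧ᶻ * ⟦ j ⟧ᶻ
    *-homo (+ m)    j = *-homo⁺ m j
    *-homo -[1+ m ] j = begin
      ⟦ -[1+ m ] ℤ.* j ⟧ᶻ         ≡⟨ ≡.cong ⟦_⟧ᶻ (ℤ.neg-distribˡ-* (+ suc m) j) ⟨
      ⟦ ℤ.- (+ suc m ℤ.* j) ⟧ᶻ    ≈⟨ -‿homo (+ suc m ℤ.* j) ⟩
      - ⟦ + suc m ℤ.* j ⟧ᶻ        ≈⟨ -‿cong (*-homo⁺ (suc m) j) ⟩
      - (⟦ + suc m ⟧ᶻ * ⟦ j ⟧ᶻ)   ≈⟨ -‿distribˡ-* _ _ ⟩
      ⟦ -[1+ m ] ⟧ᶻ * ⟦ j ⟧ᶻ      ∎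

    ℤ-rawRing : RawRing 0ℓ 0ℓ
    ℤ-rawRing = record
      { Carrier = ℤ ; _≈_ = _≡_ ; _+_ = ℤ._+_ ; _*_ = ℤ._*_
      ; -_ = ℤ.-_ ; 0# = + 0 ; 1# = + 1 }

    homomorphism : ℤ-rawRing -Raw-AlmostCommutative⟶ fromCommutativeRing commutativeRing
    homomorphism = record
      { ⟦_⟧ = ⟦_⟧ᶻ ; +-homo = +-homo ; *-homo = *-homo ; -‿homo = -‿homo
      ; 0-homo = refl ; 1-homo = refl }

    ⟦⟧ᶻ-≟ : ∀ i j → Maybe (⟦ i ⟧ᶻ ≈ ⟦ j ⟧ᶻ)
    ⟦⟧ᶻ-≟ i j with i ℤ.≟ j
    ... | yes ≡.refl = just refl
    ... | no _       = nothing

  open IntegerCoefficients using (⟦_⟧ᶻ)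
  module Solver = RingSolver IntegerCoefficients.ℤ-rawRing (fromCommutativeRing commutativeRing)
    IntegerCoefficients.homomorphism IntegerCoefficients.⟦⟧ᶻ-≟
  open Solver public using (solve; _:=_; _:+_; _:*_; _:-_; :-_; con)

  poset : Poset 0ℓ 0ℓ 0ℓ
  poset = TotalOrder.poset totalOrder

  open TotalOrder totalOrder public using (total)
    renaming (refl to ≤-refl; reflexive to ≤-reflexive; trans to ≤-trans; antisym to ≤-antisym)
  module ≤-Reasoning = PosetReasoning poset

  open ≤-Reasoning

  ≤-respˡ : ∀ {x y z} → x ≈ y → x ≤ z → y ≤ z
  ≤-respˡ e = ≤-trans (≤-reflexive (sym e))

  ≤-respʳ : ∀ {x y z} → y ≈ z → x ≤ y → x ≤ z
  ≤-respʳ e p = ≤-trans p (≤-reflexive e)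

  +-monoʳ-≤ : ∀ z {x y} → x ≤ y → z + x ≤ z + y
  +-monoʳ-≤ z {x} {y} p = begin
    z + x ≈⟨ +-comm z x ⟩ x + z ≤⟨ +-monoˡ-≤ z p ⟩ y + z ≈⟨ +-comm y z ⟩ z + y ∎

  +-mono-≤ : ∀ {x y u v} → x ≤ y → u ≤ v → x + u ≤ y + v
  +-mono-≤ {y = y} p q = ≤-trans (+-monoˡ-≤ _ p) (+-monoʳ-≤ y q)

  +-nonneg : ∀ {x y} → 0# ≤ x → 0# ≤ y → 0# ≤ x + y
  +-nonneg p q = ≤-respˡ (+-identityˡ 0#) (+-mono-≤ p q)

  x≤x+y : ∀ {x y} → 0# ≤ y → x ≤ x + y
  x≤x+y {x} p = ≤-respˡ (+-identityʳ x) (+-monoʳ-≤ x p)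

  x≤y+x : ∀ {x y} → 0# ≤ y → x ≤ y + x
  x≤y+x {x} p = ≤-respˡ (+-identityˡ x) (+-monoˡ-≤ x p)

  0≤y-x : ∀ {x y} → x ≤ y → 0# ≤ y - x
  0≤y-x {x} {y} p = ≤-respˡ (-‿inverseʳ x) (+-monoˡ-≤ (- x) p)

  0≤y-x⇒x≤y : ∀ {x y} → 0# ≤ y - x → x ≤ y
  0≤y-x⇒x≤y {x} {y} p = begin
    x ≈⟨ +-identityˡ x ⟨ 0# + x ≤⟨ +-monoˡ-≤ x p ⟩ (y - x) + x
      ≈⟨ solve 2 (λ x y → (y :- x) :+ x := y) refl x y ⟩ y ∎

  +-cancelʳ-≤ : ∀ z {x y} → x + z ≤ y + z → x ≤ y
  +-cancelʳ-≤ z {x} {y} p = 0≤y-x⇒x≤y (≤-respʳ (solve 3 (λ x y z → (y :+ z) :- (x :+ z) := y :- x) refl x y z) (0≤y-x p))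

  x+z≤y⇒x≤y-z : ∀ {x y} z → x + z ≤ y → x ≤ y - z
  x+z≤y⇒x≤y-z {x} {y} z p = +-cancelʳ-≤ z (≤-respʳ (solve 2 (λ y z → y := (y :- z) :+ z) refl y z) p)

  neg-mono-≤ : ∀ {x y} → x ≤ y → - y ≤ - x
  neg-mono-≤ {x} {y} p = 0≤y-x⇒x≤y (≤-respʳ (solve 2 (λ x y → y :- x := (:- x) :- (:- y)) refl x y) (0≤y-x p))

  *-monoˡ-≤ : ∀ {z x y} → 0# ≤ z → x ≤ y → z * x ≤ z * y
  *-monoˡ-≤ {z} {x} {y} p q = 0≤y-x⇒x≤y
    (≤-respʳ (solve 3 (λ x y z → z :* (y :- x) := (z :* y) :- (z :* x)) refl x y z) (*-nonneg p (0≤y-x q)))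

  *-monoʳ-≤ : ∀ {z x y} → 0# ≤ z → x ≤ y → x * z ≤ y * z
  *-monoʳ-≤ {z} {x} {y} p q = begin
    x * z ≈⟨ *-comm x z ⟩ z * x ≤⟨ *-monoˡ-≤ p q ⟩ z * y ≈⟨ *-comm z y ⟩ y * z ∎

  *-mono-≤ : ∀ {x y u v} → 0# ≤ u → 0# ≤ y → x ≤ y → u ≤ v → x * u ≤ y * v
  *-mono-≤ p q r s = ≤-trans (*-monoʳ-≤ p r) (*-monoˡ-≤ q s)

  0≤-x : ∀ {x} → x ≤ 0# → 0# ≤ - x
  0≤-x p = ≤-respˡ -0#≈0# (neg-mono-≤ p)

  0≤1 : 0# ≤ 1#
  0≤1 with total 0# 1#
  ... | inj₁ p = p
  ... | inj₂ p = ≤-respʳ (solve 0 (:- con (+ 1) :* :- con (+ 1) := con (+ 1)) refl) (*-nonneg q q)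
    where q = 0≤-x p

  infix 4 _<_
  _<_ : ℝ → ℝ → Set
  x < y = ¬ (y ≤ x)

  <⇒≤ : ∀ {x y} → x < y → x ≤ y
  <⇒≤ {x} {y} p with total x y
  ... | inj₁ q = q
  ... | inj₂ q = contradiction q p

  0<1 : 0# < 1#
  0<1 p = 0≉1 (≤-antisym 0≤1 p)

  0<⇒≉0 : ∀ {x} → 0# < x → ¬ (x ≈ 0#)
  0<⇒≉0 p e = p (≤-reflexive e)

  0<+ : ∀ {x y} → 0# < x → 0# ≤ y → 0# < x + y
  0<+ p q r = p (≤-trans (x≤x+y q) r)

  <-≤-trans : ∀ {x y z} → x < y → y ≤ z → x < z
  <-≤-trans p q r = p (≤-trans q r)

  ⁻¹-nonneg : ∀ {x} → 0# < x → 0# ≤ x ⁻¹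
  ⁻¹-nonneg {x} p with total 0# (x ⁻¹)
  ... | inj₁ q = q
  ... | inj₂ q = contradiction (begin
      1#            ≈⟨ *-inverseʳ x (0<⇒≉0 p) ⟨
      x * x ⁻¹      ≤⟨ *-monoˡ-≤ (<⇒≤ p) q ⟩
      x * 0#        ≈⟨ zeroʳ x ⟩
      0#            ∎) 0<1

  *-inverseˡ : ∀ {x} → 0# < x → x ⁻¹ * x ≈ 1#
  *-inverseˡ {x} p = trans (*-comm _ _) (*-inverseʳ x (0<⇒≉0 p))

  *-cancelˡ-≤ : ∀ {z x y} → 0# < z → z * x ≤ z * y → x ≤ y
  *-cancelˡ-≤ {z} {x} {y} p q = begin
    x               ≈⟨ drop x ⟨
    z ⁻¹ * (z * x)  ≤⟨ *-monoˡ-≤ (⁻¹-nonneg p) q ⟩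
    z ⁻¹ * (z * y)  ≈⟨ drop y ⟩
    y               ∎
    where
    drop : ∀ w → z ⁻¹ * (z * w) ≈ w
    drop w = trans (sym (*-assoc _ _ _)) (trans (*-congʳ (*-inverseˡ p)) (*-identityˡ w))

  *-cancelʳ-≤ : ∀ {z x y} → 0# < z → x * z ≤ y * z → x ≤ y
  *-cancelʳ-≤ p q = *-cancelˡ-≤ p (≤-respˡ (*-comm _ _) (≤-respʳ (*-comm _ _) q))

  0<* : ∀ {x y} → 0# < x → 0# < y → 0# < x * y
  0<* {x} {y} p q r = q (*-cancelˡ-≤ p (≤-respʳ (sym (zeroʳ x)) r))

  -- An abstract copy of fromℕ: large literals must not unfold.
  abstract
    ι : ℕ → ℝ
    ι = fromℕ

    ι≈fromℕ : ∀ n → ι n ≈ fromℕ n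
    ι≈fromℕ n = refl

    ι-0 : ι 0 ≈ 0#
    ι-0 = refl

    ι-suc : ∀ n → ι (suc n) ≈ 1# + ι n
    ι-suc n = refl

    ι-+ : ∀ m n → ι (m ℕ.+ n) ≈ ι m + ι n
    ι-+ = ×-homo-+ 1#

    ι-* : ∀ m n → ι (m ℕ.* n) ≈ ι m * ι n
    ι-* = ×1-homo-*

    ι-1 : ι 1 ≈ 1#
    ι-1 = +-identityʳ 1#

    0≤ι : ∀ n → 0# ≤ ι n
    0≤ι zero    = ≤-refl
    0≤ι (suc n) = +-nonneg 0≤1 (0≤ι n)

    ι-mono : ∀ {m n} → m ℕ.≤ n → ι m ≤ ι n
    ι-mono {n = n} ℕ.z≤n = 0≤ι n
    ι-mono (ℕ.s≤s p) = +-monoʳ-≤ 1# (ι-mono p)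

    0<ι : ∀ n .{{_ : ℕ.NonZero n}} → 0# < ι n
    0<ι (suc n) = 0<+ 0<1 (0≤ι n)

  open Exp semiring public using (_^_)

  ι-^ : ∀ m n → ι (m ℕ.^ n) ≈ ι m ^ n
  ι-^ m zero    = ι-1
  ι-^ m (suc n) = trans (ι-* m (m ℕ.^ n)) (*-congˡ (ι-^ m n))

  sum-cong : ∀ {n} {f g : Fin n → ℝ} → (∀ i → f i ≈ g i) → sum f ≈ sum g
  sum-cong = sum-cong-≋

  sum-mono : ∀ {n} {f g : Fin n → ℝ} → (∀ i → f i ≤ g i) → sum f ≤ sum g
  sum-mono {zero}  p = ≤-refl
  sum-mono {suc n} p = +-mono-≤ (p zero) (sum-mono (p ∘ suc))

  sum-nonneg : ∀ {n} {f : Fin n → ℝ} → (∀ i → 0# ≤ f i) → 0# ≤ sum f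
  sum-nonneg {zero}  p = ≤-refl
  sum-nonneg {suc n} p = +-nonneg (p zero) (sum-nonneg (p ∘ suc))

  sum-zero : ∀ {n} {f : Fin n → ℝ} → (∀ i → f i ≈ 0#) → sum f ≈ 0#
  sum-zero {n} p = trans (sum-cong p) (sum-replicate-zero n)

  term≤sum : ∀ {n} {f : Fin n → ℝ} → (∀ i → 0# ≤ f i) → ∀ i → f i ≤ sum f
  term≤sum p zero    = x≤x+y (sum-nonneg (p ∘ suc))
  term≤sum p (suc i) = ≤-trans (term≤sum (p ∘ suc) i) (x≤y+x (p zero))

  sum-const : ∀ n x → sum {n} (λ _ → x) ≈ ι n * x
  sum-const zero    x = sym (trans (*-congʳ ι-0) (zeroˡ x))
  sum-const (suc n) x = begin-equality
    x + sum {n} (λ _ → x)   ≈⟨ +-cong (sym (*-identityˡ x)) (sum-const n x) ⟩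
    1# * x + ι n * x        ≈⟨ distribʳ x 1# (ι n) ⟨
    (1# + ι n) * x          ≈⟨ *-congʳ (ι-suc n) ⟨
    ι (suc n) * x           ∎

-- Inequalities between powers, factorials and binomial coefficients

module Naturals where
  open import Data.Nat.Combinatorics using (_C_; nCn≡1; nCk≡nC[n∸k]; nCk+nC[k+1]≡[n+1]C[k+1])
  open import Data.Nat.Base
  open import Data.Nat.Properties
  open import Data.Nat.Solver using (module +-*-Solver)
  open +-*-Solver using (solve; _:=_; _:+_; _:*_; con)
  open ≤-Reasoning

  -- Bernoulli's inequality for `1 + 1/a`, multiplied by `a ^ suc m` so that no division occurs.
  bernoulli : ∀ a m → a ^ suc m + suc m * a ^ m ≤ suc a ^ suc m
  bernoulli a zero    = ≤-reflexive (solve 1 (λ a → a :* con 1 :+ con 1 := (con 1 :+ a) :* con 1) ≡.refl a)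
  bernoulli a (suc m) = begin
    a ^ suc (suc m) + suc (suc m) * a ^ suc m
      ≤⟨ m≤m+n _ (suc m * a ^ m) ⟩
    a ^ suc (suc m) + suc (suc m) * a ^ suc m + suc m * a ^ m
      ≡⟨ solve 3 (λ a p m → a :* (a :* p) :+ (con 2 :+ m) :* (a :* p) :+ (con 1 :+ m) :* p
                   := (con 1 :+ a) :* (a :* p :+ (con 1 :+ m) :* p)) ≡.refl a (a ^ m) m ⟩
    suc a * (a ^ suc m + suc m * a ^ m)
      ≤⟨ *-monoʳ-≤ (suc a) (bernoulli a m) ⟩
    suc a ^ suc (suc m) ∎

  ^-distribʳ-* : ∀ k m n → (m * n) ^ k ≡ m ^ k * n ^ k
  ^-distribʳ-* zero    m n = ≡.refl
  ^-distribʳ-* (suc k) m n = ≡.trans (≡.cong (m * n *_) (^-distribʳ-* k m n))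
    (solve 4 (λ m n p q → m :* n :* (p :* q) := m :* p :* (n :* q)) ≡.refl m n (m ^ k) (n ^ k))

  -- (1 + 1/r)^(r+1) decreases in r, by Bernoulli's inequality for 1 + 1/(r(r+2)).
  [1+1/r]^[r+1]≤3 : ∀ j → let r = 6 + j in suc r ^ suc r ≤ 3 * r ^ suc r
  [1+1/r]^[r+1]≤3 zero    = ≤ᵇ⇒≤ (7 ^ 7) (3 * 6 ^ 7) _
  [1+1/r]^[r+1]≤3 (suc j) = *-cancelˡ-≤ (r ^ suc r) {{m^n≢0 r (suc r)}} (begin
    r ^ suc r * (suc (suc r) * suc (suc r) ^ suc r)
      ≡⟨ solve 3 (λ p q s → p :* (q :* s) := q :* (p :* s)) ≡.refl (r ^ suc r) (2 + r) (suc (suc r) ^ suc r) ⟩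
    suc (suc r) * (r ^ suc r * suc (suc r) ^ suc r)
      ≡⟨ ≡.cong (suc (suc r) *_) (^-distribʳ-* (suc r) r (2 + r)) ⟨
    suc (suc r) * N ^ suc r
      ≡⟨ ≡.refl ⟩
    suc (suc r) * (N * N ^ r)
      ≤⟨ step ⟩
    suc r * (N ^ suc r + suc r * N ^ r)
      ≤⟨ *-monoʳ-≤ (suc r) (bernoulli N r) ⟩
    suc r * (suc N) ^ suc r
      ≡⟨ ≡.cong (λ z → suc r * z ^ suc r) (solve 1 (λ r → con 1 :+ r :* (con 2 :+ r) := (con 1 :+ r) :* (con 1 :+ r)) ≡.refl r) ⟩
    suc r * (suc r * suc r) ^ suc r
      ≡⟨ ≡.cong (suc r *_) (^-distribʳ-* (suc r) (suc r) (suc r)) ⟩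
    suc r * (suc r ^ suc r * suc r ^ suc r)
      ≤⟨ *-monoʳ-≤ (suc r) (*-monoˡ-≤ (suc r ^ suc r) ([1+1/r]^[r+1]≤3 j)) ⟩
    suc r * (3 * r ^ suc r * suc r ^ suc r)
      ≡⟨ solve 3 (λ s p q → s :* (con 3 :* p :* q) := p :* (con 3 :* (s :* q))) ≡.refl (suc r) (r ^ suc r) (suc r ^ suc r) ⟩
    r ^ suc r * (3 * (suc r * suc r ^ suc r)) ∎)
    where
    r = 6 + j
    N = r * suc (suc r)
    step : suc (suc r) * (N * N ^ r) ≤ suc r * (N ^ suc r + suc r * N ^ r)
    step = begin
      suc (suc r) * (N * N ^ r)
        ≤⟨ m≤n+m _ (N ^ r) ⟩
      N ^ r + suc (suc r) * (N * N ^ r)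
        ≡⟨ solve 2 (λ r p → p :+ (con 2 :+ r) :* (r :* (con 2 :+ r) :* p)
              := (con 1 :+ r) :* (r :* (con 2 :+ r) :* p :+ (con 1 :+ r) :* p)) ≡.refl r (N ^ r) ⟩
      suc r * (N ^ suc r + suc r * N ^ r) ∎

  [1+1/r]^r≤3 : ∀ j → let r = 6 + j in suc r ^ r ≤ 3 * r ^ r
  [1+1/r]^r≤3 j = *-cancelˡ-≤ r (begin
    r * suc r ^ r       ≤⟨ *-monoˡ-≤ (suc r ^ r) (n≤1+n r) ⟩
    suc r ^ suc r       ≤⟨ [1+1/r]^[r+1]≤3 j ⟩
    3 * (r * r ^ r)     ≡⟨ solve 2 (λ r p → con 3 :* (r :* p) := r :* (con 3 :* p)) ≡.refl r (r ^ r) ⟩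
    r * (3 * r ^ r)     ∎)
    where r = 6 + j

  -- The quotient of consecutive values of `(7 r)^r / r!` is `7 (1 + 1/r)^r`, which is at most 21.
  -- Equality holds at `r = 6`, where `720 = 6!`.
  [7r]^r-bound : ∀ j → let r = 6 + j in (7 * r) ^ r * 720 ≤ 42 ^ 6 * 21 ^ j * r !
  [7r]^r-bound zero    = ≤ᵇ⇒≤ ((7 * 6) ^ 6 * 720) (42 ^ 6 * 21 ^ 0 * 6 !) _
  [7r]^r-bound (suc j) = begin
    (7 * suc r) ^ suc r * 720
      ≡⟨ ≡.cong (λ z → 7 * suc r * z * 720) (^-distribʳ-* r 7 (suc r)) ⟩
    7 * suc r * (7 ^ r * suc r ^ r) * 720
      ≤⟨ *-monoˡ-≤ 720 (*-monoʳ-≤ (7 * suc r) (*-monoʳ-≤ (7 ^ r) ([1+1/r]^r≤3 j))) ⟩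
    7 * suc r * (7 ^ r * (3 * r ^ r)) * 720
      ≡⟨ solve 4 (λ s p q k → con 7 :* s :* (p :* (con 3 :* q)) :* k := con 21 :* s :* ((p :* q) :* k))
           ≡.refl (suc r) (7 ^ r) (r ^ r) 720 ⟩
    21 * suc r * (7 ^ r * r ^ r * 720)
      ≡⟨ ≡.cong (λ z → 21 * suc r * (z * 720)) (^-distribʳ-* r 7 r) ⟨
    21 * suc r * ((7 * r) ^ r * 720)
      ≤⟨ *-monoʳ-≤ (21 * suc r) ([7r]^r-bound j) ⟩
    21 * suc r * (42 ^ 6 * 21 ^ j * r !)
      ≡⟨ solve 4 (λ s p q f → con 21 :* s :* (p :* q :* f) := p :* (con 21 :* q) :* (s :* f))
           ≡.refl (suc r) (42 ^ 6) (21 ^ j) (r !) ⟩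
    42 ^ 6 * 21 ^ suc j * suc r ! ∎
    where r = 6 + j

  -- Pascal's rule reduces the step to `n^(k+1) + (k+1) n^k ≤ (n+1)^(k+1)`, an instance of
  -- `bernoulli`.
  nCk*k!≤n^k : ∀ n k → (n C k) * k ! ≤ n ^ k
  nCk*k!≤n^k n zero = ≤-reflexive (≡.trans (*-identityʳ (n C 0))
    (≡.trans (nCk≡nC[n∸k] {n = n} z≤n) (nCn≡1 n)))
  nCk*k!≤n^k zero (suc k) = z≤n
  nCk*k!≤n^k (suc n) (suc k) = begin
    (suc n C suc k) * suc k !
      ≡⟨ ≡.cong (_* suc k !) (nCk+nC[k+1]≡[n+1]C[k+1] n k) ⟨
    (n C k + n C suc k) * (suc k * k !)
      ≡⟨ solve 4 (λ a b k f → (a :+ b) :* (k :* f) := b :* (k :* f) :+ k :* (a :* f)) ≡.refl (n C k) (n C suc k) (suc k) (k !) ⟩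
    (n C suc k) * suc k ! + suc k * ((n C k) * k !)
      ≤⟨ +-mono-≤ (nCk*k!≤n^k n (suc k)) (*-monoʳ-≤ (suc k) (nCk*k!≤n^k n k)) ⟩
    n ^ suc k + suc k * n ^ k
      ≤⟨ bernoulli n k ⟩
    suc n ^ suc k ∎

-- Tails dominated by a Poisson variable

module PoissonTails (R : CompleteOrderedField) where
  open import Data.Nat.Combinatorics using (_C_)
  open import Data.Nat.Solver using (module +-*-Solver)
  open +-*-Solver using ()
    renaming (solve to ℕ-solve; con to ℕ-con; _:+_ to _ℕ:+_; _:*_ to _ℕ:*_; _:=_ to _ℕ:=_)
  open CompleteOrderedField R hiding (zero) renaming (Carrier to ℝ)
  open OrderedField R
  open Mult semiring using (×-assoc-*; ×-congʳ)
  open Sum semiring using (*-distribʳ-sum)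
  open Exp semiring using (^-congˡ)
  open ≤-Reasoning

  -- d k = P[S = k] and T k = P[S ≥ k] for a sum S of independent indicators;
  -- the ratio conditions say that S is dominated by a Poisson variable of
  -- mean x in the likelihood ratio order.
  record Tails (x : ℝ) : Set where
    field
      d T      : ℕ → ℝ
      d-nonneg : ∀ k → 0# ≤ d k
      T-nonneg : ∀ k → 0# ≤ T k
      T-zero   : T 0 ≈ 1#
      T-step   : ∀ k → T k ≈ d k + T (suc k)
      d-ratio  : ∀ k → ι (suc k) * d (suc k) ≤ x * d k
      T-ratio  : ∀ k → ι (suc k) * T (suc k) ≤ x * T k

  -- 25^j j! times the exponential series at X/25, truncated before degree j.
  incompleteExp : ℕ → ℕ → ℕ
  incompleteExp X zero    = 0
  incompleteExp X (suc j) = 25 ℕ.* suc j ℕ.* (incompleteExp X j ℕ.+ X ℕ.^ j)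

  tailNumerator tailDenominator : ℕ → ℕ
  tailNumerator   r = 25 ℕ.* suc r ℕ.* (7 ℕ.* r) ℕ.^ r
  tailDenominator r = tailNumerator r ℕ.+ (25 ℕ.+ 18 ℕ.* r) ℕ.* incompleteExp (7 ℕ.* r) r

  module _ {x : ℝ} (S : Tails x) (r : ℕ) (25x≤7r : ι 25 * x ≤ ι (7 ℕ.* r)) where
    open Tails S

    private
      X : ℕ
      X = 7 ℕ.* r
      c : ℕ → ℕ
      c = incompleteExp X

    ratio : ∀ (s : ℕ → ℝ) → (∀ k → 0# ≤ s k) → (∀ k → ι (suc k) * s (suc k) ≤ x * s k) →
            ∀ k → ι (25 ℕ.* suc k) * s (suc k) ≤ ι X * s k
    ratio s s≥0 h k = begin
      ι (25 ℕ.* suc k) * s (suc k)          ≈⟨ *-congʳ (ι-* 25 (suc k)) ⟩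
      ι 25 * ι (suc k) * s (suc k)      ≈⟨ *-assoc _ _ _ ⟩
      ι 25 * (ι (suc k) * s (suc k))    ≤⟨ *-monoˡ-≤ (0≤ι 25) (h k) ⟩
      ι 25 * (x * s k)                      ≈⟨ *-assoc _ _ _ ⟨
      ι 25 * x * s k                        ≤⟨ *-monoʳ-≤ (s≥0 k) 25x≤7r ⟩
      ι X * s k                             ∎

    d-ratio′ : ∀ k → ι (25 ℕ.* suc k) * d (suc k) ≤ ι X * d k
    d-ratio′ = ratio d d-nonneg d-ratio

    -- Read backwards, the ratio conditions give `d k ≥ d j (j!/k!) (25/X)^(j-k)` for `k < j`.
    -- Summing over `k` compares `1 - T j` with `d j`; clearing denominators turns the sum into
    -- `incompleteExp` and avoids dividing by `X`, which is 0 for `r = 0`.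
    head-bound : ∀ j → d j * ι (c j) ≤ ι (X ℕ.^ j) * (1# - T j)
    head-bound zero = ≤-reflexive (begin-equality
      d 0 * ι 0             ≈⟨ trans (*-congˡ ι-0) (zeroʳ _) ⟩
      0#                    ≈⟨ zeroʳ _ ⟨
      ι 1 * 0#          ≈⟨ *-congˡ (trans (+-congˡ (-‿cong T-zero)) (-‿inverseʳ 1#)) ⟨
      ι 1 * (1# - T 0)  ∎)
    head-bound (suc j) = begin
      d (suc j) * ι (25 ℕ.* suc j ℕ.* (c j ℕ.+ X ℕ.^ j))
        ≈⟨ *-congˡ (ι-* (25 ℕ.* suc j) (c j ℕ.+ X ℕ.^ j)) ⟩
      d (suc j) * (ι (25 ℕ.* suc j) * ι (c j ℕ.+ X ℕ.^ j))
        ≈⟨ solve 3 (λ a b e → a :* (b :* e) := (b :* a) :* e) refl (d (suc j)) (ι (25 ℕ.* suc j)) (ι (c j ℕ.+ X ℕ.^ j)) ⟩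
      (ι (25 ℕ.* suc j) * d (suc j)) * ι (c j ℕ.+ X ℕ.^ j)
        ≤⟨ *-monoʳ-≤ (0≤ι (c j ℕ.+ X ℕ.^ j)) (d-ratio′ j) ⟩
      (ι X * d j) * ι (c j ℕ.+ X ℕ.^ j)
        ≈⟨ *-congˡ (ι-+ (c j) (X ℕ.^ j)) ⟩
      (ι X * d j) * (ι (c j) + ι (X ℕ.^ j))
        ≈⟨ solve 4 (λ X d c p → (X :* d) :* (c :+ p) := X :* (d :* c) :+ X :* p :* d) refl
             (ι X) (d j) (ι (c j)) (ι (X ℕ.^ j)) ⟩
      ι X * (d j * ι (c j)) + ι X * ι (X ℕ.^ j) * d j
        ≤⟨ +-monoˡ-≤ _ (*-monoˡ-≤ (0≤ι X) (head-bound j)) ⟩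
      ι X * (ι (X ℕ.^ j) * (1# - T j)) + ι X * ι (X ℕ.^ j) * d j
        ≈⟨ solve 4 (λ X p t d → X :* (p :* (con (+ 1) :- t)) :+ X :* p :* d := X :* p :* (con (+ 1) :- (t :- d))) refl
             (ι X) (ι (X ℕ.^ j)) (T j) (d j) ⟩
      ι X * ι (X ℕ.^ j) * (1# - (T j - d j))
        ≈⟨ *-cong (sym (ι-* X (X ℕ.^ j))) (+-congˡ (-‿cong T-d)) ⟩
      ι (X ℕ.^ suc j) * (1# - T (suc j)) ∎
      where
      T-d : T j - d j ≈ T (suc j)
      T-d = trans (+-congʳ (T-step j)) (solve 2 (λ d t → (d :+ t) :- d := t) refl (d j) (T (suc j)))

    -- `T (suc r)` is at most the fraction `7 r / (25 (r + 1))` of `T r`, so `d r` makes up at least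
    -- the remaining `(25 + 18 r) / (25 (r + 1))`.
    T≤d : ι (25 ℕ.+ 18 ℕ.* r) * T r ≤ ι (25 ℕ.* suc r) * d r
    T≤d = +-cancelʳ-≤ (ι X * T r) (begin
      ι (25 ℕ.+ 18 ℕ.* r) * T r + ι X * T r
        ≈⟨ distribʳ _ _ _ ⟨
      (ι (25 ℕ.+ 18 ℕ.* r) + ι X) * T r
        ≈⟨ *-congʳ (ι-+ (25 ℕ.+ 18 ℕ.* r) X) ⟨
      ι (25 ℕ.+ 18 ℕ.* r ℕ.+ X) * T r
        ≡⟨ ≡.cong (λ z → ι z * T r) (ℕ-solve 1 (λ r → ℕ-con 25 ℕ:+ ℕ-con 18 ℕ:* r ℕ:+ ℕ-con 7 ℕ:* r ℕ:= ℕ-con 25 ℕ:* (ℕ-con 1 ℕ:+ r)) ≡.refl r) ⟩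
      ι (25 ℕ.* suc r) * T r
        ≈⟨ *-congˡ (T-step r) ⟩
      ι (25 ℕ.* suc r) * (d r + T (suc r))
        ≈⟨ distribˡ _ _ _ ⟩
      ι (25 ℕ.* suc r) * d r + ι (25 ℕ.* suc r) * T (suc r)
        ≤⟨ +-monoʳ-≤ _ (ratio T T-nonneg T-ratio r) ⟩
      ι (25 ℕ.* suc r) * d r + ι X * T r ∎)

    private
      numerator denominator : ℕ
      numerator   = tailNumerator r
      denominator = tailDenominator r

    -- Eliminating `d r` between `T≤d` and `head-bound` leaves an inequality that is linear in
    -- `T r`; numerator and denominator are read off from it.
    T-fraction : ι denominator * T r ≤ ι numerator
    T-fraction = begin
      ι denominator * T r
        ≈⟨ *-congʳ (trans (ι-+ numerator _) (+-congˡ (ι-* (25 ℕ.+ 18 ℕ.* r) (c r)))) ⟩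
      (ι numerator + ι (25 ℕ.+ 18 ℕ.* r) * ι (c r)) * T r
        ≈⟨ solve 4 (λ N D c T → (N :+ D :* c) :* T := N :* T :+ (D :* T) :* c) refl
             (ι numerator) (ι (25 ℕ.+ 18 ℕ.* r)) (ι (c r)) (T r) ⟩
      ι numerator * T r + (ι (25 ℕ.+ 18 ℕ.* r) * T r) * ι (c r)
        ≤⟨ +-monoʳ-≤ _ (*-monoʳ-≤ (0≤ι (c r)) T≤d) ⟩
      ι numerator * T r + (ι (25 ℕ.* suc r) * d r) * ι (c r)
        ≈⟨ +-congˡ (*-assoc _ _ _) ⟩
      ι numerator * T r + ι (25 ℕ.* suc r) * (d r * ι (c r))
        ≤⟨ +-monoʳ-≤ _ (*-monoˡ-≤ (0≤ι (25 ℕ.* suc r)) (head-bound r)) ⟩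
      ι numerator * T r + ι (25 ℕ.* suc r) * (ι (X ℕ.^ r) * (1# - T r))
        ≈⟨ +-congˡ (trans (sym (*-assoc _ _ _)) (*-congʳ (sym (ι-* (25 ℕ.* suc r) (X ℕ.^ r))))) ⟩
      ι numerator * T r + ι numerator * (1# - T r)
        ≈⟨ solve 2 (λ N T → N :* T :+ N :* (con (+ 1) :- T) := N) refl (ι numerator) (T r) ⟩
      ι numerator ∎

    -- The caller supplies `D` and `N` as literals, checked by `refl`, so that only a comparison of
    -- numerals remains. The bound is in units of 1/100000.
    T-bound : ∀ D N m → denominator ≡ D → numerator ≡ N → .{{ℕ.NonZero D}} →
              100000 ℕ.* N ℕ.≤ D ℕ.* m → ι 100000 * T r ≤ ι m
    T-bound D N m D≡ N≡ h = *-cancelˡ-≤ (0<ι D) (begin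
      ι D * (ι 100000 * T r)
        ≈⟨ solve 3 (λ D K T → D :* (K :* T) := K :* (D :* T)) refl (ι D) (ι 100000) (T r) ⟩
      ι 100000 * (ι D * T r)
        ≡⟨ ≡.cong (λ z → ι 100000 * (ι z * T r)) D≡ ⟨
      ι 100000 * (ι denominator * T r)
        ≤⟨ *-monoˡ-≤ (0≤ι 100000) T-fraction ⟩
      ι 100000 * ι numerator
        ≡⟨ ≡.cong (λ z → ι 100000 * ι z) N≡ ⟩
      ι 100000 * ι N
        ≈⟨ ι-* 100000 N ⟨
      ι (100000 ℕ.* N)
        ≤⟨ ι-mono h ⟩
      ι (D ℕ.* m)
        ≈⟨ ι-* D m ⟩
      ι D * ι m ∎)

    private
      -- For a Poisson variable `d k * k!` is geometric in `k`; `w-ratio` is the inequality that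
      -- survives domination.
      w : ℕ → ℝ
      w k = d k * ι (k !)

    w-ratio : ∀ m k → ι (25 ℕ.^ m) * w (m ℕ.+ k) ≤ ι (X ℕ.^ m) * w k
    w-ratio zero    k = ≤-refl
    w-ratio (suc m) k = begin
      ι (25 ℕ.^ suc m) * (d (suc j) * ι (suc j ℕ.* j !))
        ≈⟨ *-cong (ι-* 25 (25 ℕ.^ m)) (*-congˡ (ι-* (suc j) (j !))) ⟩
      ι 25 * p * (d (suc j) * (ι (suc j) * ι (j !)))
        ≈⟨ solve 5 (λ t p d s f → t :* p :* (d :* (s :* f)) := p :* f :* (t :* s :* d)) refl
             (ι 25) p (d (suc j)) (ι (suc j)) (ι (j !)) ⟩
      p * ι (j !) * (ι 25 * ι (suc j) * d (suc j))
        ≈⟨ *-congˡ (*-congʳ (ι-* 25 (suc j))) ⟨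
      p * ι (j !) * (ι (25 ℕ.* suc j) * d (suc j))
        ≤⟨ *-monoˡ-≤ (*-nonneg (0≤ι (25 ℕ.^ m)) (0≤ι (j !))) (d-ratio′ j) ⟩
      p * ι (j !) * (ι X * d j)
        ≈⟨ solve 4 (λ p f x d → p :* f :* (x :* d) := x :* (p :* (d :* f))) refl p (ι (j !)) (ι X) (d j) ⟩
      ι X * (p * w j)
        ≤⟨ *-monoˡ-≤ (0≤ι X) (w-ratio m k) ⟩
      ι X * (ι (X ℕ.^ m) * w k)
        ≈⟨ *-assoc _ _ _ ⟨
      ι X * ι (X ℕ.^ m) * w k
        ≈⟨ *-congʳ (ι-* X (X ℕ.^ m)) ⟨
      ι (X ℕ.^ suc m) * w k ∎
      where
      j = m ℕ.+ k
      p = ι (25 ℕ.^ m)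

    sum-d : ∀ m → sum {m} (λ k → d (toℕ k)) + T m ≈ 1#
    sum-d m = trans (go m 0) T-zero
      where
      go : ∀ m k → sum {m} (λ i → d (k ℕ.+ toℕ i)) + T (k ℕ.+ m) ≈ T k
      go zero    k = trans (+-identityˡ _) (reflexive (≡.cong T (ℕ.+-identityʳ k)))
      go (suc m) k = begin-equality
        (d (k ℕ.+ 0) + sum {m} (λ i → d (k ℕ.+ suc (toℕ i)))) + T (k ℕ.+ suc m)
          ≈⟨ +-assoc _ _ _ ⟩
        d (k ℕ.+ 0) + (sum {m} (λ i → d (k ℕ.+ suc (toℕ i))) + T (k ℕ.+ suc m))
          ≈⟨ +-cong (reflexive (≡.cong d (ℕ.+-identityʳ k)))
               (+-cong (sum-cong {m} (λ i → reflexive (≡.cong d (ℕ.+-suc k (toℕ i)))))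
                       (reflexive (≡.cong T (ℕ.+-suc k m)))) ⟩
        d k + (sum {m} (λ i → d (suc k ℕ.+ toℕ i)) + T (suc k ℕ.+ m))
          ≈⟨ +-congˡ (go m (suc k)) ⟩
        d k + T (suc k)
          ≈⟨ T-step k ⟨
        T k ∎

    -- This is one term of the expansion of `32^r = (7 + 25)^r`. Passing from `w r` to `w k` turns
    -- `25^(r-k)` into `X^(r-k)`, and `C(r,k) k! ≤ r^k` turns the rest into `(7 r)^k = X^k`.
    binomialTerm-bound : ∀ (i : Fin (suc r)) →
      Binomial.binomialTerm commutativeSemiring (ι 7) (ι 25) r i * w r ≤ ι (X ℕ.^ r) * d (toℕ i)
    binomialTerm-bound i = begin
      Binomial.binomialTerm commutativeSemiring (ι 7) (ι 25) r i * w r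
        ≈⟨ *-congʳ (trans (×-congʳ (r C k) (sym (*-identityˡ _))) (trans (sym (×-assoc-* (r C k) 1# _)) (*-congʳ (sym (ι≈fromℕ (r C k)))))) ⟩
      ι (r C k) * (ι 7 ^ k * ι 25 ^ m) * w r
        ≈⟨ *-congʳ (*-congˡ (*-cong (sym (ι-^ 7 k)) (sym (ι-^ 25 m)))) ⟩
      ι (r C k) * (ι (7 ℕ.^ k) * ι (25 ℕ.^ m)) * w r
        ≈⟨ solve 4 (λ a b e w → a :* (b :* e) :* w := a :* b :* (e :* w)) refl
             (ι (r C k)) (ι (7 ℕ.^ k)) (ι (25 ℕ.^ m)) (w r) ⟩
      ι (r C k) * ι (7 ℕ.^ k) * (ι (25 ℕ.^ m) * w r)
        ≡⟨ ≡.cong (λ z → ι (r C k) * ι (7 ℕ.^ k) * (ι (25 ℕ.^ m) * w z)) (≡.sym m+k≡r) ⟩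
      ι (r C k) * ι (7 ℕ.^ k) * (ι (25 ℕ.^ m) * w (m ℕ.+ k))
        ≤⟨ *-monoˡ-≤ (*-nonneg (0≤ι (r C k)) (0≤ι (7 ℕ.^ k))) (w-ratio m k) ⟩
      ι (r C k) * ι (7 ℕ.^ k) * (ι (X ℕ.^ m) * (d k * ι (k !)))
        ≈⟨ solve 5 (λ a b e d f → a :* b :* (e :* (d :* f)) := a :* f :* (b :* (e :* d))) refl
             (ι (r C k)) (ι (7 ℕ.^ k)) (ι (X ℕ.^ m)) (d k) (ι (k !)) ⟩
      ι (r C k) * ι (k !) * (ι (7 ℕ.^ k) * (ι (X ℕ.^ m) * d k))
        ≤⟨ *-monoʳ-≤ (*-nonneg (0≤ι (7 ℕ.^ k)) (*-nonneg (0≤ι (X ℕ.^ m)) (d-nonneg k)))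
             (≤-respˡ (ι-* (r C k) (k !)) (ι-mono (Naturals.nCk*k!≤n^k r k))) ⟩
      ι (r ℕ.^ k) * (ι (7 ℕ.^ k) * (ι (X ℕ.^ m) * d k))
        ≈⟨ solve 4 (λ a b e d → a :* (b :* (e :* d)) := e :* (b :* a) :* d) refl
             (ι (r ℕ.^ k)) (ι (7 ℕ.^ k)) (ι (X ℕ.^ m)) (d k) ⟩
      ι (X ℕ.^ m) * (ι (7 ℕ.^ k) * ι (r ℕ.^ k)) * d k
        ≈⟨ *-congʳ (*-congˡ (trans (sym (ι-* (7 ℕ.^ k) (r ℕ.^ k)))
             (reflexive (≡.cong ι (≡.sym (Naturals.^-distribʳ-* k 7 r)))))) ⟩
      ι (X ℕ.^ m) * ι (X ℕ.^ k) * d k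
        ≈⟨ *-congʳ (trans (sym (ι-* (X ℕ.^ m) (X ℕ.^ k)))
             (reflexive (≡.cong ι (≡.trans (≡.sym (ℕ.^-distribˡ-+-* X m k)) (≡.cong (X ℕ.^_) m+k≡r))))) ⟩
      ι (X ℕ.^ r) * d k ∎
      where
      k = toℕ i
      m = r ∸ k
      m+k≡r : m ℕ.+ k ≡ r
      m+k≡r = ℕ.m∸n+n≡m (Fin.toℕ≤pred[n] i)

    -- Σₖ≤ᵣ (αr)^k/k! ≥ (1 + α)^r by the binomial theorem, which bounds d r by
    -- r^r/r! (α/(1 + α))^r with α/(1 + α) = 7/32.
    d-bound : ι (32 ℕ.^ r) * w r ≤ ι (X ℕ.^ r)
    d-bound = begin
      ι (32 ℕ.^ r) * w r
        ≈⟨ *-congʳ (trans (ι-^ 32 r) (^-congˡ r (ι-+ 7 25))) ⟩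
      (ι 7 + ι 25) ^ r * w r
        ≈⟨ *-congʳ (Binomial.theorem commutativeSemiring r (ι 7) (ι 25)) ⟩
      sum {suc r} (Binomial.binomialTerm commutativeSemiring (ι 7) (ι 25) r) * w r
        ≈⟨ *-distribʳ-sum {suc r} (w r) (Binomial.binomialTerm commutativeSemiring (ι 7) (ι 25) r) ⟩
      sum {suc r} (λ i → Binomial.binomialTerm commutativeSemiring (ι 7) (ι 25) r i * w r)
        ≤⟨ sum-mono {suc r} binomialTerm-bound ⟩
      sum {suc r} (λ i → ι (X ℕ.^ r) * d (toℕ i))
        ≈⟨ *-distribˡ-sum {suc r} (ι (X ℕ.^ r)) (λ i → d (toℕ i)) ⟨
      ι (X ℕ.^ r) * sum {suc r} (λ i → d (toℕ i))
        ≤⟨ *-monoˡ-≤ (0≤ι (X ℕ.^ r)) (≤-respʳ (sum-d (suc r)) (x≤x+y (T-nonneg (suc r)))) ⟩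
      ι (X ℕ.^ r) * 1#
        ≈⟨ *-identityʳ _ ⟩
      ι (X ℕ.^ r) ∎

  module _ {x : ℝ} (S : Tails x) (j : ℕ) (25x≤7r : ι 25 * x ≤ ι (7 ℕ.* (6 ℕ.+ j))) where
    open Tails S

    private
      r : ℕ
      r = 6 ℕ.+ j

    d-geometric : ι 720 * (ι (32 ℕ.^ r) * d r) ≤ ι (42 ℕ.^ 6 ℕ.* 21 ℕ.^ j)
    d-geometric = *-cancelʳ-≤ (0<ι (r !) {{ℕ._!≢0 r}}) (begin
      ι 720 * (ι (32 ℕ.^ r) * d r) * ι (r !)
        ≈⟨ solve 4 (λ a b d f → a :* (b :* d) :* f := b :* (d :* f) :* a) refl
             (ι 720) (ι (32 ℕ.^ r)) (d r) (ι (r !)) ⟩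
      ι (32 ℕ.^ r) * (d r * ι (r !)) * ι 720
        ≤⟨ *-monoʳ-≤ (0≤ι 720) (d-bound S r 25x≤7r) ⟩
      ι ((7 ℕ.* r) ℕ.^ r) * ι 720
        ≈⟨ ι-* ((7 ℕ.* r) ℕ.^ r) 720 ⟨
      ι ((7 ℕ.* r) ℕ.^ r ℕ.* 720)
        ≤⟨ ι-mono (Naturals.[7r]^r-bound j) ⟩
      ι (42 ℕ.^ 6 ℕ.* 21 ℕ.^ j ℕ.* r !)
        ≈⟨ ι-* (42 ℕ.^ 6 ℕ.* 21 ℕ.^ j) (r !) ⟩
      ι (42 ℕ.^ 6 ℕ.* 21 ℕ.^ j) * ι (r !) ∎)

    -- The factor `25 (r + 1) / (25 + 18 r)` from `T≤d` increases to the limit `25/18`.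
    T≤25/18d : ι 18 * T r ≤ ι 25 * d r
    T≤25/18d = *-cancelˡ-≤ (0<ι (suc r)) (begin
      ι (suc r) * (ι 18 * T r)
        ≈⟨ *-assoc _ _ _ ⟨
      ι (suc r) * ι 18 * T r
        ≈⟨ *-congʳ (ι-* (suc r) 18) ⟨
      ι (suc r ℕ.* 18) * T r
        ≤⟨ *-monoʳ-≤ (T-nonneg r) (ι-mono (ℕ.+-mono-≤ (ℕ.m≤m+n 18 7) (ℕ.≤-reflexive (ℕ.*-comm r 18)))) ⟩
      ι (25 ℕ.+ 18 ℕ.* r) * T r
        ≤⟨ T≤d S r 25x≤7r ⟩
      ι (25 ℕ.* suc r) * d r
        ≈⟨ *-congʳ (trans (ι-* 25 (suc r)) (*-comm _ _)) ⟩
      ι (suc r) * ι 25 * d r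
        ≈⟨ *-assoc _ _ _ ⟩
      ι (suc r) * (ι 25 * d r) ∎)

    -- (25/18) 6^6/6! (7/32)^6 ≤ 987/100000; from r = 6 on, the bound
    -- (25/18) r^r/r! (7/32)^r shrinks by 3 · 7/32 = 21/32 at every step.
    T-geometric : ι 100000 * (ι (32 ℕ.^ j) * T r) ≤ ι 987 * ι (21 ℕ.^ j)
    T-geometric = *-cancelˡ-≤ (0<ι K) (begin
      ι K * (ι 100000 * (ι (32 ℕ.^ j) * T r))
        ≈⟨ *-congʳ (trans (ι-* 18 (720 ℕ.* 32 ℕ.^ 6)) (*-congˡ (ι-* 720 (32 ℕ.^ 6)))) ⟩
      ι 18 * (ι 720 * ι (32 ℕ.^ 6)) * (ι 100000 * (ι (32 ℕ.^ j) * T r))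
        ≈⟨ solve 6 (λ a b c e f t → a :* (b :* c) :* (e :* (f :* t)) := e :* (b :* (c :* f) :* (a :* t))) refl
             (ι 18) (ι 720) (ι (32 ℕ.^ 6)) (ι 100000) (ι (32 ℕ.^ j)) (T r) ⟩
      ι 100000 * (ι 720 * (ι (32 ℕ.^ 6) * ι (32 ℕ.^ j)) * (ι 18 * T r))
        ≈⟨ *-congˡ (*-congʳ (*-congˡ (trans (sym (ι-* (32 ℕ.^ 6) (32 ℕ.^ j)))
             (reflexive (≡.cong ι (≡.sym (ℕ.^-distribˡ-+-* 32 6 j))))))) ⟩
      ι 100000 * (ι 720 * ι (32 ℕ.^ r) * (ι 18 * T r))
        ≤⟨ *-monoˡ-≤ (0≤ι 100000) (*-monoˡ-≤ (*-nonneg (0≤ι 720) (0≤ι (32 ℕ.^ r))) T≤25/18d) ⟩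
      ι 100000 * (ι 720 * ι (32 ℕ.^ r) * (ι 25 * d r))
        ≈⟨ solve 5 (λ a b c e d → a :* (b :* c :* (e :* d)) := a :* e :* (b :* (c :* d))) refl
             (ι 100000) (ι 720) (ι (32 ℕ.^ r)) (ι 25) (d r) ⟩
      ι 100000 * ι 25 * (ι 720 * (ι (32 ℕ.^ r) * d r))
        ≤⟨ *-monoˡ-≤ (*-nonneg (0≤ι 100000) (0≤ι 25)) d-geometric ⟩
      ι 100000 * ι 25 * ι (42 ℕ.^ 6 ℕ.* 21 ℕ.^ j)
        ≈⟨ *-cong (sym (ι-* 100000 25)) (ι-* (42 ℕ.^ 6) (21 ℕ.^ j)) ⟩
      ι (100000 ℕ.* 25) * (ι (42 ℕ.^ 6) * ι (21 ℕ.^ j))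
        ≈⟨ *-assoc _ _ _ ⟨
      ι (100000 ℕ.* 25) * ι (42 ℕ.^ 6) * ι (21 ℕ.^ j)
        ≈⟨ *-congʳ (ι-* (100000 ℕ.* 25) (42 ℕ.^ 6)) ⟨
      ι (100000 ℕ.* 25 ℕ.* 42 ℕ.^ 6) * ι (21 ℕ.^ j)
        ≤⟨ *-monoʳ-≤ (0≤ι (21 ℕ.^ j)) (ι-mono (ℕ.≤ᵇ⇒≤ (100000 ℕ.* 25 ℕ.* 42 ℕ.^ 6) (K ℕ.* 987) _)) ⟩
      ι (K ℕ.* 987) * ι (21 ℕ.^ j)
        ≈⟨ trans (*-congʳ (ι-* K 987)) (*-assoc _ _ _) ⟩
      ι K * (ι 987 * ι (21 ℕ.^ j)) ∎)
      where
      K = 18 ℕ.* (720 ℕ.* 32 ℕ.^ 6)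

-- Numerical bound on the probability of being blocked

module BlockingProbability (R : CompleteOrderedField) where
  open CompleteOrderedField R hiding (zero) renaming (Carrier to ℝ)
  open OrderedField R
  open PoissonTails R
  open ≤-Reasoning

  -- The constant `32/11` is `1 / (1 - 21/32)`. Keeping `K` and `M` as separate parameters lets the
  -- induction pass to the shifted sequence with `32 K` and `21 M` instead of dividing.
  geometric-sum : ∀ m (τ : ℕ → ℝ) {K M} → 0# ≤ M →
    (∀ j → K * (ι (32 ℕ.^ j) * τ j) ≤ M * ι (21 ℕ.^ j)) →
    ι 11 * (K * sum {m} (λ j → τ (toℕ j))) ≤ ι 32 * M
  geometric-sum zero τ {K} {M} 0≤M h = begin
    ι 11 * (K * 0#) ≈⟨ trans (*-congˡ (zeroʳ K)) (zeroʳ _) ⟩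
    0#                  ≤⟨ *-nonneg (0≤ι 32) 0≤M ⟩
    ι 32 * M        ∎
  geometric-sum (suc m) τ {K} {M} 0≤M h = *-cancelˡ-≤ (0<ι 32) (begin
    ι 32 * (ι 11 * (K * (τ 0 + S)))
      ≈⟨ solve 5 (λ a b k t s → a :* (b :* (k :* (t :+ s))) := a :* b :* (k :* t) :+ b :* (a :* k :* s)) refl
           (ι 32) (ι 11) K (τ 0) S ⟩
    ι 32 * ι 11 * (K * τ 0) + ι 11 * (ι 32 * K * S)
      ≤⟨ +-mono-≤ (*-monoˡ-≤ (*-nonneg (0≤ι 32) (0≤ι 11)) first) rest ⟩
    ι 32 * ι 11 * M + ι 32 * (ι 21 * M)
      ≈⟨ solve 4 (λ a b c m → a :* b :* m :+ a :* (c :* m) := a :* ((b :+ c) :* m)) refl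
           (ι 32) (ι 11) (ι 21) M ⟩
    ι 32 * ((ι 11 + ι 21) * M)
      ≈⟨ *-congˡ (*-congʳ (ι-+ 11 21)) ⟨
    ι 32 * (ι 32 * M) ∎)
    where
    S = sum {m} (λ j → τ (suc (toℕ j)))
    first : K * τ 0 ≤ M
    first = begin
      K * τ 0                 ≈⟨ *-congˡ (trans (*-congʳ ι-1) (*-identityˡ _)) ⟨
      K * (ι 1 * τ 0)     ≤⟨ h 0 ⟩
      M * ι 1             ≈⟨ trans (*-congˡ ι-1) (*-identityʳ M) ⟩
      M                       ∎
    rest : ι 11 * (ι 32 * K * S) ≤ ι 32 * (ι 21 * M)
    rest = geometric-sum m (τ ∘ suc) (*-nonneg (0≤ι 21) 0≤M) λ j → begin
      ι 32 * K * (ι (32 ℕ.^ j) * τ (suc j))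
        ≈⟨ solve 4 (λ a k p t → a :* k :* (p :* t) := k :* (a :* p :* t)) refl
             (ι 32) K (ι (32 ℕ.^ j)) (τ (suc j)) ⟩
      K * (ι 32 * ι (32 ℕ.^ j) * τ (suc j))
        ≈⟨ *-congˡ (*-congʳ (ι-* 32 (32 ℕ.^ j))) ⟨
      K * (ι (32 ℕ.^ suc j) * τ (suc j))
        ≤⟨ h (suc j) ⟩
      M * ι (21 ℕ.^ suc j)
        ≈⟨ *-congˡ (ι-* 21 (21 ℕ.^ j)) ⟩
      M * (ι 21 * ι (21 ℕ.^ j))
        ≈⟨ solve 3 (λ m a p → m :* (a :* p) := a :* m :* p) refl M (ι 21) (ι (21 ℕ.^ j)) ⟩
      ι 21 * M * ι (21 ℕ.^ j) ∎

  sum-grow : ∀ m k (τ : ℕ → ℝ) → (∀ r → 0# ≤ τ r) →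
             sum {m} (λ j → τ (toℕ j)) ≤ sum {k ℕ.+ m} (λ j → τ (toℕ j))
  sum-grow zero    k τ h = sum-nonneg {k ℕ.+ 0} (λ j → h (toℕ j))
  sum-grow (suc m) k τ h rewrite ℕ.+-suc k m = +-monoʳ-≤ (τ 0) (sum-grow m k (τ ∘ suc) (h ∘ suc))

  -- Every rank has its own variable and its own mean: rank 1 is measured unconditionally, the
  -- higher ranks after conditioning.
  IsTail : ℕ → ℝ → Set
  IsTail r t = ∃ λ x → ∃ λ (S : Tails x) → (ι 25 * x ≤ ι (7 ℕ.* r)) × (t ≈ Tails.T S r)

  module _ (τ : ℕ → ℝ) (isTail : ∀ r → IsTail r (τ r)) where

    private
      E : ℝ
      E = ι 100000
      0≤E : 0# ≤ E
      0≤E = 0≤ι 100000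

    τ-nonneg : ∀ r → 0# ≤ τ r
    τ-nonneg r with isTail r
    ... | _ , S , _ , e = ≤-respʳ (sym e) (Tails.T-nonneg S r)

    private
      bound : ∀ r D N m → tailDenominator r ≡ D → tailNumerator r ≡ N → .{{ℕ.NonZero D}} →
              100000 ℕ.* N ℕ.≤ D ℕ.* m → E * τ r ≤ ι m
      bound r D N m p q h with isTail r
      ... | _ , S , b , e = ≤-respˡ (*-congˡ (sym e)) (T-bound S r b D N m p q h)

    -- τ r is at most the probability that a Poisson variable of mean 7r/25 is at
    -- least r, here in units of 1/100000.
    τ₁ : E * τ 1 ≤ ι 24562
    τ₁ = bound 1 1425 350 24562 ≡.refl ≡.refl (ℕ.≤ᵇ⇒≤ (100000 ℕ.* 350) (1425 ℕ.* 24562) _)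

    τ₂ : E * τ 2 ≤ ι 10999
    τ₂ = bound 2 133650 14700 10999 ≡.refl ≡.refl (ℕ.≤ᵇ⇒≤ (100000 ℕ.* 14700) (133650 ℕ.* 10999) _)

    τ₃ : E * τ 3 ≤ ι 5395
    τ₃ = bound 3 17166525 926100 5395 ≡.refl ≡.refl (ℕ.≤ᵇ⇒≤ (100000 ℕ.* 926100) (17166525 ℕ.* 5395) _)

    τ₄ : E * τ 4 ≤ ι 2756
    τ₄ = bound 4 2788001400 76832000 2756 ≡.refl ≡.refl (ℕ.≤ᵇ⇒≤ (100000 ℕ.* 76832000) (2788001400 ℕ.* 2756) _)

    τ₅ : E * τ 5 ≤ ι 1442
    τ₅ = bound 5 546590390625 7878281250 1442 ≡.refl ≡.refl (ℕ.≤ᵇ⇒≤ (100000 ℕ.* 7878281250) (546590390625 ℕ.* 1442) _)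

    -- `2872` is `987 * 32/11` rounded up, where `987` is the leading constant of `T-geometric`.
    tail-sum : ∀ m → E * sum {m} (λ j → τ (6 ℕ.+ toℕ j)) ≤ ι 2872
    tail-sum m = *-cancelˡ-≤ (0<ι 11) (begin
      ι 11 * (E * sum {m} (λ j → τ (6 ℕ.+ toℕ j)))
        ≤⟨ geometric-sum m (λ j → τ (6 ℕ.+ j)) (0≤ι 987) geometric ⟩
      ι 32 * ι 987
        ≈⟨ ι-* 32 987 ⟨
      ι (32 ℕ.* 987)
        ≤⟨ ι-mono (ℕ.≤ᵇ⇒≤ (32 ℕ.* 987) (11 ℕ.* 2872) _) ⟩
      ι (11 ℕ.* 2872)
        ≈⟨ ι-* 11 2872 ⟩
      ι 11 * ι 2872 ∎)
      where
      geometric : ∀ j → E * (ι (32 ℕ.^ j) * τ (6 ℕ.+ j)) ≤ ι 987 * ι (21 ℕ.^ j)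
      geometric j with isTail (6 ℕ.+ j)
      ... | _ , S , b , e = ≤-respˡ (*-congˡ (*-congˡ (sym e))) (T-geometric S j b)

    rest-sum : ∀ m → E * sum {m} (λ j → τ (2 ℕ.+ toℕ j)) ≤ ι 23464
    rest-sum m = begin
      E * sum {m} (λ j → τ (2 ℕ.+ toℕ j))
        -- Four more terms are appended so that ranks 2 to 5 can be split off even when `m < 4`.
        ≤⟨ *-monoˡ-≤ 0≤E (sum-grow m 4 (λ j → τ (2 ℕ.+ j)) (λ j → τ-nonneg (2 ℕ.+ j))) ⟩
      E * (τ 2 + (τ 3 + (τ 4 + (τ 5 + s))))
        ≈⟨ solve 6 (λ e a b c d s → e :* (a :+ (b :+ (c :+ (d :+ s)))) := e :* a :+ (e :* b :+ (e :* c :+ (e :* d :+ e :* s)))) refl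
             E (τ 2) (τ 3) (τ 4) (τ 5) s ⟩
      E * τ 2 + (E * τ 3 + (E * τ 4 + (E * τ 5 + E * s)))
        ≤⟨ +-mono-≤ τ₂ (+-mono-≤ τ₃ (+-mono-≤ τ₄ (+-mono-≤ τ₅ (tail-sum m)))) ⟩
      ι 10999 + (ι 5395 + (ι 2756 + (ι 1442 + ι 2872)))
        ≈⟨ trans (ι-+ 10999 12465) (+-congˡ (trans (ι-+ 5395 7070)
             (+-congˡ (trans (ι-+ 2756 4314) (+-congˡ (ι-+ 1442 2872)))))) ⟨
      ι 23464 ∎
      where
      s = sum {m} (λ j → τ (6 ℕ.+ toℕ j))

    private
      complement : ∀ k l {t} → E * t ≤ ι k → l ℕ.+ k ≡ 100000 → ι l ≤ E * (1# - t)
      complement k l {t} h e = begin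
        ι l                        ≤⟨ x+z≤y⇒x≤y-z (E * t) (≤-respʳ (trans (sym (ι-+ l k)) (reflexive (≡.cong ι e))) (+-monoʳ-≤ (ι l) h)) ⟩
        E - E * t                      ≈⟨ solve 2 (λ e t → e :- e :* t := e :* (con (+ 1) :- t)) refl E t ⟩
        E * (1# - t)                   ∎

    -- The target `4/7` is chosen so that `7/25 * 4/7 = 4/25`. The numbers 75438 and 76536 are what
    -- `τ₁` and `rest-sum` leave of 100000.
    survival : ∀ m → ι 4 ≤ ι 7 * ((1# - τ 1) * (1# - sum {m} (λ j → τ (2 ℕ.+ toℕ j))))
    survival m = *-cancelˡ-≤ (0<* (0<ι 100000) (0<ι 100000)) (begin
      E * E * ι 4
        ≈⟨ trans (ι-* (100000 ℕ.* 100000) 4) (*-congʳ (ι-* 100000 100000)) ⟨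
      ι (100000 ℕ.* 100000 ℕ.* 4)
        ≤⟨ ι-mono (ℕ.≤ᵇ⇒≤ (100000 ℕ.* 100000 ℕ.* 4) (7 ℕ.* (75438 ℕ.* 76536)) _) ⟩
      ι (7 ℕ.* (75438 ℕ.* 76536))
        ≈⟨ trans (ι-* 7 (75438 ℕ.* 76536)) (*-congˡ (ι-* 75438 76536)) ⟩
      ι 7 * (ι 75438 * ι 76536)
        ≤⟨ *-monoˡ-≤ (0≤ι 7) (*-mono-≤ (0≤ι 76536) (≤-trans (0≤ι 75438) p) p
             (complement 23464 76536 (rest-sum m) ≡.refl)) ⟩
      ι 7 * (E * (1# - τ 1) * (E * (1# - s)))
        ≈⟨ solve 4 (λ a e x y → a :* (e :* x :* (e :* y)) := e :* e :* (a :* (x :* y))) refl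
             (ι 7) E (1# - τ 1) (1# - s) ⟩
      E * E * (ι 7 * ((1# - τ 1) * (1# - s))) ∎)
      where
      s = sum {m} (λ j → τ (2 ℕ.+ toℕ j))
      p : ι 75438 ≤ E * (1# - τ 1)
      p = complement 24562 75438 τ₁ ≡.refl

-- Indicators and finitely supported expectations

module Expectation (lem : ∀ {ℓ} → ExcludedMiddle ℓ) (R : CompleteOrderedField) where
  open Prophet lem R hiding (zero)
  open OrderedField R
  open ≤-Reasoning

  𝟙-yes : ∀ {P : Set} → P → 𝟙 P ≈ 1#
  𝟙-yes {P} p with lem {P = P}
  ... | yes _ = refl
  ... | no ¬p = contradiction p ¬p

  𝟙-no : ∀ {P : Set} → ¬ P → 𝟙 P ≈ 0#
  𝟙-no {P} ¬p with lem {P = P}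
  ... | yes p = contradiction p ¬p
  ... | no _  = refl

  𝟙-nonneg : ∀ (P : Set) → 0# ≤ 𝟙 P
  𝟙-nonneg P with lem {P = P}
  ... | yes _ = 0≤1
  ... | no _  = ≤-refl

  𝟙≤1 : ∀ (P : Set) → 𝟙 P ≤ 1#
  𝟙≤1 P with lem {P = P}
  ... | yes _ = ≤-refl
  ... | no _  = 0≤1

  𝟙-mono : ∀ {P Q : Set} → (P → Q) → 𝟙 P ≤ 𝟙 Q
  𝟙-mono {P} {Q} f with lem {P = P}
  ... | yes p = ≤-reflexive (sym (𝟙-yes (f p)))
  ... | no _  = 𝟙-nonneg Q

  𝟙-cong : ∀ {P Q : Set} → (P → Q) → (Q → P) → 𝟙 P ≈ 𝟙 Q
  𝟙-cong f g = ≤-antisym (𝟙-mono f) (𝟙-mono g)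

  𝟙-× : ∀ (P Q : Set) → 𝟙 (P × Q) ≈ 𝟙 P * 𝟙 Q
  𝟙-× P Q with lem {P = P}
  ... | yes p = trans (𝟙-cong proj₂ (p ,_)) (sym (*-identityˡ _))
  ... | no ¬p = trans (𝟙-no (¬p ∘ proj₁)) (sym (zeroˡ _))

  record Linear {C : Set} (E : (C → ℝ) → ℝ) : Set where
    field
      cong    : ∀ {f g} → (∀ c → f c ≈ g c) → E f ≈ E g
      +-homo  : ∀ f g → E (λ c → f c + g c) ≈ E f + E g
      *-homo  : ∀ x f → E (λ c → x * f c) ≈ x * E f

    0-homo : E (λ _ → 0#) ≈ 0#
    0-homo = begin-equality
      E (λ _ → 0#)        ≈⟨ cong (λ _ → sym (zeroˡ 0#)) ⟩
      E (λ _ → 0# * 0#)   ≈⟨ *-homo 0# (λ _ → 0#) ⟩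
      0# * E (λ _ → 0#)   ≈⟨ zeroˡ _ ⟩
      0#                  ∎

    sum-homo : ∀ {m} (f : Fin m → C → ℝ) → E (λ c → sum (λ i → f i c)) ≈ sum (λ i → E (f i))
    sum-homo {zero}  f = 0-homo
    sum-homo {suc m} f = trans (+-homo (f zero) _) (+-congˡ (sum-homo (f ∘ suc)))

    *-homoʳ : ∀ f x → E (λ c → f c * x) ≈ E f * x
    *-homoʳ f x = trans (cong (λ c → *-comm (f c) x)) (trans (*-homo x f) (*-comm x _))

    neg-homo : ∀ f → E (λ c → - f c) ≈ - E f
    neg-homo f = begin-equality
      E (λ c → - f c)       ≈⟨ cong (λ c → solve 1 (λ x → :- x := :- con (+ 1) :* x) refl (f c)) ⟩
      E (λ c → - 1# * f c)  ≈⟨ *-homo (- 1#) f ⟩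
      - 1# * E f            ≈⟨ solve 1 (λ x → :- con (+ 1) :* x := :- x) refl (E f) ⟩
      - E f                 ∎

  -- The interface hides the finite support. `swap` is Fubini's theorem, stated against an arbitrary
  -- linear functional so that products of means can be handled by induction. `attained` is the
  -- averaging argument that later replaces random thresholds by fixed ones.
  record IsMean {C : Set} (mean : (C → ℝ) → ℝ) : Set₁ where
    no-eta-equality
    field
      linear   : Linear mean
      mono     : ∀ {f g} → (∀ c → f c ≤ g c) → mean f ≤ mean g
      const    : ∀ x → mean (λ _ → x) ≈ x
      swap     : ∀ {D : Set} {E : (D → ℝ) → ℝ} → Linear E → ∀ (f : C → D → ℝ) →
                 mean (λ c → E (f c)) ≈ E (λ d → mean (λ c → f c d))
      attained : ∀ f → ∃ λ c → mean f ≤ f c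

  -- The expectation operator of a finitely supported distribution.
  record Mean (C : Set) : Set₁ where
    no-eta-equality
    field
      mean   : (C → ℝ) → ℝ
      isMean : IsMean mean
    open IsMean isMean public
    open Linear linear public

    nonneg : ∀ {f} → (∀ c → 0# ≤ f c) → 0# ≤ mean f
    nonneg h = ≤-respˡ (const 0#) (mono h)

    1-homo : ∀ f → mean (λ c → 1# - f c) ≈ 1# - mean f
    1-homo f = trans (+-homo _ _) (+-cong (const 1#) (neg-homo f))

  open Mean using (mean)

  module _ {C : Set} {m} (w : Fin m → ℝ) (w≥0 : ∀ a → 0# ≤ w a) (Σw≈1 : sum w ≈ 1#) (point : Fin m → C) where

    private
      weighted : (C → ℝ) → ℝ
      weighted f = sum (λ a → w a * f (point a))

    weighted-linear : Linear weighted
    weighted-linear = record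
      { cong   = λ h → sum-cong (λ a → *-congˡ (h (point a)))
      ; +-homo = λ f g → trans (sum-cong {m} (λ a → distribˡ (w a) (f (point a)) (g (point a)))) (∑-distrib-+ (λ a → w a * f (point a)) (λ a → w a * g (point a)))
      ; *-homo = λ x f → trans (sum-cong {m} (λ a → solve 3 (λ w x y → w :* (x :* y) := x :* (w :* y)) refl (w a) x (f (point a))))
                   (sym (*-distribˡ-sum x (λ a → w a * f (point a)))) }

    weighted-const : ∀ x → weighted (λ _ → x) ≈ x
    weighted-const x = begin-equality
      sum (λ a → w a * x)   ≈⟨ sum-cong (λ a → *-comm (w a) x) ⟩
      sum (λ a → x * w a)   ≈⟨ *-distribˡ-sum x w ⟨
      x * sum w             ≈⟨ trans (*-congˡ Σw≈1) (*-identityʳ x) ⟩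
      x                     ∎

    -- If every support point fell below the average `M`, the nonnegative terms
    -- `w a * (M - f (point a))` would sum to 0, forcing every weight to vanish although the weights
    -- sum to 1. Zero weights are allowed, so the contradiction comes from the weights and not from
    -- a single point.
    weighted-attained : ∀ f → ∃ λ c → weighted f ≤ f c
    weighted-attained f with lem {P = ∃ λ a → weighted f ≤ f (point a)}
    ... | yes (a , p) = point a , p
    ... | no ¬p = contradiction (≤-respˡ Σw≈1 (≤-respʳ (sum-zero {m} (λ _ → refl)) (sum-mono w≤0))) 0<1
      where
      M = weighted f
      gap : Fin m → ℝ
      gap a = w a * (M - f (point a))
      Σgap≈0 : sum gap ≈ 0#
      Σgap≈0 = begin-equality
        sum gap
          ≈⟨ sum-cong (λ a → solve 3 (λ w M f → w :* (M :- f) := w :* M :+ :- con (+ 1) :* (w :* f)) refl (w a) M (f (point a))) ⟩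
        sum (λ a → w a * M + - 1# * (w a * f (point a)))
          ≈⟨ ∑-distrib-+ (λ a → w a * M) (λ a → - 1# * (w a * f (point a))) ⟩
        weighted (λ _ → M) + sum (λ a → - 1# * (w a * f (point a)))
          ≈⟨ +-cong (weighted-const M) (sym (*-distribˡ-sum (- 1#) (λ a → w a * f (point a)))) ⟩
        M + - 1# * M
          ≈⟨ solve 1 (λ M → M :+ :- con (+ 1) :* M := con (+ 0)) refl M ⟩
        0# ∎
      gap≥0 : ∀ a → 0# ≤ gap a
      gap≥0 a = *-nonneg (w≥0 a) (0≤y-x (<⇒≤ (λ p → ¬p (a , p))))
      w≤0 : ∀ a → w a ≤ 0#
      w≤0 a with lem {P = w a ≤ 0#}
      ... | yes p = p
      ... | no 0<w = contradiction (≤-respʳ Σgap≈0 (term≤sum gap≥0 a))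
                       (0<* 0<w (λ q → ¬p (a , 0≤y-x⇒x≤y (≤-respʳ (solve 2 (λ M f → :- (M :- f) := f :- M) refl M (f (point a)))
                                                     (0≤-x q)))))

    abstract
      weighted-isMean : IsMean weighted
      weighted-isMean = record
        { linear   = weighted-linear
        ; mono     = λ h → sum-mono (λ a → *-monoˡ-≤ (w≥0 a) (h (point a)))
        ; const    = weighted-const
        ; swap     = λ {D} {E} lin f → trans (sum-cong (λ a → sym (Linear.*-homo lin (w a) (f (point a)))))
                       (sym (Linear.sum-homo lin (λ a d → w a * f (point a) d)))
        ; attained = weighted-attained }

    fromWeights : Mean C
    fromWeights = record { mean = weighted ; isMean = weighted-isMean }

  module _ {C : Set} where

    productMean : ∀ {n} → (Fin n → Mean C) → (Vec C n → ℝ) → ℝ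
    productMean {zero}  μ f = f []
    productMean {suc n} μ f = mean (μ zero) (λ a → productMean (μ ∘ suc) (λ v → f (a ∷ v)))

    productMean-linear : ∀ {n} (μ : Fin n → Mean C) → Linear (productMean μ)
    productMean-linear {zero}  μ = record
      { cong = λ h → h [] ; +-homo = λ _ _ → refl ; *-homo = λ _ _ → refl }
    productMean-linear {suc n} μ = record
      { cong   = λ h → μ₀.cong (λ a → E.cong (λ v → h (a ∷ v)))
      ; +-homo = λ f g → trans (μ₀.cong (λ a → E.+-homo _ _)) (μ₀.+-homo _ _)
      ; *-homo = λ x f → trans (μ₀.cong (λ a → E.*-homo _ _)) (μ₀.*-homo _ _) }
      where
      module μ₀ = Mean (μ zero)
      module E = Linear (productMean-linear (μ ∘ suc))

    abstract
      productMean-isMean : ∀ {n} (μ : Fin n → Mean C) → IsMean (productMean μ)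
      productMean-isMean μ = record
        { linear = productMean-linear μ ; mono = mono′ μ ; const = const′ μ
        ; swap = λ lin → swap′ μ lin ; attained = attained′ μ }
        where
        mono′ : ∀ {n} (μ : Fin n → Mean C) {f g} → (∀ v → f v ≤ g v) → productMean μ f ≤ productMean μ g
        mono′ {zero}  μ h = h []
        mono′ {suc n} μ h = Mean.mono (μ zero) (λ a → mono′ (μ ∘ suc) (λ v → h (a ∷ v)))
        const′ : ∀ {n} (μ : Fin n → Mean C) x → productMean μ (λ _ → x) ≈ x
        const′ {zero}  μ x = refl
        const′ {suc n} μ x = trans (Mean.cong (μ zero) (λ a → const′ (μ ∘ suc) x)) (Mean.const (μ zero) x)
        swap′ : ∀ {n} (μ : Fin n → Mean C) {D : Set} {E : (D → ℝ) → ℝ} → Linear E → ∀ (f : Vec C n → D → ℝ) →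
                productMean μ (λ c → E (f c)) ≈ E (λ d → productMean μ (λ c → f c d))
        swap′ {zero}  μ lin f = refl
        swap′ {suc n} μ lin f = trans (Mean.cong (μ zero) (λ a → swap′ (μ ∘ suc) lin (λ v → f (a ∷ v))))
                                      (Mean.swap (μ zero) lin _)
        attained′ : ∀ {n} (μ : Fin n → Mean C) f → ∃ λ v → productMean μ f ≤ f v
        attained′ {zero}  μ f = [] , ≤-refl
        attained′ {suc n} μ f with Mean.attained (μ zero) (λ a → productMean (μ ∘ suc) (λ v → f (a ∷ v)))
        ... | a , p with attained′ (μ ∘ suc) (λ v → f (a ∷ v))
        ... | v , q = a ∷ v , ≤-trans p q

    product : ∀ {n} → (Fin n → Mean C) → Mean (Vec C n)
    product μ = record { mean = productMean μ ; isMean = productMean-isMean μ }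

    -- Resampling coordinate `i` from its own distribution does not change a product distribution.
    -- Overwriting the coordinate isolates it without splitting the vector.
    fubini : ∀ {n} (μ : Fin n → Mean C) i f →
             mean (product μ) f ≈ mean (μ i) (λ a → mean (product μ) (λ v → f (v [ i ]≔ a)))
    fubini μ zero    f = Mean.cong (μ zero) (λ a → sym (Mean.const (μ zero) _))
    fubini μ (suc i) f = trans (Mean.cong (μ zero) (λ b → fubini (μ ∘ suc) i (λ v → f (b ∷ v))))
                               (Mean.swap (μ zero) (Mean.linear (μ (suc i))) _)

    independence : ∀ {n} (μ : Fin n → Mean C) i (g : C → ℝ) (h : Vec C n → ℝ) →
      (∀ v a → h (v [ i ]≔ a) ≈ h v) →
      mean (product μ) (λ v → g (Vec.lookup v i) * h v) ≈ mean (μ i) g * mean (product μ) h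
    independence μ i g h ignores = begin-equality
      mean (product μ) (λ v → g (Vec.lookup v i) * h v)
        ≈⟨ fubini μ i _ ⟩
      mean (μ i) (λ a → mean (product μ) (λ v → g (Vec.lookup (v [ i ]≔ a) i) * h (v [ i ]≔ a)))
        ≈⟨ Mean.cong (μ i) (λ a → Mean.cong (product μ) (λ v →
             *-cong (reflexive (≡.cong g (lookup∘update i v a))) (ignores v a))) ⟩
      mean (μ i) (λ a → mean (product μ) (λ v → g a * h v))
        ≈⟨ Mean.cong (μ i) (λ a → Mean.*-homo (product μ) (g a) h) ⟩
      mean (μ i) (λ a → g a * mean (product μ) h)
        ≈⟨ Mean.*-homoʳ (μ i) g _ ⟩
      mean (μ i) g * mean (product μ) h ∎

  module _ (p : ℝ) (0≤p : 0# ≤ p) (p≤1 : p ≤ 1#) where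

    private
      w : Fin 2 → ℝ
      w zero    = p
      w (suc _) = 1# - p
      side : Fin 2 → Bool
      side zero    = true
      side (suc _) = false

    abstract
      w-nonneg : ∀ a → 0# ≤ w a
      w-nonneg zero    = 0≤p
      w-nonneg (suc _) = 0≤y-x p≤1

      w-sum : sum w ≈ 1#
      w-sum = solve 1 (λ p → p :+ (con (+ 1) :- p :+ con (+ 0)) := con (+ 1)) refl p

    coin : Mean Bool
    coin = fromWeights w w-nonneg w-sum side

    coin-mean : ∀ f → mean coin f ≈ p * f true + (1# - p) * f false
    coin-mean f = +-congˡ (+-identityʳ _)

  module _ {C D : Set} (_∼_ : C → D → Bool) where

    relate : ∀ {n} → (Fin n → Mean C) → (Fin n → Mean D) → Fin n → ℝ
    relate ν π i = mean (ν i) (λ k → mean (π i) (λ a → 𝟙 (True (k ∼ a))))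

    -- The bits of `zipWith _∼_ κ ℓ` come from disjoint pairs of coordinates, hence they are
    -- independent coins with biases `relate ν π i`. This identifies the law of the active set once
    -- the thresholds are random.
    pushforward : ∀ {n} (ν : Fin n → Mean C) (π : Fin n → Mean D) (μ : Fin n → Mean Bool) →
      (∀ i f → mean (μ i) f ≈ relate ν π i * f true + (1# - relate ν π i) * f false) →
      ∀ g → mean (product ν) (λ κ → mean (product π) (λ ℓ → g (zipWith _∼_ κ ℓ))) ≈ mean (product μ) g
    pushforward {zero}  ν π μ h g = refl
    pushforward {suc n} ν π μ h g = begin-equality
      mean (ν zero) (λ k → mean (product (ν ∘ suc)) (λ κ → mean (π zero) (λ a → mean (product (π ∘ suc)) (λ ℓ →
        g ((k ∼ a) ∷ zipWith _∼_ κ ℓ)))))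
        ≈⟨ Mean.cong (ν zero) (λ k → Mean.swap (product (ν ∘ suc)) (Mean.linear (π zero)) _) ⟩
      mean (ν zero) (λ k → mean (π zero) (λ a → mean (product (ν ∘ suc)) (λ κ → mean (product (π ∘ suc)) (λ ℓ →
        g ((k ∼ a) ∷ zipWith _∼_ κ ℓ)))))
        ≈⟨ Mean.cong (ν zero) (λ k → Mean.cong (π zero) (λ a → pushforward (ν ∘ suc) (π ∘ suc) (μ ∘ suc) (h ∘ suc) (λ v → g ((k ∼ a) ∷ v)))) ⟩
      mean (ν zero) (λ k → mean (π zero) (λ a → H (k ∼ a)))
        -- A function of one bit is affine in the indicator of that bit, so linearity leaves only
        -- the bias.
        ≈⟨ Mean.cong (ν zero) (λ k → Mean.cong (π zero) (λ a → split (k ∼ a))) ⟩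
      mean (ν zero) (λ k → mean (π zero) (λ a → H false + 𝟙 (True (k ∼ a)) * (H true - H false)))
        ≈⟨ Mean.cong (ν zero) (λ k → trans (Mean.+-homo (π zero) _ _)
             (+-cong (Mean.const (π zero) _) (Mean.*-homoʳ (π zero) _ _))) ⟩
      mean (ν zero) (λ k → H false + mean (π zero) (λ a → 𝟙 (True (k ∼ a))) * (H true - H false))
        ≈⟨ trans (Mean.+-homo (ν zero) _ _) (+-cong (Mean.const (ν zero) _) (Mean.*-homoʳ (ν zero) _ _)) ⟩
      H false + p * (H true - H false)
        ≈⟨ solve 3 (λ p t f → f :+ p :* (t :- f) := p :* t :+ (con (+ 1) :- p) :* f) refl p (H true) (H false) ⟩
      p * H true + (1# - p) * H false
        ≈⟨ h zero H ⟨
      mean (μ zero) H ∎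
      where
      p = relate ν π zero
      H : Bool → ℝ
      H b = mean (product (μ ∘ suc)) (λ v → g (b ∷ v))
      split : ∀ b → H b ≈ H false + 𝟙 (True b) * (H true - H false)
      split true  = sym (trans (+-congˡ (trans (*-congʳ (𝟙-yes _)) (*-identityˡ _)))
                      (solve 2 (λ t f → f :+ (t :- f) := t) refl (H true) (H false)))
      split false = sym (trans (+-congˡ (trans (*-congʳ (𝟙-no (λ ()))) (zeroˡ _))) (+-identityʳ _))

-- Random sets of active items

module RandomSubsets (lem : ∀ {ℓ} → ExcludedMiddle ℓ) (R : CompleteOrderedField) where
  open Prophet lem R hiding (zero)
  open OrderedField R
  open PoissonTails R
  open BlockingProbability R
  open Expectation lem R
  open Mean using (mean)
  open ≤-Reasoning

  -- The probability with odds y.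
  prob : ℝ → ℝ
  prob y = y * (1# + y) ⁻¹

  module _ {y : ℝ} (0≤y : 0# ≤ y) where

    private
      0<1+y : 0# < 1# + y
      0<1+y = 0<+ 0<1 0≤y

    1-prob : 1# - prob y ≈ (1# + y) ⁻¹
    1-prob = begin-equality
      1# - y * (1# + y) ⁻¹
        ≈⟨ +-congʳ (*-inverseʳ (1# + y) (0<⇒≉0 0<1+y)) ⟨
      (1# + y) * (1# + y) ⁻¹ - y * (1# + y) ⁻¹
        ≈⟨ solve 2 (λ y q → (con (+ 1) :+ y) :* q :- y :* q := q) refl y ((1# + y) ⁻¹) ⟩
      (1# + y) ⁻¹ ∎

    0≤1-prob : 0# ≤ 1# - prob y
    0≤1-prob = ≤-respʳ (sym 1-prob) (⁻¹-nonneg 0<1+y)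

    prob≈y*[1-prob] : prob y ≈ y * (1# - prob y)
    prob≈y*[1-prob] = *-congˡ (sym 1-prob)

    prob-nonneg : 0# ≤ prob y
    prob-nonneg = *-nonneg 0≤y (⁻¹-nonneg 0<1+y)

    prob≤1 : prob y ≤ 1#
    prob≤1 = 0≤y-x⇒x≤y 0≤1-prob

    abstract
      oddsCoin : Mean Bool
      oddsCoin = coin (prob y) prob-nonneg prob≤1

      oddsCoin-mean : ∀ f → mean oddsCoin f ≈ prob y * f true + (1# - prob y) * f false
      oddsCoin-mean = coin-mean (prob y) prob-nonneg prob≤1

  randomSubset : ∀ {n} (y : Fin n → ℝ) → (∀ i → 0# ≤ y i) → Mean (Subset n)
  randomSubset y 0≤y = product (λ i → oddsCoin (0≤y i))

  randomSubset-mean : ∀ {n} (y : Fin (suc n) → ℝ) (0≤y : ∀ i → 0# ≤ y i) (f : Subset (suc n) → ℝ) →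
    mean (randomSubset y 0≤y) f ≈
      prob (y zero) * mean (randomSubset (y ∘ suc) (0≤y ∘ suc)) (λ A → f (inside ∷ A)) +
      (1# - prob (y zero)) * mean (randomSubset (y ∘ suc) (0≤y ∘ suc)) (λ A → f (outside ∷ A))
  randomSubset-mean y 0≤y f =
    oddsCoin-mean (0≤y zero) (λ b → mean (randomSubset (y ∘ suc) (0≤y ∘ suc)) (λ A → f (b ∷ A)))

  module _ (φ : ℕ → ℕ → Set)
    (φ-pred : ∀ {k m} → φ (suc k) (suc m) → φ k m) (φ-suc : ∀ {k m} → φ k m → φ (suc k) (suc m))
    (φ-zero : ∀ {k} → ¬ φ (suc k) 0) where

    private
      s : ∀ {n} (y : Fin n → ℝ) → (∀ i → 0# ≤ y i) → Subset n → ℕ → ℝ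
      s y 0≤y S k = mean (randomSubset y 0≤y) (λ A → 𝟙 (φ k ∣ A Sub.∩ S ∣))

      s-nonneg : ∀ {n} (y : Fin n → ℝ) 0≤y S k → 0# ≤ s {n} y 0≤y S k
      s-nonneg y 0≤y S k = Mean.nonneg (randomSubset y 0≤y) (λ A → 𝟙-nonneg (φ k ∣ A Sub.∩ S ∣))

    -- The assumptions on `φ` hold for `m ≡ k` and for `k ≤ m`, so both ratio conditions of `Tails`
    -- come from one induction over the items. An item of odds `y₀ = p/q` gives
    -- `s (k+1) = q (y₀ s′ k + s′ (k+1))`, and raising the mean from `μ` to `y₀ + μ` leaves
    -- `q y₀² s′ k` to spare.
    count-ratio : ∀ {n} (y : Fin n → ℝ) (0≤y : ∀ i → 0# ≤ y i) (S : Subset n) k →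
      ι (suc k) * s y 0≤y S (suc k) ≤ value S y * s y 0≤y S k
    count-ratio y 0≤y [] k = ≤-reflexive (trans (trans (*-congˡ (𝟙-no φ-zero)) (zeroʳ _)) (sym (zeroˡ _)))
    count-ratio y 0≤y (outside ∷ S) k = begin
      ι (suc k) * s y 0≤y (outside ∷ S) (suc k)     ≈⟨ *-congˡ (ignore (suc k)) ⟩
      ι (suc k) * s′ (suc k)                        ≤⟨ count-ratio (y ∘ suc) (0≤y ∘ suc) S k ⟩
      value S (y ∘ suc) * s′ k                      ≈⟨ *-cong (sym (+-identityˡ _)) (sym (ignore k)) ⟩
      value (outside ∷ S) y * s y 0≤y (outside ∷ S) k ∎
      where
      s′ = s (y ∘ suc) (0≤y ∘ suc) S
      ignore : ∀ k → s y 0≤y (outside ∷ S) k ≈ s′ k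
      ignore k = trans (randomSubset-mean y 0≤y (λ A → 𝟙 (φ k ∣ A Sub.∩ (outside ∷ S) ∣)))
        (solve 2 (λ p a → p :* a :+ (con (+ 1) :- p) :* a := a) refl (prob (y zero)) (s′ k))
    count-ratio y 0≤y (inside ∷ S) zero = begin
      ι 1 * s y 0≤y (inside ∷ S) 1
        ≈⟨ trans (*-congʳ ι-1) (*-identityˡ _) ⟩
      s y 0≤y (inside ∷ S) 1
        ≈⟨ trans (randomSubset-mean y 0≤y (λ A → 𝟙 (φ 1 ∣ A Sub.∩ (inside ∷ S) ∣)))
             (+-congʳ (*-congˡ (Mean.cong (randomSubset (y ∘ suc) (0≤y ∘ suc)) (λ A → 𝟙-cong φ-pred φ-suc)))) ⟩
      p * s′ 0 + q * s′ 1
        ≤⟨ +-mono-≤ (≤-reflexive (*-congʳ (prob≈y*[1-prob] (0≤y zero))))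
             (*-monoˡ-≤ q≥0 (≤-respˡ (trans (*-congʳ ι-1) (*-identityˡ _)) (count-ratio (y ∘ suc) (0≤y ∘ suc) S 0))) ⟩
      y₀ * q * s′ 0 + q * (μ * s′ 0)
        ≈⟨ solve 4 (λ y q a m → y :* q :* a :+ q :* (m :* a) := (y :+ m) :* (q :* a)) refl y₀ q (s′ 0) μ ⟩
      (y₀ + μ) * (q * s′ 0)
        -- Nothing is assumed about `φ 0` at a successor, where it fails for `m ≡ 0` and holds for
        -- `0 ≤ m`; by nonnegativity the bound needs only the term without the item.
        ≤⟨ *-monoˡ-≤ (+-nonneg (0≤y zero) μ≥0) (x≤y+x (*-nonneg (prob-nonneg (0≤y zero)) (Mean.nonneg (randomSubset (y ∘ suc) (0≤y ∘ suc)) (λ A → 𝟙-nonneg _)))) ⟩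
      (y₀ + μ) * (p * mean (randomSubset (y ∘ suc) (0≤y ∘ suc)) (λ A → 𝟙 (φ 0 (suc ∣ A Sub.∩ S ∣))) + q * s′ 0)
        ≈⟨ *-congˡ (randomSubset-mean y 0≤y (λ A → 𝟙 (φ 0 ∣ A Sub.∩ (inside ∷ S) ∣))) ⟨
      value (inside ∷ S) y * s y 0≤y (inside ∷ S) 0 ∎
      where
      s′ = s (y ∘ suc) (0≤y ∘ suc) S
      y₀ = y zero
      p = prob y₀
      q = 1# - p
      q≥0 = 0≤1-prob (0≤y zero)
      μ = value S (y ∘ suc)
      μ≥0 : 0# ≤ μ
      μ≥0 = sum-nonneg λ i → value-term (lookup S i) i
        where
        value-term : ∀ b i → 0# ≤ (if b then y (suc i) else 0#)
        value-term true  i = 0≤y (suc i)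
        value-term false i = ≤-refl
    count-ratio y 0≤y (inside ∷ S) (suc k) = begin
      ι (2 ℕ.+ k) * s y 0≤y (inside ∷ S) (2 ℕ.+ k)
        ≈⟨ *-cong (ι-suc (suc k)) (unfold (suc k)) ⟩
      (1# + ι (suc k)) * (p * s′ (suc k) + q * s′ (2 ℕ.+ k))
        ≈⟨ *-congˡ (+-congʳ (*-congʳ (prob≈y*[1-prob] (0≤y zero)))) ⟩
      (1# + ι (suc k)) * (y₀ * q * s′ (suc k) + q * s′ (2 ℕ.+ k))
        ≈⟨ solve 5 (λ K y q a b → (con (+ 1) :+ K) :* (y :* q :* a :+ q :* b)
                := q :* ((con (+ 1) :+ K) :* b :+ (y :* a :+ y :* (K :* a)))) refl (ι (suc k)) y₀ q (s′ (suc k)) (s′ (2 ℕ.+ k)) ⟩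
      q * ((1# + ι (suc k)) * s′ (2 ℕ.+ k) + (y₀ * s′ (suc k) + y₀ * (ι (suc k) * s′ (suc k))))
        ≤⟨ *-monoˡ-≤ q≥0 (+-mono-≤ (≤-respˡ (*-congʳ (ι-suc (suc k))) (count-ratio (y ∘ suc) (0≤y ∘ suc) S (suc k)))
             (+-monoʳ-≤ _ (*-monoˡ-≤ (0≤y zero) (count-ratio (y ∘ suc) (0≤y ∘ suc) S k)))) ⟩
      q * (μ * s′ (suc k) + (y₀ * s′ (suc k) + y₀ * (μ * s′ k)))
        ≤⟨ *-monoˡ-≤ q≥0 (x≤x+y (*-nonneg (*-nonneg (0≤y zero) (0≤y zero)) (s-nonneg (y ∘ suc) (0≤y ∘ suc) S k))) ⟩
      q * (μ * s′ (suc k) + (y₀ * s′ (suc k) + y₀ * (μ * s′ k)) + y₀ * y₀ * s′ k)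
        ≈⟨ solve 5 (λ q m y a b → q :* (m :* a :+ (y :* a :+ y :* (m :* b)) :+ y :* y :* b)
                := (y :+ m) :* (y :* q :* b :+ q :* a)) refl q μ y₀ (s′ (suc k)) (s′ k) ⟩
      (y₀ + μ) * (y₀ * q * s′ k + q * s′ (suc k))
        ≈⟨ *-congˡ (trans (+-congʳ (*-congʳ (sym (prob≈y*[1-prob] (0≤y zero))))) (sym (unfold k))) ⟩
      value (inside ∷ S) y * s y 0≤y (inside ∷ S) (suc k) ∎
      where
      s′ = s (y ∘ suc) (0≤y ∘ suc) S
      y₀ = y zero
      p = prob y₀
      q = 1# - p
      q≥0 = 0≤1-prob (0≤y zero)
      μ = value S (y ∘ suc)
      unfold : ∀ k → s y 0≤y (inside ∷ S) (suc k) ≈ p * s′ k + q * s′ (suc k)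
      unfold k = trans (randomSubset-mean y 0≤y (λ A → 𝟙 (φ (suc k) ∣ A Sub.∩ (inside ∷ S) ∣)))
        (+-congʳ (*-congˡ (Mean.cong (randomSubset (y ∘ suc) (0≤y ∘ suc)) (λ A → 𝟙-cong φ-pred φ-suc))))

  module _ {n} (y : Fin n → ℝ) (0≤y : ∀ i → 0# ≤ y i) (S : Subset n) where

    -- A single item shows why the mean is the total of the odds and not of the probabilities: with
    -- `d 1 = p` and `d 0 = 1 - p`, the condition `d 1 ≤ x d 0` says `x ≥ p / (1 - p)`.
    countTails : Tails (value S y)
    countTails = record
      { d        = λ k → E (λ A → 𝟙 (∣ A Sub.∩ S ∣ ≡ k))
      ; T        = λ k → E (λ A → 𝟙 (k ℕ.≤ ∣ A Sub.∩ S ∣))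
      ; d-nonneg = λ k → nonneg (λ A → 𝟙-nonneg _)
      ; T-nonneg = λ k → nonneg (λ A → 𝟙-nonneg _)
      ; T-zero   = trans (cong (λ A → 𝟙-yes ℕ.z≤n)) (const 1#)
      ; T-step   = λ k → trans (cong (λ A → step k ∣ A Sub.∩ S ∣)) (+-homo _ _)
      ; d-ratio  = count-ratio (λ k m → m ≡ k) ℕ.suc-injective (≡.cong suc) (λ ()) y 0≤y S
      ; T-ratio  = count-ratio ℕ._≤_ ℕ.s≤s⁻¹ ℕ.s≤s (λ ()) y 0≤y S }
      where
      open Mean (randomSubset y 0≤y) renaming (mean to E)
      step : ∀ k m → 𝟙 (k ℕ.≤ m) ≈ 𝟙 (m ≡ k) + 𝟙 (suc k ℕ.≤ m)
      step k m with ℕ.<-cmp k m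
      ... | tri< k<m k≢m _ = trans (𝟙-yes (ℕ.<⇒≤ k<m))
              (sym (trans (+-cong (𝟙-no (k≢m ∘ ≡.sym)) (𝟙-yes k<m)) (+-identityˡ _)))
      ... | tri≈ k≮m ≡.refl _ = trans (𝟙-yes ℕ.≤-refl)
              (sym (trans (+-cong (𝟙-yes ≡.refl) (𝟙-no k≮m)) (+-identityʳ _)))
      ... | tri> k≮m k≢m m<k = trans (𝟙-no (ℕ.<⇒≱ m<k))
              (sym (trans (+-cong (𝟙-no (k≢m ∘ ≡.sym)) (𝟙-no k≮m)) (+-identityˡ _)))

  without : ∀ {n} → Subset n → (Fin n → ℝ) → Fin n → ℝ
  without S y i = if lookup S i then 0# else y i

  without-nonneg : ∀ {n} (S : Subset n) (y : Fin n → ℝ) → (∀ i → 0# ≤ y i) → ∀ i → 0# ≤ without S y i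
  without-nonneg S y 0≤y i with lookup S i
  ... | true  = ≤-refl
  ... | false = 0≤y i

  value-mono : ∀ {n} (S : Subset n) {x y : Fin n → ℝ} → (∀ i → x i ≤ y i) → value S x ≤ value S y
  value-mono S {x} {y} h = sum-mono (λ i → term (lookup S i) i)
    where
    term : ∀ b i → (if b then x i else 0#) ≤ (if b then y i else 0#)
    term true  i = h i
    term false i = ≤-refl

  without≤ : ∀ {n} (S : Subset n) (y : Fin n → ℝ) → (∀ i → 0# ≤ y i) → ∀ i → without S y i ≤ y i
  without≤ S y 0≤y i with lookup S i
  ... | true  = 0≤y i
  ... | false = ≤-refl

  -- Items are independent, so conditioning on missing `S` sets the odds of its members to 0 and
  -- leaves the others alone. The result is again a `randomSubset`, to which `countTails` applies.
  conditioning : ∀ {n} (S : Subset n) (y : Fin n → ℝ) (0≤y : ∀ i → 0# ≤ y i)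
    (0≤y′ : ∀ i → 0# ≤ without S y i) (g : Subset n → ℝ) →
    mean (randomSubset y 0≤y) (λ A → 𝟙 (∣ A Sub.∩ S ∣ ≡ 0) * g A) ≈
    mean (randomSubset y 0≤y) (λ A → 𝟙 (∣ A Sub.∩ S ∣ ≡ 0)) * mean (randomSubset (without S y) 0≤y′) g
  conditioning [] y 0≤y 0≤y′ g = refl
  conditioning (inside ∷ S) y 0≤y 0≤y′ g = begin-equality
    mean (randomSubset y 0≤y) (λ A → 𝟙 (∣ A Sub.∩ (inside ∷ S) ∣ ≡ 0) * g A)
      ≈⟨ randomSubset-mean y 0≤y (λ A → 𝟙 (∣ A Sub.∩ (inside ∷ S) ∣ ≡ 0) * g A) ⟩
    p * E (λ A → 𝟙 (suc ∣ A Sub.∩ S ∣ ≡ 0) * g (inside ∷ A)) + q * E (λ A → 𝟙 (∣ A Sub.∩ S ∣ ≡ 0) * g (outside ∷ A))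
      ≈⟨ +-cong (*-congˡ (trans (Linear.cong lin (λ A → trans (*-congʳ (𝟙-no (λ ()))) (zeroˡ _))) (Linear.0-homo lin)))
                (*-congˡ (conditioning S (y ∘ suc) (0≤y ∘ suc) (0≤y′ ∘ suc) (λ A → g (outside ∷ A)))) ⟩
    p * 0# + q * (M * G outside)
      ≈⟨ solve 5 (λ p q m f t → p :* con (+ 0) :+ q :* (m :* f)
            := (p :* con (+ 0) :+ q :* m) :* (con (+ 0) :* t :+ (con (+ 1) :- con (+ 0)) :* f)) refl p q M (G outside) (G inside) ⟩
    (p * 0# + q * M) * (0# * G inside + (1# - 0#) * G outside)
      ≈⟨ *-cong (+-congʳ (*-congˡ (trans (Linear.cong lin (λ A → 𝟙-no (λ ()))) (Linear.0-homo lin))))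
                (+-cong (*-congʳ (zeroˡ _)) (*-congʳ (+-congˡ (-‿cong (zeroˡ _))))) ⟨
    (p * E (λ A → 𝟙 (suc ∣ A Sub.∩ S ∣ ≡ 0)) + q * M) * (prob 0# * G inside + (1# - prob 0#) * G outside)
      ≈⟨ *-cong (randomSubset-mean y 0≤y (λ A → 𝟙 (∣ A Sub.∩ (inside ∷ S) ∣ ≡ 0))) (randomSubset-mean (without (inside ∷ S) y) 0≤y′ g) ⟨
    mean (randomSubset y 0≤y) (λ A → 𝟙 (∣ A Sub.∩ (inside ∷ S) ∣ ≡ 0)) * mean (randomSubset (without (inside ∷ S) y) 0≤y′) g ∎
    where
    p = prob (y zero)
    q = 1# - p
    E = mean (randomSubset (y ∘ suc) (0≤y ∘ suc))
    lin = Mean.linear (randomSubset (y ∘ suc) (0≤y ∘ suc))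
    M = E (λ A → 𝟙 (∣ A Sub.∩ S ∣ ≡ 0))
    G : Bool → ℝ
    G b = mean (randomSubset (without S (y ∘ suc)) (0≤y′ ∘ suc)) (λ A → g (b ∷ A))
  conditioning (outside ∷ S) y 0≤y 0≤y′ g = begin-equality
    mean (randomSubset y 0≤y) (λ A → 𝟙 (∣ A Sub.∩ (outside ∷ S) ∣ ≡ 0) * g A)
      ≈⟨ randomSubset-mean y 0≤y (λ A → 𝟙 (∣ A Sub.∩ (outside ∷ S) ∣ ≡ 0) * g A) ⟩
    p * E (λ A → 𝟙 (∣ A Sub.∩ S ∣ ≡ 0) * g (inside ∷ A)) + q * E (λ A → 𝟙 (∣ A Sub.∩ S ∣ ≡ 0) * g (outside ∷ A))
      ≈⟨ +-cong (*-congˡ (conditioning S (y ∘ suc) (0≤y ∘ suc) (0≤y′ ∘ suc) (λ A → g (inside ∷ A))))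
                (*-congˡ (conditioning S (y ∘ suc) (0≤y ∘ suc) (0≤y′ ∘ suc) (λ A → g (outside ∷ A)))) ⟩
    p * (M * G inside) + q * (M * G outside)
      ≈⟨ solve 4 (λ p m f t → p :* (m :* t) :+ (con (+ 1) :- p) :* (m :* f)
            := (p :* m :+ (con (+ 1) :- p) :* m) :* (p :* t :+ (con (+ 1) :- p) :* f)) refl p M (G outside) (G inside) ⟩
    (p * M + q * M) * (p * G inside + q * G outside)
      ≈⟨ *-cong (randomSubset-mean y 0≤y (λ A → 𝟙 (∣ A Sub.∩ (outside ∷ S) ∣ ≡ 0))) (randomSubset-mean (without (outside ∷ S) y) 0≤y′ g) ⟨
    mean (randomSubset y 0≤y) (λ A → 𝟙 (∣ A Sub.∩ (outside ∷ S) ∣ ≡ 0)) * mean (randomSubset (without (outside ∷ S) y) 0≤y′) g ∎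
    where
    p = prob (y zero)
    q = 1# - p
    E = mean (randomSubset (y ∘ suc) (0≤y ∘ suc))
    M = E (λ A → 𝟙 (∣ A Sub.∩ S ∣ ≡ 0))
    G : Bool → ℝ
    G b = mean (randomSubset (without S (y ∘ suc)) (0≤y′ ∘ suc)) (λ A → g (b ∷ A))

  module _ {n} (y : Fin n → ℝ) (0≤y : ∀ i → 0# ≤ y i) (S : ℕ → Subset n)
           (light : ∀ r → ι 25 * value (S r) y ≤ ι (7 ℕ.* r)) where

    Sparse : Subset n → Set
    Sparse A = (∣ A Sub.∩ S 1 ∣ ≡ 0) × (∀ r → 2 ℕ.≤ r → ∣ A Sub.∩ S r ∣ ℕ.< r)

    private
      module E = Mean (randomSubset y 0≤y)
      y′ = without (S 1) y
      0≤y′ = without-nonneg (S 1) y 0≤y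
      module E′ = Mean (randomSubset y′ 0≤y′)

      τ : ℕ → ℝ
      τ 1 = E.mean (λ A → 𝟙 (1 ℕ.≤ ∣ A Sub.∩ S 1 ∣))
      τ r = E′.mean (λ A → 𝟙 (r ℕ.≤ ∣ A Sub.∩ S r ∣))

      light′ : ∀ r → ι 25 * value (S r) y′ ≤ ι (7 ℕ.* r)
      light′ r = ≤-trans (*-monoˡ-≤ (0≤ι 25) (value-mono (S r) (without≤ (S 1) y 0≤y))) (light r)

      isTail : ∀ r → IsTail r (τ r)
      isTail 0 = _ , countTails y′ 0≤y′ (S 0) , light′ 0 , refl
      isTail 1 = _ , countTails y 0≤y (S 1) , light 1 , refl
      isTail r@(suc (suc _)) = _ , countTails y′ 0≤y′ (S r) , light′ r , refl

      missing₁ : Subset n → ℝ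
      missing₁ A = 𝟙 (∣ A Sub.∩ S 1 ∣ ≡ 0)

      full : Subset n → Fin n → ℝ
      full A j = 𝟙 (2 ℕ.+ toℕ j ℕ.≤ ∣ A Sub.∩ S (2 ℕ.+ toℕ j) ∣)

      -- Summing over `Fin n` covers all ranks from 2 on: a set with `r` active members forces
      -- `r ≤ n`.
      union-bound : ∀ A → missing₁ A * (1# - sum (full A)) ≤ 𝟙 (Sparse A)
      union-bound A with lem {P = Sparse A}
      ... | yes _ = ≤-trans (*-monoˡ-≤ (𝟙-nonneg _) 1-Σ≤1) (≤-respˡ (sym (*-identityʳ _)) (𝟙≤1 _))
        where
        1-Σ≤1 : 1# - sum (full A) ≤ 1#
        1-Σ≤1 = 0≤y-x⇒x≤y (≤-respʳ (solve 1 (λ s → s := con (+ 1) :- (con (+ 1) :- s)) refl (sum (full A)))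
                  (sum-nonneg {f = full A} (λ j → 𝟙-nonneg _)))
      ... | no ¬sparse with lem {P = ∣ A Sub.∩ S 1 ∣ ≡ 0} | lem {P = ∃ λ j → 2 ℕ.+ toℕ j ℕ.≤ ∣ A Sub.∩ S (2 ℕ.+ toℕ j) ∣}
      ...   | no hit | _ = ≤-reflexive (zeroˡ _)
      ...   | yes _ | yes (j , dense) = ≤-respˡ (sym (*-identityˡ _))
              (0≤y-x⇒x≤y (≤-respʳ (solve 1 (λ s → s :- con (+ 1) := con (+ 0) :- (con (+ 1) :- s)) refl (sum (full A)))
                (0≤y-x (≤-respˡ (𝟙-yes dense) (term≤sum {f = full A} (λ _ → 𝟙-nonneg _) j)))))
      ...   | yes missed | no ¬dense = contradiction (missed , below) ¬sparse
        where
        below : ∀ r → 2 ℕ.≤ r → ∣ A Sub.∩ S r ∣ ℕ.< r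
        below r 2≤r with r ℕ.≤? ∣ A Sub.∩ S r ∣
        ... | no r≰c  = ℕ.≰⇒> r≰c
        ... | yes r≤c = contradiction
          (fromℕ< j<n , ≡.subst (λ k → k ℕ.≤ ∣ A Sub.∩ S k ∣) (≡.sym r≡) r≤c) ¬dense
          where
          j<n : r ℕ.∸ 2 ℕ.< n
          j<n = ℕ.≤-trans (ℕ.∸-monoʳ-< {r} (ℕ.s≤s (ℕ.z≤n {1})) 2≤r) (ℕ.≤-trans r≤c (∣p∣≤n (A Sub.∩ S r)))
          r≡ : 2 ℕ.+ toℕ (fromℕ< j<n) ≡ r
          r≡ = ≡.trans (≡.cong (2 ℕ.+_) (toℕ-fromℕ< j<n)) (ℕ.m+[n∸m]≡n 2≤r)

      missing₁-mean : 1# - τ 1 ≈ E.mean missing₁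
      missing₁-mean = trans (+-congʳ (trans (sym T-zero) (T-step 0))) (solve 2 (λ d t → (d :+ t) :- t := d) refl (E.mean missing₁) (τ 1))
        where open Tails (countTails y 0≤y (S 1)) using (T-zero; T-step)

      crowded : ℝ
      crowded = sum {n} (λ j → τ (2 ℕ.+ toℕ j))

      crowded-mean : E′.mean (λ A → 1# - sum (full A)) ≈ 1# - crowded
      crowded-mean = trans (E′.1-homo (λ A → sum (full A))) (+-congˡ (-‿cong (E′.sum-homo (λ j A → full A j))))

      survives : ι 4 ≤ ι 7 * ((1# - τ 1) * (1# - crowded))
      survives = survival τ isTail n

      factor : (1# - τ 1) * (1# - crowded) ≈ E.mean (λ A → missing₁ A * (1# - sum (full A)))
      factor = trans (*-cong missing₁-mean (sym crowded-mean)) (sym (conditioning (S 1) y 0≤y 0≤y′ (λ A → 1# - sum (full A))))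

    sparse-probability : ι 4 ≤ ι 7 * mean (randomSubset y 0≤y) (λ A → 𝟙 (Sparse A))
    sparse-probability =
      ≤-trans survives (*-monoˡ-≤ (0≤ι 7) (≤-respˡ (sym factor) (E.mono union-bound)))

-- Greedy acceptance in arrival order

module _ {n} (M : LaminarMatroid n) where
  open LaminarMatroid M

  -- If A is the set of the other items that are active, then i is accepted
  -- in any arrival order.
  Unblocked : Fin n → Subset n → Set
  Unblocked i A = ∀ {S} → S ∈ˡ family → i Sub.∈ S → ∣ A Sub.∩ S ∣ ℕ.< rank S

  Unloop : Fin n → Set
  Unloop i = ∀ {S} → S ∈ˡ family → i Sub.∈ S → rank S ≢ 0

  ∩-monoˡ : ∀ {A B S : Subset n} → A Sub.⊆ B → ∣ A Sub.∩ S ∣ ℕ.≤ ∣ B Sub.∩ S ∣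
  ∩-monoˡ {A} {B} {S} A⊆B = p⊆q⇒∣p∣≤∣q∣ λ x∈ →
    let x∈A , x∈S = x∈p∩q⁻ A S x∈ in x∈p∩q⁺ (A⊆B x∈A , x∈S)

  ∩-monoʳ : ∀ {A S T : Subset n} → S Sub.⊆ T → ∣ A Sub.∩ S ∣ ℕ.≤ ∣ A Sub.∩ T ∣
  ∩-monoʳ {A} {S} {T} S⊆T = p⊆q⇒∣p∣≤∣q∣ λ x∈ →
    let x∈A , x∈S = x∈p∩q⁻ A S x∈ in x∈p∩q⁺ (x∈A , S⊆T x∈S)

  Unblocked-anti : ∀ {i A B} → A Sub.⊆ B → Unblocked i B → Unblocked i A
  Unblocked-anti A⊆B ub S∈ i∈S = ℕ.≤-<-trans (∩-monoˡ A⊆B) (ub S∈ i∈S)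

∣[p∪⁅i⁆]∩q∣≤1+∣p∩q∣ : ∀ {n} (p q : Subset n) i → ∣ (p Sub.∪ ⁅ i ⁆) Sub.∩ q ∣ ℕ.≤ suc ∣ p Sub.∩ q ∣
∣[p∪⁅i⁆]∩q∣≤1+∣p∩q∣ (x ∷ p) (outside ∷ q) zero rewrite ∪-identityʳ p with x
... | true  = ℕ.n≤1+n _
... | false = ℕ.n≤1+n _
∣[p∪⁅i⁆]∩q∣≤1+∣p∩q∣ (true ∷ p) (inside ∷ q) zero rewrite ∪-identityʳ p = ℕ.s≤s (ℕ.n≤1+n _)
∣[p∪⁅i⁆]∩q∣≤1+∣p∩q∣ (false ∷ p) (inside ∷ q) zero rewrite ∪-identityʳ p = ℕ.≤-refl
∣[p∪⁅i⁆]∩q∣≤1+∣p∩q∣ (true ∷ p)  (true ∷ q)  (suc i) = ℕ.s≤s (∣[p∪⁅i⁆]∩q∣≤1+∣p∩q∣ p q i)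
∣[p∪⁅i⁆]∩q∣≤1+∣p∩q∣ (true ∷ p)  (false ∷ q) (suc i) = ∣[p∪⁅i⁆]∩q∣≤1+∣p∩q∣ p q i
∣[p∪⁅i⁆]∩q∣≤1+∣p∩q∣ (false ∷ p) (true ∷ q)  (suc i) = ∣[p∪⁅i⁆]∩q∣≤1+∣p∩q∣ p q i
∣[p∪⁅i⁆]∩q∣≤1+∣p∩q∣ (false ∷ p) (false ∷ q) (suc i) = ∣[p∪⁅i⁆]∩q∣≤1+∣p∩q∣ p q i

module _ {n} (M : LaminarMatroid n) (above : Fin n → Bool) (step : Subset n → Fin n → Subset n)
  (step≡ : ∀ I j → step I j ≡
    (if above j ∧ does (LaminarMatroid.independent? M (I Sub.∪ ⁅ j ⁆)) then I Sub.∪ ⁅ j ⁆ else I))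
  (active : Subset n) (above⇒active : ∀ j → above j ≡ true → j Sub.∈ active) where

  open LaminarMatroid M

  private
    step-⊇ : ∀ I j → I Sub.⊆ step I j
    step-⊇ I j rewrite step≡ I j with above j ∧ does (independent? (I Sub.∪ ⁅ j ⁆))
    ... | true  = p⊆p∪q ⁅ j ⁆
    ... | false = λ x∈ → x∈

    foldl-⊇ : ∀ js I → I Sub.⊆ foldl step I js
    foldl-⊇ []       I x∈ = x∈
    foldl-⊇ (j ∷ js) I x∈ = foldl-⊇ js (step I j) (step-⊇ I j x∈)

    step-∈ : ∀ {I j x} → x Sub.∈ step I j → x Sub.∈ I ⊎ (x ≡ j × above j ≡ true)
    step-∈ {I} {j} x∈ rewrite step≡ I j with above j
    ... | false = inj₁ x∈
    ... | true with does (independent? (I Sub.∪ ⁅ j ⁆))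
    ...   | false = inj₁ x∈
    ...   | true with x∈p∪q⁻ I ⁅ j ⁆ x∈
    ...     | inj₁ x∈I = inj₁ x∈I
    ...     | inj₂ x∈j = inj₂ (x∈⁅y⁆⇒x≡y j x∈j , ≡.refl)

    step-independent : ∀ I j → Independent I → Independent (step I j)
    step-independent I j ind rewrite step≡ I j with above j
    ... | false = ind
    ... | true with independent? (I Sub.∪ ⁅ j ⁆)
    ...   | yes ind′ = ind′
    ...   | no _     = ind

  module _ (i : Fin n) (i-above : above i ≡ true) (unblocked : Unblocked M i (active [ i ]≔ outside)) where

    private
      others : Subset n
      others = active [ i ]≔ outside

      extends : ∀ I → Independent I → I Sub.⊆ others → Independent (I Sub.∪ ⁅ i ⁆)
      extends I ind I⊆ = All.tabulate λ {S} S∈ → bound S S∈ (i ∈? S)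
        where
        bound : ∀ S → S ∈ˡ family → Dec (i Sub.∈ S) → ∣ (I Sub.∪ ⁅ i ⁆) Sub.∩ S ∣ ℕ.≤ rank S
        bound S S∈ (yes i∈S) = ℕ.≤-trans (∣[p∪⁅i⁆]∩q∣≤1+∣p∩q∣ I S i) (Unblocked-anti M I⊆ unblocked S∈ i∈S)
        bound S S∈ (no i∉S) = ℕ.≤-trans (p⊆q⇒∣p∣≤∣q∣ drop) (All.lookup ind S∈)
          where
          drop : ((I Sub.∪ ⁅ i ⁆) Sub.∩ S) Sub.⊆ (I Sub.∩ S)
          drop x∈ with x∈p∩q⁻ (I Sub.∪ ⁅ i ⁆) S x∈
          ... | x∈∪ , x∈S with x∈p∪q⁻ I ⁅ i ⁆ x∈∪
          ...   | inj₁ x∈I = x∈p∩q⁺ (x∈I , x∈S)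
          ...   | inj₂ x∈i = contradiction (≡.subst (Sub._∈ S) (x∈⁅y⁆⇒x≡y i x∈i) x∈S) i∉S

      step-i : ∀ I → Independent I → I Sub.⊆ others → i Sub.∈ step I i
      step-i I ind I⊆ rewrite step≡ I i | i-above | dec-true (independent? (I Sub.∪ ⁅ i ⁆)) (extends I ind I⊆) =
        q⊆p∪q I ⁅ i ⁆ (x∈⁅x⁆ i)

      go : ∀ js I → Independent I → I Sub.⊆ others → i ∈ˡ js → i Sub.∈ foldl step I js
      go (j ∷ js) I ind I⊆ (here ≡.refl) = foldl-⊇ js (step I j) (step-i I ind I⊆)
      go (j ∷ js) I ind I⊆ (there i∈) with i Fin.≟ j
      ... | yes ≡.refl = foldl-⊇ js (step I j) (step-i I ind I⊆)
      ... | no i≢j = go js (step I j) (step-independent I j ind) step⊆ i∈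
        where
        step⊆ : step I j Sub.⊆ others
        step⊆ {x} x∈ with step-∈ {I} {j} x∈
        ... | inj₁ x∈I = I⊆ x∈I
        ... | inj₂ (≡.refl , above-j) = []≔-minimal active x i (i≢j ∘ ≡.sym) (above⇒active x above-j)

    -- Until `i` arrives, the accepted set is independent and consists of other active items, so
    -- `unblocked` leaves space for `i` in every set containing it. `step` is a parameter described
    -- by `step≡` because the step function of `accepted` is local to that definition.
    greedy-accepts : i Sub.∈ foldl step Sub.⊥ (allFin n)
    greedy-accepts = go (allFin n) Sub.⊥ (All.tabulate λ {S} _ →
        ≡.subst (ℕ._≤ rank S) (≡.sym (ℕ.n≤0⇒n≡0 (≡.subst (∣ Sub.⊥ Sub.∩ S ∣ ℕ.≤_) (∣⊥∣≡0 n) (∣p∩q∣≤∣p∣ Sub.⊥ S)))) ℕ.z≤n)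
      (λ x∈ → contradiction x∈ ∉⊥) (∈-allFin i)

-- Blocking along the chain of sets containing an item

module LaminarContention (lem : ∀ {ℓ} → ExcludedMiddle ℓ) (R : CompleteOrderedField) where
  open Prophet lem R hiding (zero)
  open OrderedField R
  open Expectation lem R
  open RandomSubsets lem R
  open Mean using (mean)
  open ≤-Reasoning

  value-⊥ : ∀ {n} (x : Fin n → ℝ) → value Sub.⊥ x ≈ 0#
  value-⊥ {zero}  x = refl
  value-⊥ {suc n} x = trans (+-identityˡ _) (value-⊥ (x ∘ suc))

  value-⁅⁆ : ∀ {n} (i : Fin n) (x : Fin n → ℝ) → value ⁅ i ⁆ x ≈ x i
  value-⁅⁆ zero    x = trans (+-congˡ (value-⊥ (x ∘ suc))) (+-identityʳ _)
  value-⁅⁆ (suc i) x = trans (+-identityˡ _) (value-⁅⁆ i (x ∘ suc))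

  value-scale : ∀ {n} (S : Subset n) c (x : Fin n → ℝ) → value S (λ i → c * x i) ≈ c * value S x
  value-scale []            c x = sym (zeroʳ c)
  value-scale (inside ∷ S)  c x = trans (+-congˡ (value-scale S c (x ∘ suc))) (sym (distribˡ c _ _))
  value-scale (outside ∷ S) c x = trans (+-cong (sym (zeroʳ c)) (value-scale S c (x ∘ suc))) (sym (distribˡ c _ _))

  -- Each item is active with odds α times its probability q of belonging to
  -- the optimum; 7/25 nearly maximises α (1 - b₁) (1 - Σ bᵣ), where bᵣ is
  -- the probability that a Poisson variable of mean α r is at least r.
  α : ℝ
  α = ι 7 * ι 25 ⁻¹

  0≤α : 0# ≤ α
  0≤α = *-nonneg (0≤ι 7) (⁻¹-nonneg (0<ι 25))

  25α≈7 : ι 25 * α ≈ ι 7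
  25α≈7 = trans (solve 3 (λ a b c → a :* (b :* c) := b :* (a :* c)) refl (ι 25) (ι 7) (ι 25 ⁻¹))
    (trans (*-congˡ (*-inverseʳ (ι 25) (0<⇒≉0 (0<ι 25)))) (*-identityʳ _))

  module _ {n} (M : LaminarMatroid n) (q : Fin n → ℝ) (0≤q : ∀ i → 0# ≤ q i) (q≤1 : ∀ i → q i ≤ 1#)
           (polytope : ∀ {S} → S ∈ˡ LaminarMatroid.family M → value S q ≤ ι (LaminarMatroid.rank M S)) where
    open LaminarMatroid M

    odds : Fin n → ℝ
    odds i = α * q i

    odds-nonneg : ∀ i → 0# ≤ odds i
    odds-nonneg i = *-nonneg 0≤α (0≤q i)

    -- The sets of the family that contain i form a chain, so those of rank r
    -- have a largest member.
    largest : ∀ i r → 1 ℕ.≤ r → ∃ λ T → i Sub.∈ T × value T q ≤ ι r ×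
      (∀ {S} → S ∈ˡ family → i Sub.∈ S → rank S ≡ r → S Sub.⊆ T)
    largest i r 1≤r =
      let T , cand , maximal = go family (λ S∈ → S∈)
      in T , i∈ cand , light cand , maximal
      where
      -- When no set of rank `r` contains `i`, the default is `⁅ i ⁆`, which is light because
      -- `q i ≤ 1 ≤ r`. In every case `i` belongs to the result, so missing the set for rank 1 also
      -- means that `i` itself is inactive.
      Candidate : Subset n → Set
      Candidate T = T ≡ ⁅ i ⁆ ⊎ (T ∈ˡ family × i Sub.∈ T × rank T ≡ r)

      i∈ : ∀ {T} → Candidate T → i Sub.∈ T
      i∈ (inj₁ ≡.refl)       = x∈⁅x⁆ i
      i∈ (inj₂ (_ , i∈T , _)) = i∈T

      light : ∀ {T} → Candidate T → value T q ≤ ι r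
      light (inj₁ ≡.refl) = begin
        value ⁅ i ⁆ q ≈⟨ value-⁅⁆ i q ⟩
        q i           ≤⟨ q≤1 i ⟩
        1#            ≈⟨ ι-1 ⟨
        ι 1           ≤⟨ ι-mono 1≤r ⟩
        ι r           ∎
      light (inj₂ (T∈ , _ , ≡.refl)) = polytope T∈

      go : ∀ Ss → (∀ {S} → S ∈ˡ Ss → S ∈ˡ family) → ∃ λ T → Candidate T ×
           (∀ {S} → S ∈ˡ Ss → i Sub.∈ S → rank S ≡ r → S Sub.⊆ T)
      go [] _ = ⁅ i ⁆ , inj₁ ≡.refl , λ ()
      go (S₀ ∷ Ss) ⊆family with go Ss (⊆family ∘ there)
      ... | T , cand , maximal with lem {P = i Sub.∈ S₀ × rank S₀ ≡ r}
      ...   | no ¬cand₀ = T , cand , λ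
                { (here ≡.refl) i∈S rank≡ → contradiction (i∈S , rank≡) ¬cand₀
                ; (there S∈) → maximal S∈ }
      ...   | yes (i∈S₀ , rank≡₀) with comparable cand
        where
        comparable : Candidate T → T Sub.⊆ S₀ ⊎ S₀ Sub.⊆ T
        comparable (inj₁ ≡.refl) = inj₁ (λ x∈ → ≡.subst (Sub._∈ S₀) (≡.sym (x∈⁅y⁆⇒x≡y i x∈)) i∈S₀)
        comparable (inj₂ (T∈ , i∈T , _)) with laminar T∈ (⊆family (here ≡.refl))
        ... | inj₁ disjoint = contradiction (i , x∈p∩q⁺ (i∈T , i∈S₀)) disjoint
        ... | inj₂ nested   = nested
      ...     | inj₁ T⊆S₀ = S₀ , inj₂ (⊆family (here ≡.refl) , i∈S₀ , rank≡₀) , λ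
                { (here ≡.refl) _ _ x∈ → x∈
                ; (there S∈) i∈S rank≡ x∈ → T⊆S₀ (maximal S∈ i∈S rank≡ x∈) }
      ...     | inj₂ S₀⊆T = T , cand , λ
                { (here ≡.refl) _ _ x∈ → S₀⊆T x∈
                ; (there S∈) → maximal S∈ }

    free-probability : ∀ i → Unloop M i →
      ι 4 ≤ ι 7 * mean (randomSubset odds odds-nonneg) (λ A → 𝟙 (lookup A i ≡ outside × Unblocked M i A))
    free-probability i unloop = ≤-trans (sparse-probability odds odds-nonneg chain light)
      (*-monoˡ-≤ (0≤ι 7) (Mean.mono (randomSubset odds odds-nonneg) (λ A → 𝟙-mono (free A))))
      where
      chain : ℕ → Subset n
      -- A filler that makes the rank the index: `i` is not a loop, so no set containing it has rank
      -- 0.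
      chain zero    = Sub.⊥
      chain (suc r) = proj₁ (largest i (suc r) (ℕ.s≤s ℕ.z≤n))

      chain-light : ∀ r → value (chain r) q ≤ ι r
      chain-light zero    = ≤-reflexive (trans (value-⊥ q) (sym ι-0))
      chain-light (suc r) = proj₁ (proj₂ (proj₂ (largest i (suc r) (ℕ.s≤s ℕ.z≤n))))

      light : ∀ r → ι 25 * value (chain r) odds ≤ ι (7 ℕ.* r)
      light r = begin
        ι 25 * value (chain r) odds       ≈⟨ *-congˡ (value-scale (chain r) α q) ⟩
        ι 25 * (α * value (chain r) q)    ≈⟨ trans (sym (*-assoc _ _ _)) (*-congʳ 25α≈7) ⟩
        ι 7 * value (chain r) q           ≤⟨ *-monoˡ-≤ (0≤ι 7) (chain-light r) ⟩
        ι 7 * ι r                         ≈⟨ ι-* 7 r ⟨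
        ι (7 ℕ.* r)                       ∎

      free : ∀ A → Sparse odds odds-nonneg chain light A → lookup A i ≡ outside × Unblocked M i A
      free A (missed , below) = i∉A , unblocked
        where
        i∉A : lookup A i ≡ outside
        i∉A with lookup A i in eq
        ... | false = ≡.refl
        ... | true  = contradiction (≡.subst₂ ℕ._≤_ (∣⁅x⁆∣≡1 i) missed (p⊆q⇒∣p∣≤∣q∣ i⊆)) λ ()
          where
          i⊆ : ⁅ i ⁆ Sub.⊆ (A Sub.∩ chain 1)
          i⊆ x∈ rewrite x∈⁅y⁆⇒x≡y i x∈ =
            x∈p∩q⁺ (lookup⇒[]= i A eq , proj₁ (proj₂ (largest i 1 (ℕ.s≤s ℕ.z≤n))))
        unblocked : Unblocked M i A
        unblocked {S} S∈ i∈S with rank S in eq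
        ... | zero = contradiction eq (unloop S∈ i∈S)
        ... | suc r = ℕ.≤-<-trans (∩-monoʳ M {A} (proj₂ (proj₂ (proj₂ (largest i (suc r) (ℕ.s≤s ℕ.z≤n)))) S∈ i∈S eq)) (small r)
          where
          small : ∀ r → ∣ A Sub.∩ chain (suc r) ∣ ℕ.< suc r
          small zero    = ℕ.s≤s (ℕ.≤-reflexive missed)
          small (suc r) = below (suc (suc r)) (ℕ.s≤s (ℕ.s≤s ℕ.z≤n))

-- Once entry `i` of the active set is overwritten, coordinate `i` of either argument is invisible:
-- the room for an item depends on neither its own threshold nor its own level.
zipWith-update : ∀ {A B C : Set} (f : A → B → C) {n} (xs : Vec A n) (ys : Vec B n) i x c →
  zipWith f (xs [ i ]≔ x) ys [ i ]≔ c ≡ zipWith f xs ys [ i ]≔ c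
zipWith-update f (_ ∷ _) (_ ∷ _) zero x c = ≡.refl
zipWith-update f (a ∷ xs) (b ∷ ys) (suc i) x c = ≡.cong (f a b ∷_) (zipWith-update f xs ys i x c)

zipWith-updateʳ : ∀ {A B C : Set} (f : A → B → C) {n} (xs : Vec A n) (ys : Vec B n) i y c →
  zipWith f xs (ys [ i ]≔ y) [ i ]≔ c ≡ zipWith f xs ys [ i ]≔ c
zipWith-updateʳ f (_ ∷ _) (_ ∷ _) zero y c = ≡.refl
zipWith-updateʳ f (a ∷ xs) (b ∷ ys) (suc i) y c = ≡.cong (f a b ∷_) (zipWith-updateʳ f xs ys i y c)

Independent-⊥ : ∀ {n} (M : LaminarMatroid n) → LaminarMatroid.Independent M Sub.⊥
Independent-⊥ {n} M = All.tabulate λ {S} _ →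
  ℕ.≤-trans (ℕ.≤-trans (∣p∩q∣≤∣p∣ Sub.⊥ S) (ℕ.≤-reflexive (∣⊥∣≡0 n))) ℕ.z≤n

independent⇒unloop : ∀ {n} (M : LaminarMatroid n) {I i} → LaminarMatroid.Independent M I →
  lookup I i ≡ true → Unloop M i
independent⇒unloop M {I} {i} ind i∈I {S} S∈ i∈S rank≡0 = contradiction
  (≡.subst₂ ℕ._≤_ (∣⁅x⁆∣≡1 i) rank≡0 (ℕ.≤-trans (p⊆q⇒∣p∣≤∣q∣ i⊆) (All.lookup ind S∈))) λ ()
  where
  i⊆ : Sub.⁅ i ⁆ Sub.⊆ (I Sub.∩ S)
  i⊆ x∈ rewrite x∈⁅y⁆⇒x≡y i x∈ = x∈p∩q⁺ (lookup⇒[]= i I i∈I , i∈S)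

-- The optimal set and its stability

module BestSet (lem : ∀ {ℓ} → ExcludedMiddle ℓ) (R : CompleteOrderedField) where
  open Prophet lem R hiding (zero)
  open OrderedField R
  open Expectation lem R
  open ≤-Reasoning

  value-nonneg : ∀ {n} (I : Subset n) {x : Fin n → ℝ} → (∀ i → 0# ≤ x i) → 0# ≤ value I x
  value-nonneg I {x} h = sum-nonneg (λ i → term (lookup I i) i)
    where
    term : ∀ b i → 0# ≤ (if b then x i else 0#)
    term true  i = h i
    term false i = ≤-refl

  value-cong : ∀ {n} (I : Subset n) {x y : Fin n → ℝ} → (∀ i → x i ≈ y i) → value I x ≈ value I y
  value-cong I {x} {y} h = sum-cong (λ i → term (lookup I i) i)
    where
    term : ∀ b i → (if b then x i else 0#) ≈ (if b then y i else 0#)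
    term true  i = h i
    term false i = refl

  value-update : ∀ {n} (I : Subset n) (x y : Fin n → ℝ) i → (∀ j → j ≢ i → y j ≈ x j) →
    value I y ≈ value I x + (if lookup I i then y i - x i else 0#)
  value-update (true ∷ I) x y zero h = trans (+-congˡ (value-cong I (λ j → h (suc j) λ ())))
    (solve 3 (λ x y v → y :+ v := x :+ v :+ (y :- x)) refl (x zero) (y zero) (value I (x ∘ suc)))
  value-update (false ∷ I) x y zero h = trans (+-congˡ (value-cong I (λ j → h (suc j) λ ()))) (sym (+-identityʳ _))
  value-update (b ∷ I) x y (suc i) h = begin-equality
    (if b then y zero else 0#) + value I (y ∘ suc)
      ≈⟨ +-cong (head b) (value-update I (x ∘ suc) (y ∘ suc) i (λ j j≢i → h (suc j) λ { ≡.refl → j≢i ≡.refl })) ⟩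
    (if b then x zero else 0#) + (value I (x ∘ suc) + _)
      ≈⟨ +-assoc _ _ _ ⟨
    value (b ∷ I) x + (if lookup I i then y (suc i) - x (suc i) else 0#) ∎
    where
    head : ∀ b → (if b then y zero else 0#) ≈ (if b then x zero else 0#)
    head true  = h zero λ ()
    head false = refl

  best : ∀ {n} → List (Subset n) → (Fin n → ℝ) → Subset n
  best []       x = Sub.⊥
  best (I ∷ Is) x = if ⟦ value (best Is x) x ≤ value I x ⟧ then I else best Is x

  best-all : ∀ {n} {P : Subset n → Set} {Is} x → P Sub.⊥ → All P Is → P (best Is x)
  best-all x p⊥ [] = p⊥
  best-all {Is = I ∷ Is} x p⊥ (pI ∷ pIs) with lem {P = value (best Is x) x ≤ value I x}
  ... | yes _ = pI
  ... | no _  = best-all x p⊥ pIs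

  best-max : ∀ {n} (Is : List (Subset n)) x → All (λ I → value I x ≤ value (best Is x) x) Is
  best-max []       x = []
  best-max (I ∷ Is) x with lem {P = value (best Is x) x ≤ value I x}
  ... | yes J≤I = ≤-refl ∷ All.map (λ p → ≤-trans p J≤I) (best-max Is x)
  ... | no J≰I  = <⇒≤ J≰I ∷ best-max Is x

  if≤ : ∀ {x} → 0# ≤ x → ∀ b → (if b then x else 0#) ≤ x
  if≤ 0≤x true  = ≤-refl
  if≤ 0≤x false = 0≤x

  -- Ties are broken by position in the list, so raising the value of a chosen
  -- item does not change the choice.
  best-stable : ∀ {n} (Is : List (Subset n)) (x y : Fin n → ℝ) i → (∀ j → 0# ≤ x j) →
    (∀ j → j ≢ i → y j ≈ x j) → x i ≤ y i →
    lookup (best Is x) i ≡ true → best Is y ≡ best Is x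
  best-stable []       x y i 0≤x y≈x x≤y _ = ≡.refl
  best-stable {n} (I ∷ Is) x y i 0≤x y≈x x≤y chosen
    with lem {P = value (best Is x) x ≤ value I x} | lem {P = value (best Is y) y ≤ value I y}
  ... | yes J≤I | yes _ = ≡.refl
  -- `I` contains `i` and gains the whole increase `y i - x i`; every competitor gains at most that.
  ... | yes J≤I | no J′≰I = contradiction J′≤I J′≰I
    where
    J′≤I : value (best Is y) y ≤ value I y
    J′≤I = begin
      value (best Is y) y                             ≈⟨ value-update (best Is y) x y i y≈x ⟩
      value (best Is y) x + _                         ≤⟨ +-mono-≤ (best-all {P = λ I → value I x ≤ value (best Is x) x} y
                                                            (≤-respˡ (sym ⊥≈0) (value-nonneg (best Is x) 0≤x)) (best-max Is x))
                                                          (if≤ (0≤y-x x≤y) (lookup (best Is y) i)) ⟩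
      value (best Is x) x + (y i - x i)               ≤⟨ +-monoˡ-≤ _ J≤I ⟩
      value I x + (y i - x i)                         ≡⟨ ≡.cong (λ b → value I x + (if b then y i - x i else 0#)) chosen ⟨
      value I x + (if lookup I i then y i - x i else 0#) ≈⟨ value-update I x y i y≈x ⟨
      value I y                                       ∎
      where
      ⊥≈0 : value {n} Sub.⊥ x ≈ 0#
      ⊥≈0 = LaminarContention.value-⊥ lem R x
  ... | no J≰I | no _ = best-stable Is x y i 0≤x y≈x x≤y chosen
  ... | no J≰I | yes J′≤I = contradiction (+-cancelʳ-≤ (y i - x i) (begin
      value (best Is x) x + (y i - x i)  ≡⟨ ≡.cong (λ b → value (best Is x) x + (if b then y i - x i else 0#)) chosen ⟨
      value (best Is x) x + _            ≈⟨ value-update (best Is x) x y i y≈x ⟨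
      value (best Is x) y                ≡⟨ ≡.cong (λ J → value J y) (best-stable Is x y i 0≤x y≈x x≤y chosen) ⟨
      value (best Is y) y                ≤⟨ J′≤I ⟩
      value I y                          ≈⟨ value-update I x y i y≈x ⟩
      value I x + _                      ≤⟨ +-monoʳ-≤ _ (if≤ (0≤y-x x≤y) (lookup I i)) ⟩
      value I x + (y i - x i)            ∎)) J≰I

  value-count : ∀ {n} (S A : Subset n) → value S (λ i → 𝟙 (lookup A i ≡ true)) ≈ ι ∣ A Sub.∩ S ∣
  value-count [] [] = sym ι-0
  value-count (true ∷ S) (true ∷ A)  = trans (+-cong (𝟙-yes ≡.refl) (value-count S A)) (sym (ι-suc _))
  value-count (true ∷ S) (false ∷ A) = trans (+-cong (𝟙-no λ ()) (value-count S A)) (+-identityˡ _)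
  value-count (false ∷ S) (true ∷ A)  = trans (+-congˡ (value-count S A)) (+-identityˡ _)
  value-count (false ∷ S) (false ∷ A) = trans (+-congˡ (value-count S A)) (+-identityˡ _)

-- A random threshold with prescribed probabilities of being exceeded

module RandomThreshold (lem : ∀ {ℓ} → ExcludedMiddle ℓ) (R : CompleteOrderedField) where
  open Prophet lem R hiding (zero)
  open OrderedField R
  open Expectation lem R
  open Mean using (mean)

  private
    -- Threshold `k < N` has weight `g (k+1) - g k`. The remaining weight `1 - g N` sits on `k = N`,
    -- which no level up to `N` exceeds.
    increments : ∀ N → (ℕ → ℝ) → Fin (suc N) → ℝ
    increments zero    g _       = 1# - g 0
    increments (suc N) g zero    = g 1 - g 0
    increments (suc N) g (suc k) = increments N (g ∘ suc) k

    increments-nonneg : ∀ N g → (∀ a → g a ≤ g (suc a)) → (∀ a → g a ≤ 1#) → ∀ k → 0# ≤ increments N g k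
    increments-nonneg zero    g mono ≤1 _       = 0≤y-x (≤1 0)
    increments-nonneg (suc N) g mono ≤1 zero    = 0≤y-x (mono 0)
    increments-nonneg (suc N) g mono ≤1 (suc k) = increments-nonneg N (g ∘ suc) (mono ∘ suc) (≤1 ∘ suc) k

    increments-sum : ∀ N g → sum (increments N g) ≈ 1# - g 0
    increments-sum zero    g = +-identityʳ _
    increments-sum (suc N) g = trans (+-congˡ (increments-sum N (g ∘ suc)))
      (solve 2 (λ a b → (b :- a) :+ (con (+ 1) :- b) := con (+ 1) :- a) refl (g 0) (g 1))

    increments-below : ∀ N g a → a ℕ.≤ N →
      sum (λ k → increments N g k * 𝟙 (True (toℕ k <ᵇ a))) ≈ g a - g 0
    increments-below N g zero _ = trans (sum-zero (λ k → trans (*-congˡ (𝟙-no {True (toℕ k <ᵇ 0)} (¬k<0 (toℕ k)))) (zeroʳ (increments N g k))))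
      (sym (-‿inverseʳ (g 0)))
      where
      ¬k<0 : ∀ k → ¬ True (k <ᵇ 0)
      ¬k<0 zero    ()
      ¬k<0 (suc k) ()
    increments-below (suc N) g (suc a) (ℕ.s≤s a≤N) = trans
      (+-cong (trans (*-congˡ (𝟙-yes tt)) (*-identityʳ _)) (increments-below N (g ∘ suc) a a≤N))
      (solve 3 (λ x y z → (y :- x) :+ (z :- y) := z :- x) refl (g 0) (g 1) (g (suc a)))

  module _ (N : ℕ) (g : ℕ → ℝ) (g0≈0 : g 0 ≈ 0#) (mono : ∀ a → g a ≤ g (suc a)) (g≤1 : ∀ a → g a ≤ 1#) where

    abstract
      threshold : Mean ℕ
      threshold = fromWeights (increments N g) (increments-nonneg N g mono g≤1)
        (trans (increments-sum N g) (trans (+-congˡ (-‿cong g0≈0)) (solve 0 (con (+ 1) :- con (+ 0) := con (+ 1)) refl))) toℕ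

      threshold-below : ∀ a → a ℕ.≤ N → mean threshold (λ k → 𝟙 (True (k <ᵇ a))) ≈ g a
      threshold-below a a≤N = trans (increments-below N g a a≤N)
        (trans (+-congˡ (-‿cong g0≈0)) (solve 1 (λ x → x :- con (+ 0) := x) refl (g a)))

-- The prophet inequality on the grid

module DiscreteProphet (lem : ∀ {ℓ} → ExcludedMiddle ℓ) (R : CompleteOrderedField) where
  open Prophet lem R hiding (zero)
  open OrderedField R
  open Expectation lem R
  open RandomSubsets lem R
  open LaminarContention lem R
  open BestSet lem R
  open RandomThreshold lem R
  open Mean using (mean)
  open CommutativeSemigroupProperties *-commutativeSemigroup using (x∙yz≈y∙xz)
  open ≤-Reasoning

  module _ {n} (M : LaminarMatroid n) (δ : ℝ) (0≤δ : 0# ≤ δ) where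
    open LaminarMatroid M

    levelValue : Vec ℕ n → Fin n → ℝ
    levelValue ℓ i = δ * ι (lookup ℓ i)

    levelValue-nonneg : ∀ ℓ i → 0# ≤ levelValue ℓ i
    levelValue-nonneg ℓ i = *-nonneg 0≤δ (0≤ι (lookup ℓ i))

    optimum : Vec ℕ n → Subset n
    optimum ℓ = best (filter independent? (allSubsets n)) (levelValue ℓ)

    optimum-independent : ∀ ℓ → Independent (optimum ℓ)
    optimum-independent ℓ = best-all (levelValue ℓ) (Independent-⊥ M) (all-filter independent? (allSubsets n))

    optimum-value : Vec ℕ n → ℝ
    optimum-value ℓ = value (optimum ℓ) (levelValue ℓ)

    active : Vec ℕ n → Vec ℕ n → Subset n
    active κ ℓ = zipWith _<ᵇ_ κ ℓ

    gain : Fin n → ℕ → ℕ → ℝ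
    gain i k a = (δ * ι a) * 𝟙 (True (k <ᵇ a))

    Room : Fin n → Subset n → Set
    Room i A = Unblocked M i (A [ i ]≔ outside)

    -- A lower bound for what thresholds `κ` earn at levels `ℓ`. An active item is credited only if
    -- it has room beside all other active items, including later ones; this removes the arrival
    -- order and makes the two factors of each term depend on disjoint coordinates.
    thresholdValue : Vec ℕ n → Vec ℕ n → ℝ
    thresholdValue κ ℓ = sum (λ i → gain i (lookup κ i) (lookup ℓ i) * 𝟙 (Room i (active κ ℓ)))

    private
      -- Excluding level 0 loses no value and makes `rate i 0` vanish, as the distribution of a
      -- threshold requires.
      Picked : Fin n → Vec ℕ n → Set
      Picked i ℓ = (0 ℕ.< lookup ℓ i) × (lookup (optimum ℓ) i ≡ true)

      Picked-mono : ∀ i ℓ {a b} → a ℕ.≤ b → Picked i (ℓ [ i ]≔ a) → Picked i (ℓ [ i ]≔ b)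
      Picked-mono i ℓ {a} {b} a≤b (0<a , chosen) =
        ≡.subst (0 ℕ.<_) (≡.sym (lookup∘update i ℓ b)) (ℕ.<-≤-trans (≡.subst (0 ℕ.<_) (lookup∘update i ℓ a) 0<a) a≤b) ,
        ≡.trans (≡.cong (λ I → lookup I i) (best-stable (filter independent? (allSubsets n))
          (levelValue (ℓ [ i ]≔ a)) (levelValue (ℓ [ i ]≔ b)) i (levelValue-nonneg (ℓ [ i ]≔ a)) same raised chosen)) chosen
        where
        same : ∀ j → j ≢ i → levelValue (ℓ [ i ]≔ b) j ≈ levelValue (ℓ [ i ]≔ a) j
        same j j≢i = *-congˡ (reflexive (≡.cong ι (≡.trans (lookup∘update′ j≢i ℓ b) (≡.sym (lookup∘update′ j≢i ℓ a)))))
        raised : levelValue (ℓ [ i ]≔ a) i ≤ levelValue (ℓ [ i ]≔ b) i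
        raised = *-monoˡ-≤ 0≤δ (ι-mono (≡.subst₂ ℕ._≤_ (≡.sym (lookup∘update i ℓ a)) (≡.sym (lookup∘update i ℓ b)) a≤b))

    -- `π-bounded` expresses that every `π i` lives on the levels up to `N`, the range in which
    -- `threshold-below` is valid.
    module _ (N : ℕ) (π : Fin n → Mean ℕ)
      (π-bounded : ∀ i {f g} → (∀ a → a ℕ.≤ N → f a ≈ g a) → mean (π i) f ≈ mean (π i) g) where

      private
        module 𝔼 = Mean (product π)

        -- The probability of being picked given level `a`; by independence, conditioning on the
        -- level is overwriting the coordinate.
        rate : Fin n → ℕ → ℝ
        rate i a = 𝔼.mean (λ ℓ → 𝟙 (Picked i (ℓ [ i ]≔ a)))

        rate-zero : ∀ i → rate i 0 ≈ 0#
        rate-zero i = trans (𝔼.cong (λ ℓ → 𝟙-no (λ (0<0 , _) → ℕ.n≮n 0 (≡.subst (0 ℕ.<_) (lookup∘update i ℓ 0) 0<0))))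
          (𝔼.const 0#)

        rate-mono : ∀ i a → rate i a ≤ rate i (suc a)
        rate-mono i a = 𝔼.mono (λ ℓ → 𝟙-mono (Picked-mono i ℓ (ℕ.n≤1+n a)))

        rate-nonneg : ∀ i a → 0# ≤ rate i a
        rate-nonneg i a = 𝔼.nonneg (λ ℓ → 𝟙-nonneg _)

        rate≤1 : ∀ i a → rate i a ≤ 1#
        rate≤1 i a = ≤-respʳ (𝔼.const 1#) (𝔼.mono (λ ℓ → 𝟙≤1 _))

        q : Fin n → ℝ
        q i = mean (π i) (rate i)

        v : Fin n → ℝ
        v i = mean (π i) (λ a → (δ * ι a) * rate i a)

        0≤q : ∀ i → 0# ≤ q i
        0≤q i = Mean.nonneg (π i) (rate-nonneg i)

        q≤1 : ∀ i → q i ≤ 1#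
        q≤1 i = ≤-respʳ (Mean.const (π i) 1#) (Mean.mono (π i) (rate≤1 i))

        0≤v : ∀ i → 0# ≤ v i
        0≤v i = Mean.nonneg (π i) (λ a → *-nonneg (*-nonneg 0≤δ (0≤ι a)) (rate-nonneg i a))

        q-global : ∀ i → q i ≈ 𝔼.mean (λ ℓ → 𝟙 (Picked i ℓ))
        q-global i = sym (fubini π i (λ ℓ → 𝟙 (Picked i ℓ)))

        v-global : ∀ i → v i ≈ 𝔼.mean (λ ℓ → levelValue ℓ i * 𝟙 (Picked i ℓ))
        v-global i = sym (trans (fubini π i (λ ℓ → levelValue ℓ i * 𝟙 (Picked i ℓ)))
          (Mean.cong (π i) (λ a → trans
            (𝔼.cong (λ ℓ → *-congʳ (*-congˡ (reflexive (≡.cong ι (lookup∘update i ℓ a))))))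
            (𝔼.*-homo (δ * ι a) (λ ℓ → 𝟙 (Picked i (ℓ [ i ]≔ a)))))))

        polytope : ∀ {S} → S ∈ˡ family → value S q ≤ ι (rank S)
        polytope {S} S∈ = begin
          value S q
            ≈⟨ value-cong S q-global ⟩
          value S (λ i → 𝔼.mean (λ ℓ → 𝟙 (Picked i ℓ)))
            ≈⟨ sum-cong {n} (λ i → term i (lookup S i)) ⟨
          sum {n} (λ i → 𝔼.mean (λ ℓ → if lookup S i then 𝟙 (Picked i ℓ) else 0#))
            ≈⟨ 𝔼.sum-homo (λ i ℓ → if lookup S i then 𝟙 (Picked i ℓ) else 0#) ⟨
          𝔼.mean (λ ℓ → value S (λ i → 𝟙 (Picked i ℓ)))
            ≤⟨ 𝔼.mono (λ ℓ → ≤-respʳ (value-count S (optimum ℓ)) (value-mono S (λ i → 𝟙-mono proj₂))) ⟩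
          𝔼.mean (λ ℓ → ι ∣ optimum ℓ Sub.∩ S ∣)
            ≤⟨ 𝔼.mono (λ ℓ → ι-mono (All.lookup (optimum-independent ℓ) S∈)) ⟩
          𝔼.mean (λ ℓ → ι (rank S))
            ≈⟨ 𝔼.const (ι (rank S)) ⟩
          ι (rank S) ∎
          where
          term : ∀ i b → 𝔼.mean (λ ℓ → if b then 𝟙 (Picked i ℓ) else 0#) ≈ (if b then 𝔼.mean (λ ℓ → 𝟙 (Picked i ℓ)) else 0#)
          term i true  = refl
          term i false = 𝔼.const 0#

        sum-v : sum v ≈ 𝔼.mean optimum-value
        sum-v = begin-equality
          sum v
            ≈⟨ sum-cong {n} v-global ⟩
          sum {n} (λ i → 𝔼.mean (λ ℓ → levelValue ℓ i * 𝟙 (Picked i ℓ)))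
            ≈⟨ 𝔼.sum-homo (λ i ℓ → levelValue ℓ i * 𝟙 (Picked i ℓ)) ⟨
          𝔼.mean (λ ℓ → sum {n} (λ i → levelValue ℓ i * 𝟙 (Picked i ℓ)))
            ≈⟨ 𝔼.cong (λ ℓ → sum-cong {n} (term ℓ)) ⟩
          𝔼.mean optimum-value ∎
          where
          credit : ∀ b a → (δ * ι a) * 𝟙 ((0 ℕ.< a) × (b ≡ true)) ≈ (if b then δ * ι a else 0#)
          credit false a       = trans (*-congˡ (𝟙-no λ ())) (zeroʳ _)
          credit true  zero    = trans (*-congʳ (trans (*-congˡ ι-0) (zeroʳ δ)))
                                   (trans (zeroˡ _) (sym (trans (*-congˡ ι-0) (zeroʳ δ))))
          credit true  (suc a) = trans (*-congˡ (𝟙-yes (ℕ.s≤s ℕ.z≤n , ≡.refl))) (*-identityʳ _)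
          term : ∀ ℓ i → levelValue ℓ i * 𝟙 (Picked i ℓ) ≈ (if lookup (optimum ℓ) i then levelValue ℓ i else 0#)
          term ℓ i = credit (lookup (optimum ℓ) i) (lookup ℓ i)

        y : Fin n → ℝ
        y = odds M q 0≤q q≤1 polytope

        0≤y : ∀ i → 0# ≤ y i
        0≤y = odds-nonneg M q 0≤q q≤1 polytope

        -- This is `α / (1 + y i)`. Since `Λ i * q i` is the probability with odds `y i = α q i`,
        -- thinning the picks of `i` by `Λ i` produces exactly the intended odds of being active.
        Λ : Fin n → ℝ
        Λ i = α * (1# - prob (y i))

        0≤Λ : ∀ i → 0# ≤ Λ i
        0≤Λ i = *-nonneg 0≤α (0≤1-prob (0≤y i))

        Λ≤1 : ∀ i → Λ i ≤ 1#
        Λ≤1 i = begin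
          α * (1# - prob (y i)) ≤⟨ *-mono-≤ (0≤1-prob (0≤y i)) 0≤1 α≤1 1-p≤1 ⟩
          1# * 1#               ≈⟨ *-identityˡ 1# ⟩
          1#                    ∎
          where
          α≤1 : α ≤ 1#
          α≤1 = *-cancelˡ-≤ (0<ι 25) (≤-respˡ (sym 25α≈7) (≤-respʳ (sym (*-identityʳ (ι 25))) (ι-mono (ℕ.≤ᵇ⇒≤ 7 25 _))))
          1-p≤1 : 1# - prob (y i) ≤ 1#
          1-p≤1 = 0≤y-x⇒x≤y (≤-respʳ (solve 1 (λ p → p := con (+ 1) :- (con (+ 1) :- p)) refl (prob (y i))) (prob-nonneg (0≤y i)))

        thinned : Fin n → ℕ → ℝ
        thinned i a = Λ i * rate i a

        thinned-zero : ∀ i → thinned i 0 ≈ 0#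
        thinned-zero i = trans (*-congˡ (rate-zero i)) (zeroʳ _)

        thinned-mono : ∀ i a → thinned i a ≤ thinned i (suc a)
        thinned-mono i a = *-monoˡ-≤ (0≤Λ i) (rate-mono i a)

        thinned≤1 : ∀ i a → thinned i a ≤ 1#
        thinned≤1 i a = ≤-respʳ (*-identityˡ 1#) (*-mono-≤ (rate-nonneg i a) 0≤1 (Λ≤1 i) (rate≤1 i a))

        ν : Fin n → Mean ℕ
        ν i = threshold N (thinned i) (thinned-zero i) (thinned-mono i) (thinned≤1 i)

        ν-below : ∀ i a → a ℕ.≤ N → mean (ν i) (λ k → 𝟙 (True (k <ᵇ a))) ≈ thinned i a
        ν-below i = threshold-below N (thinned i) (thinned-zero i) (thinned-mono i) (thinned≤1 i)

        active-probability : ∀ i → relate _<ᵇ_ ν π i ≈ prob (y i)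
        active-probability i = begin-equality
          mean (ν i) (λ k → mean (π i) (λ a → 𝟙 (True (k <ᵇ a))))
            ≈⟨ Mean.swap (ν i) (Mean.linear (π i)) (λ k a → 𝟙 (True (k <ᵇ a))) ⟩
          mean (π i) (λ a → mean (ν i) (λ k → 𝟙 (True (k <ᵇ a))))
            ≈⟨ π-bounded i (ν-below i) ⟩
          mean (π i) (λ a → Λ i * rate i a)
            ≈⟨ Mean.*-homo (π i) (Λ i) (rate i) ⟩
          α * (1# - prob (y i)) * q i
            ≈⟨ solve 3 (λ a p q → a :* p :* q := a :* q :* p) refl α (1# - prob (y i)) (q i) ⟩
          y i * (1# - prob (y i))
            ≈⟨ prob≈y*[1-prob] (0≤y i) ⟨
          prob (y i) ∎

        mean-gain-at : ∀ i a → a ℕ.≤ N → mean (ν i) (λ k → gain i k a) ≈ (δ * ι a) * (Λ i * rate i a)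
        mean-gain-at i a a≤N = trans (Mean.*-homo (ν i) (δ * ι a) (λ k → 𝟙 (True (k <ᵇ a)))) (*-congˡ (ν-below i a a≤N))

        mean-gain : ∀ i → mean (ν i) (λ k → mean (π i) (gain i k)) ≈ Λ i * v i
        mean-gain i = begin-equality
          mean (ν i) (λ k → mean (π i) (gain i k))
            ≈⟨ Mean.swap (ν i) (Mean.linear (π i)) (gain i) ⟩
          mean (π i) (λ a → mean (ν i) (λ k → gain i k a))
            ≈⟨ π-bounded i (mean-gain-at i) ⟩
          mean (π i) (λ a → (δ * ι a) * (Λ i * rate i a))
            ≈⟨ Mean.cong (π i) (λ a → x∙yz≈y∙xz (δ * ι a) (Λ i) (rate i a)) ⟩
          mean (π i) (λ a → Λ i * ((δ * ι a) * rate i a))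
            ≈⟨ Mean.*-homo (π i) (Λ i) (λ a → (δ * ι a) * rate i a) ⟩
          Λ i * v i ∎

        𝔼²[_] : (Vec ℕ n → Vec ℕ n → ℝ) → ℝ
        𝔼²[ f ] = mean (product ν) (λ κ → 𝔼.mean (f κ))

        room : Fin n → Subset n → ℝ
        room i A = 𝟙 (Room i A)

        Q : Fin n → ℝ
        Q i = mean (randomSubset y 0≤y) (room i)

        room-probability : ∀ i → 𝔼²[ (λ κ ℓ → room i (active κ ℓ)) ] ≈ Q i
        room-probability i = pushforward _<ᵇ_ ν π (λ i → oddsCoin (0≤y i))
          (λ i f → trans (oddsCoin-mean (0≤y i) f)
            (+-cong (*-congʳ (sym (active-probability i))) (*-congʳ (+-congˡ (-‿cong (sym (active-probability i)))))))
          (room i)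

        -- The room for `i` ignores coordinate `i` of both vectors, so gain and room separate: over
        -- the levels for fixed thresholds, and then over the thresholds.
        term-mean : ∀ i → 𝔼²[ (λ κ ℓ → gain i (lookup κ i) (lookup ℓ i) * room i (active κ ℓ)) ] ≈ Λ i * v i * Q i
        term-mean i = begin-equality
          𝔼²[ (λ κ ℓ → gain i (lookup κ i) (lookup ℓ i) * room i (active κ ℓ)) ]
            ≈⟨ Mean.cong (product ν) (λ κ → independence π i (gain i (lookup κ i)) (λ ℓ → room i (active κ ℓ))
                 (λ ℓ a → reflexive (≡.cong (λ A → 𝟙 (Unblocked M i A)) (zipWith-updateʳ _<ᵇ_ κ ℓ i a outside)))) ⟩
          mean (product ν) (λ κ → mean (π i) (gain i (lookup κ i)) * 𝔼.mean (λ ℓ → room i (active κ ℓ)))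
            ≈⟨ independence ν i (λ k → mean (π i) (gain i k)) (λ κ → 𝔼.mean (λ ℓ → room i (active κ ℓ)))
                 (λ κ k → 𝔼.cong (λ ℓ → reflexive (≡.cong (λ A → 𝟙 (Unblocked M i A)) (zipWith-update _<ᵇ_ κ ℓ i k outside)))) ⟩
          mean (ν i) (λ k → mean (π i) (gain i k)) * 𝔼²[ (λ κ ℓ → room i (active κ ℓ)) ]
            ≈⟨ *-cong (mean-gain i) (room-probability i) ⟩
          Λ i * v i * Q i ∎

        mean-thresholdValue : 𝔼²[ thresholdValue ] ≈ sum {n} (λ i → Λ i * v i * Q i)
        mean-thresholdValue = begin-equality
          𝔼²[ thresholdValue ]
            ≈⟨ Mean.cong (product ν) (λ κ → 𝔼.sum-homo (λ i ℓ → gain i (lookup κ i) (lookup ℓ i) * room i (active κ ℓ))) ⟩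
          mean (product ν) (λ κ → sum {n} (λ i → 𝔼.mean (λ ℓ → gain i (lookup κ i) (lookup ℓ i) * room i (active κ ℓ))))
            ≈⟨ Mean.sum-homo (product ν) (λ i κ → 𝔼.mean (λ ℓ → gain i (lookup κ i) (lookup ℓ i) * room i (active κ ℓ))) ⟩
          sum {n} (λ i → 𝔼²[ (λ κ ℓ → gain i (lookup κ i) (lookup ℓ i) * room i (active κ ℓ)) ])
            ≈⟨ sum-cong {n} term-mean ⟩
          sum (λ i → Λ i * v i * Q i) ∎

        loop-worthless : ∀ i → ¬ Unloop M i → v i ≈ 0#
        loop-worthless i loop = trans (v-global i) (trans (𝔼.cong (λ ℓ → trans (*-congˡ (𝟙-no (never ℓ))) (zeroʳ _))) (𝔼.const 0#))
          where
          never : ∀ ℓ → ¬ Picked i ℓ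
          never ℓ (_ , chosen) = loop (independent⇒unloop M {optimum ℓ} (optimum-independent ℓ) chosen)

        -- That `i` is inactive is independent of the room left by the others. The resulting factor
        -- `1 - prob (y i)` is the one already contained in `Λ i`, so `term-bound` pays for it only
        -- once.
        free≤room : ∀ i → mean (randomSubset y 0≤y) (λ A → 𝟙 (lookup A i ≡ outside × Unblocked M i A)) ≤ (1# - prob (y i)) * Q i
        free≤room i = begin
          mean (randomSubset y 0≤y) (λ A → 𝟙 (lookup A i ≡ outside × Unblocked M i A))
            ≤⟨ Mean.mono (randomSubset y 0≤y) (λ A → ≤-respʳ (𝟙-× (lookup A i ≡ outside) (Room i A)) (𝟙-mono (to A))) ⟩
          mean (randomSubset y 0≤y) (λ A → 𝟙 (lookup A i ≡ outside) * room i A)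
            ≈⟨ independence (λ i → oddsCoin (0≤y i)) i (λ b → 𝟙 (b ≡ outside)) (room i)
                 (λ A b → reflexive (≡.cong (λ B → 𝟙 (Unblocked M i B)) ([]≔-idempotent A i))) ⟩
          mean (oddsCoin (0≤y i)) (λ b → 𝟙 (b ≡ outside)) * Q i
            ≈⟨ *-congʳ (oddsCoin-mean (0≤y i) (λ b → 𝟙 (b ≡ outside))) ⟩
          (prob (y i) * 𝟙 (true ≡ outside) + (1# - prob (y i)) * 𝟙 (false ≡ outside)) * Q i
            ≈⟨ *-congʳ (trans (+-cong (trans (*-congˡ (𝟙-no λ ())) (zeroʳ _)) (trans (*-congˡ (𝟙-yes ≡.refl)) (*-identityʳ _))) (+-identityˡ _)) ⟩
          (1# - prob (y i)) * Q i ∎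
          where
          to : ∀ A → lookup A i ≡ outside × Unblocked M i A → lookup A i ≡ outside × Room i A
          to A (i∉A , ub) = i∉A , ≡.subst (Unblocked M i) (≡.sym (≡.trans (≡.cong (A [ i ]≔_) (≡.sym i∉A)) ([]≔-lookup A i))) ub

        term-bound : ∀ i → ι 4 * v i ≤ ι 25 * (Λ i * v i * Q i)
        term-bound i with lem {P = Unloop M i}
        ... | no loop = ≤-reflexive (begin-equality
              ι 4 * v i                 ≈⟨ trans (*-congˡ v≈0) (zeroʳ _) ⟩
              0#                        ≈⟨ solve 3 (λ a b c → con (+ 0) := a :* (b :* con (+ 0) :* c)) refl (ι 25) (Λ i) (Q i) ⟩
              ι 25 * (Λ i * 0# * Q i)   ≈⟨ *-congˡ (*-congʳ (*-congˡ v≈0)) ⟨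
              ι 25 * (Λ i * v i * Q i)  ∎)
          where v≈0 = loop-worthless i loop
        ... | yes unloop = begin
              ι 4 * v i
                ≤⟨ *-monoʳ-≤ (0≤v i) (free-probability M q 0≤q q≤1 polytope i unloop) ⟩
              ι 7 * mean (randomSubset y 0≤y) (λ A → 𝟙 (lookup A i ≡ outside × Unblocked M i A)) * v i
                ≤⟨ *-monoʳ-≤ (0≤v i) (*-monoˡ-≤ (0≤ι 7) (free≤room i)) ⟩
              ι 7 * ((1# - prob (y i)) * Q i) * v i
                ≈⟨ *-congʳ (*-congʳ 25α≈7) ⟨
              ι 25 * α * ((1# - prob (y i)) * Q i) * v i
                ≈⟨ solve 5 (λ t a p q v → t :* a :* (p :* q) :* v := t :* (a :* p :* v :* q)) refl
                     (ι 25) α (1# - prob (y i)) (Q i) (v i) ⟩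
              ι 25 * (Λ i * v i * Q i) ∎

        w : Fin n → ℝ
        w i = Λ i * v i * Q i

        sum-bound : ι 4 * sum v ≤ ι 25 * sum w
        sum-bound = begin
          ι 4 * sum v                   ≈⟨ *-distribˡ-sum (ι 4) v ⟩
          sum {n} (λ i → ι 4 * v i)     ≤⟨ sum-mono {n} term-bound ⟩
          sum {n} (λ i → ι 25 * w i)    ≈⟨ *-distribˡ-sum (ι 25) w ⟨
          ι 25 * sum w                  ∎

        average-bound : ι 4 * 𝔼.mean optimum-value ≤ ι 25 * 𝔼²[ thresholdValue ]
        average-bound = ≤-respˡ (*-congˡ sum-v) (≤-respʳ (*-congˡ (sym mean-thresholdValue)) sum-bound)

        best-thresholds : ∃ λ κ → 𝔼²[ thresholdValue ] ≤ 𝔼.mean (thresholdValue κ)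
        best-thresholds = Mean.attained (product ν) (λ κ → 𝔼.mean (thresholdValue κ))

      good-thresholds : ∃ λ κ → ι 4 * mean (product π) optimum-value ≤ ι 25 * mean (product π) (thresholdValue κ)
      good-thresholds = proj₁ best-thresholds ,
        ≤-trans average-bound (*-monoˡ-≤ (0≤ι 25) (proj₂ best-thresholds))

-- Lower sums and partitions of the probability space into cells

module Integration (lem : ∀ {ℓ} → ExcludedMiddle ℓ) (R : CompleteOrderedField) where
  open Prophet lem R hiding (zero)
  open OrderedField R
  open Expectation lem R
  open Mean using (mean)
  open ≤-Reasoning

  module _ (N : ℕ) where

    sumVec : ∀ n → (Vec ℕ n → ℝ) → ℝ
    sumVec zero    f = f []
    sumVec (suc n) f = sum {suc N} (λ a → sumVec n (λ ℓ → f (toℕ a ∷ ℓ)))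

    sumVec-cong : ∀ n {f g} → (∀ ℓ → f ℓ ≈ g ℓ) → sumVec n f ≈ sumVec n g
    sumVec-cong zero    h = h []
    sumVec-cong (suc n) h = sum-cong {suc N} (λ a → sumVec-cong n (λ ℓ → h (toℕ a ∷ ℓ)))

    sumVec-mono : ∀ n {f g} → (∀ ℓ → f ℓ ≤ g ℓ) → sumVec n f ≤ sumVec n g
    sumVec-mono zero    h = h []
    sumVec-mono (suc n) h = sum-mono {suc N} (λ a → sumVec-mono n (λ ℓ → h (toℕ a ∷ ℓ)))

    sumVec-* : ∀ n c f → sumVec n (λ ℓ → c * f ℓ) ≈ c * sumVec n f
    sumVec-* zero    c f = refl
    sumVec-* (suc n) c f = trans (sum-cong {suc N} (λ a → sumVec-* n c (λ ℓ → f (toℕ a ∷ ℓ))))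
      (sym (*-distribˡ-sum {suc N} c (λ a → sumVec n (λ ℓ → f (toℕ a ∷ ℓ)))))

    product-mean : ∀ n (μ : Fin n → Mean ℕ) (w : Fin n → ℕ → ℝ) →
      (∀ i f → mean (μ i) f ≈ sum {suc N} (λ a → w i (toℕ a) * f (toℕ a))) →
      ∀ G → mean (product μ) G ≈ sumVec n (λ ℓ → prod (λ i → w i (lookup ℓ i)) * G ℓ)
    product-mean zero    μ w h G = sym (*-identityˡ _)
    product-mean (suc n) μ w h G = begin-equality
      mean (μ zero) (λ a → mean (product (μ ∘ suc)) (λ ℓ → G (a ∷ ℓ)))
        ≈⟨ h zero (λ a → mean (product (μ ∘ suc)) (λ ℓ → G (a ∷ ℓ))) ⟩
      sum {suc N} (λ a → w zero (toℕ a) * mean (product (μ ∘ suc)) (λ ℓ → G (toℕ a ∷ ℓ)))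
        ≈⟨ sum-cong {suc N} (λ a → *-congˡ {w zero (toℕ a)} (product-mean n (μ ∘ suc) (w ∘ suc) (h ∘ suc) (λ ℓ → G (toℕ a ∷ ℓ)))) ⟩
      sum {suc N} (λ a → w zero (toℕ a) * sumVec n (λ ℓ → weight ℓ * G (toℕ a ∷ ℓ)))
        ≈⟨ sum-cong {suc N} (λ a → sumVec-* n (w zero (toℕ a)) (λ ℓ → weight ℓ * G (toℕ a ∷ ℓ))) ⟨
      sum {suc N} (λ a → sumVec n (λ ℓ → w zero (toℕ a) * (weight ℓ * G (toℕ a ∷ ℓ))))
        ≈⟨ sum-cong {suc N} (λ a → sumVec-cong n (λ ℓ → *-assoc (w zero (toℕ a)) (weight ℓ) (G (toℕ a ∷ ℓ)))) ⟨
      sumVec (suc n) (λ ℓ → prod (λ i → w i (lookup ℓ i)) * G ℓ) ∎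
      where
      weight : Vec ℕ n → ℝ
      weight ℓ = prod (λ i → w (suc i) (lookup ℓ i))

  module _ (S : ProbabilitySpace) where
    open ProbabilitySpace S

    private
      ∅ : Pred Ω 0ℓ
      ∅ _ = ⊥

      pair : Pred Ω 0ℓ → Pred Ω 0ℓ → ℕ → Pred Ω 0ℓ
      pair A B zero          = A
      pair A B (suc zero)    = B
      pair A B (suc (suc _)) = ∅

    Event-∅ : Event ∅
    Event-∅ = Event-resp ((λ ¬u → ¬u tt) , λ ()) (Event-∁ Event-U)

    private
      Event-pair : ∀ {A B} → Event A → Event B → ∀ k → Event (pair A B k)
      Event-pair a b zero          = a
      Event-pair a b (suc zero)    = b
      Event-pair a b (suc (suc _)) = Event-∅

    Event-∩ : ∀ {A B} → Event A → Event B → Event (A ∩ B)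
    Event-∩ {A} {B} a b = Event-resp (to , from) (Event-∁ (Event-⋃ (Event-pair (Event-∁ a) (Event-∁ b))))
      where
      to : ∀ {ω} → ω ∈ ∁ (⋃ ℕ (pair (∁ A) (∁ B))) → ω ∈ A ∩ B
      to h = decidable-stable lem (λ ¬a → h (0 , ¬a)) , decidable-stable lem (λ ¬b → h (1 , ¬b))
      from : ∀ {ω} → ω ∈ A ∩ B → ω ∈ ∁ (⋃ ℕ (pair (∁ A) (∁ B)))
      from (a , b) (zero , ¬a)     = ¬a a
      from (a , b) (suc zero , ¬b) = ¬b b

    -- For the constant sequence `∅`, countable additivity bounds the partial sum `𝐏 ∅ + 𝐏 ∅` by
    -- `𝐏 ∅`.
    𝐏-∅ : 𝐏 ∅ ≈ 0#
    𝐏-∅ = ≤-antisym (+-cancelʳ-≤ (𝐏 ∅) (≤-respʳ (sym (+-identityˡ _)) twice)) (𝐏-nonneg Event-∅)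
      where
      lub = 𝐏-⋃ {λ _ → ∅} (λ _ → Event-∅) λ _ ()
      twice : 𝐏 ∅ + 𝐏 ∅ ≤ 𝐏 ∅
      twice = ≤-respˡ (+-congˡ (+-identityʳ _))
        (≤-respʳ (𝐏-resp ((λ ()) , λ ()) (Event-⋃ (λ _ → Event-∅))) (IsLUB.upper lub _ (2 , refl)))

    𝐏-split : ∀ {A} B → Event A → Event B → 𝐏 A ≈ 𝐏 (A ∩ B) + 𝐏 (A ∩ ∁ B)
    𝐏-split {A} B a b = trans (𝐏-resp (to , from) a) (≤-antisym (IsLUB.least lub _ partial) two)
      where
      A₀ = A ∩ B
      A₁ = A ∩ ∁ B
      events = Event-pair (Event-∩ a b) (Event-∩ a (Event-∁ b))
      to : ∀ {ω} → ω ∈ A → ω ∈ ⋃ ℕ (pair A₀ A₁)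
      to {ω} ω∈A with lem {P = ω ∈ B}
      ... | yes ω∈B = 0 , ω∈A , ω∈B
      ... | no ω∉B  = 1 , ω∈A , ω∉B
      from : ∀ {ω} → ω ∈ ⋃ ℕ (pair A₀ A₁) → ω ∈ A
      from (zero , ω∈A , _)     = ω∈A
      from (suc zero , ω∈A , _) = ω∈A
      disjoint : ∀ j k → j ≢ k → ∀ {ω} → ¬ (ω ∈ pair A₀ A₁ j × ω ∈ pair A₀ A₁ k)
      disjoint zero zero j≢k _ = j≢k ≡.refl
      disjoint zero (suc zero) _ ((_ , ω∈B) , (_ , ω∉B)) = ω∉B ω∈B
      disjoint (suc zero) zero _ ((_ , ω∉B) , (_ , ω∈B)) = ω∉B ω∈B
      disjoint (suc zero) (suc zero) j≢k _ = j≢k ≡.refl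
      disjoint (suc (suc _)) _ _ (() , _)
      disjoint zero (suc (suc _)) _ (_ , ())
      disjoint (suc zero) (suc (suc _)) _ (_ , ())
      lub = 𝐏-⋃ {pair A₀ A₁} events (λ {j} {k} j≢k {ω} → disjoint j k j≢k {ω})
      two : 𝐏 A₀ + 𝐏 A₁ ≤ 𝐏 (⋃ ℕ (pair A₀ A₁))
      two = ≤-respˡ (+-congˡ (+-identityʳ _)) (IsLUB.upper lub _ (2 , refl))
      bound : ∀ N → sum {N} (λ k → 𝐏 (pair A₀ A₁ (toℕ k))) ≤ 𝐏 A₀ + 𝐏 A₁
      bound zero = +-nonneg (𝐏-nonneg (events 0)) (𝐏-nonneg (events 1))
      bound (suc zero) = +-monoʳ-≤ _ (𝐏-nonneg (events 1))
      bound (suc (suc N)) = +-monoʳ-≤ _ (≤-reflexive (trans (+-congˡ (sum-zero {N} (λ _ → 𝐏-∅))) (+-identityʳ _)))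
      partial : ∀ s → (∃ λ N → s ≈ sum {N} (λ k → 𝐏 (pair A₀ A₁ (toℕ k)))) → s ≤ 𝐏 A₀ + 𝐏 A₁
      partial s (N , s≈) = ≤-respˡ (sym s≈) (bound N)

    -- A common interface for `𝐏`, for the point mass at some `ω`, and for the integral of a simple
    -- function over a varying set, so that the decomposition into cells is proved once for all
    -- three.
    record Additive (m : Pred Ω 0ℓ → ℝ) : Set (lsuc 0ℓ) where
      field
        m-resp  : ∀ {A B} → A ≐ B → Event A → m A ≈ m B
        m-split : ∀ {A} B → Event A → Event B → m A ≈ m (A ∩ B) + m (A ∩ ∁ B)

      empty : ∀ {A} → Event A → (∀ ω → ¬ (ω ∈ A)) → m A ≈ 0#
      empty {A} a ∉A = begin-equality
        m A            ≈⟨ solve 1 (λ x → x := (x :+ x) :- x) refl (m A) ⟩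
        (m A + m A) - m A  ≈⟨ +-congʳ (+-cong (m-resp to a) (m-resp to′ a)) ⟩
        (m (A ∩ A) + m (A ∩ ∁ A)) - m A  ≈⟨ +-congʳ (m-split A a a) ⟨
        m A - m A      ≈⟨ -‿inverseʳ (m A) ⟩
        0#             ∎
        where
        to : A ≐ A ∩ A
        to = (λ x → x , x) , proj₁
        to′ : A ≐ A ∩ ∁ A
        to′ = (λ {ω} x → contradiction x (∉A ω)) , proj₁

    𝐏-additive : Additive 𝐏
    𝐏-additive = record { m-resp = 𝐏-resp ; m-split = 𝐏-split }

    𝟙-additive : ∀ ω → Additive (λ A → 𝟙 (ω ∈ A))
    𝟙-additive ω = record
      { m-resp  = λ (to , from) _ → 𝟙-cong to from
      ; m-split = λ {A} B _ _ → split A B }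
      where
      split : ∀ A B → 𝟙 (ω ∈ A) ≈ 𝟙 (ω ∈ A ∩ B) + 𝟙 (ω ∈ A ∩ ∁ B)
      split A B with lem {P = ω ∈ B}
      ... | yes b = trans (𝟙-cong (_, b) proj₁) (sym (trans (+-congˡ (𝟙-no (λ (_ , ¬b) → ¬b b))) (+-identityʳ _)))
      ... | no ¬b = trans (𝟙-cong (_, ¬b) proj₁) (sym (trans (+-congʳ (𝟙-no (λ (_ , b) → ¬b b))) (+-identityˡ _)))

    sum-additive : ∀ {k} (a : Fin k → ℝ) (A : Fin k → Pred Ω 0ℓ) → (∀ j → Event (A j)) →
                   Additive (λ C → sum (λ j → a j * 𝐏 (A j ∩ C)))
    sum-additive {k} a A ev = record
      { m-resp  = λ (to , from) c → sum-cong {k} (λ j → *-congˡ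
          (𝐏-resp ((λ (x , y) → x , to y) , (λ (x , y) → x , from y)) (Event-∩ (ev j) c)))
      ; m-split = λ {C} B c b → trans
          (sum-cong {k} (λ j → trans (*-congˡ (trans (𝐏-split B (Event-∩ (ev j) c) b)
             (+-cong (𝐏-resp (reassoc {A j} {C} {B}) (Event-∩ (Event-∩ (ev j) c) b))
                     (𝐏-resp (reassoc {A j} {C} {∁ B}) (Event-∩ (Event-∩ (ev j) c) (Event-∁ b))))))
             (distribˡ (a j) _ _)))
          (∑-distrib-+ (λ j → a j * 𝐏 (A j ∩ (C ∩ B))) (λ j → a j * 𝐏 (A j ∩ (C ∩ ∁ B)))) }
      where
      reassoc : ∀ {A B C : Pred Ω 0ℓ} → (A ∩ B) ∩ C ≐ A ∩ (B ∩ C)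
      reassoc = (λ ((x , y) , z) → x , y , z) , (λ (x , y , z) → (x , y) , z)

    -- By induction on the pieces: `C` is split along the first set, inside which the bound drops
    -- from `c` to `c - a₀`. The bound may become negative, but when no pieces are left that can
    -- happen only on an empty `C`.
    sum≤ : ∀ {k} (a : Fin k → ℝ) (A : Fin k → Pred Ω 0ℓ) → (∀ j → Event (A j)) →
      ∀ {C} c → Event C → (∀ ω → ω ∈ C → sum (λ j → a j * 𝟙 (ω ∈ A j)) ≤ c) →
      sum (λ j → a j * 𝐏 (A j ∩ C)) ≤ c * 𝐏 C
    sum≤ {zero} a A ev {C} c eC h with lem {P = ∃ λ ω → ω ∈ C}
    ... | yes (ω , ω∈C) = *-nonneg (h ω ω∈C) (𝐏-nonneg eC)
    ... | no empty = ≤-reflexive (sym (trans (*-congˡ (Additive.empty 𝐏-additive eC (λ ω ω∈C → empty (ω , ω∈C)))) (zeroʳ c)))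
    sum≤ {suc k} a A ev {C} c eC h = begin
      a₀ * 𝐏 (A₀ ∩ C) + rest C
        ≈⟨ +-cong (*-congˡ (𝐏-resp ((λ (x , y) → y , x) , (λ (x , y) → y , x)) (Event-∩ (ev zero) eC)))
                  (Additive.m-split (sum-additive (a ∘ suc) (A ∘ suc) (ev ∘ suc)) A₀ eC (ev zero)) ⟩
      a₀ * 𝐏 (C ∩ A₀) + (rest (C ∩ A₀) + rest (C ∩ ∁ A₀))
        ≤⟨ +-monoʳ-≤ _ (+-mono-≤
             (sum≤ (a ∘ suc) (A ∘ suc) (ev ∘ suc) (c - a₀) (Event-∩ eC (ev zero)) inA₀)
             (sum≤ (a ∘ suc) (A ∘ suc) (ev ∘ suc) c (Event-∩ eC (Event-∁ (ev zero))) outA₀)) ⟩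
      a₀ * 𝐏 (C ∩ A₀) + ((c - a₀) * 𝐏 (C ∩ A₀) + c * 𝐏 (C ∩ ∁ A₀))
        ≈⟨ solve 4 (λ a c p q → a :* p :+ ((c :- a) :* p :+ c :* q) := c :* (p :+ q)) refl
             a₀ c (𝐏 (C ∩ A₀)) (𝐏 (C ∩ ∁ A₀)) ⟩
      c * (𝐏 (C ∩ A₀) + 𝐏 (C ∩ ∁ A₀))
        ≈⟨ *-congˡ (𝐏-split A₀ eC (ev zero)) ⟨
      c * 𝐏 C ∎
      where
      a₀ = a zero
      A₀ = A zero
      rest : Pred Ω 0ℓ → ℝ
      rest C = sum (λ j → a (suc j) * 𝐏 (A (suc j) ∩ C))
      inA₀ : ∀ ω → ω ∈ C ∩ A₀ → sum (λ j → a (suc j) * 𝟙 (ω ∈ A (suc j))) ≤ c - a₀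
      inA₀ ω (ω∈C , ω∈A₀) = x+z≤y⇒x≤y-z a₀ (≤-respˡ
        (trans (+-congʳ (trans (*-congˡ (𝟙-yes ω∈A₀)) (*-identityʳ a₀))) (+-comm a₀ _)) (h ω ω∈C))
      outA₀ : ∀ ω → ω ∈ C ∩ ∁ A₀ → sum (λ j → a (suc j) * 𝟙 (ω ∈ A (suc j))) ≤ c
      outA₀ ω (ω∈C , ω∉A₀) = ≤-respˡ
        (trans (+-congʳ (trans (*-congˡ (𝟙-no ω∉A₀)) (zeroʳ a₀))) (+-identityˡ _)) (h ω ω∈C)

    -- A simple function with an exact representation. Its atoms form a list, so that sums are
    -- concatenations; the indexed form of `IsLowerSum` is produced only at the end.
    record Simple (f : Ω → ℝ) (s : ℝ) : Set (lsuc 0ℓ) where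
      field
        atoms    : List (ℝ × Pred Ω 0ℓ)
        good     : All (λ (a , A) → (0# ≤ a) × Event A) atoms
        pointwise : ∀ ω → List.foldr (λ (a , A) r → a * 𝟙 (ω ∈ A) + r) 0# atoms ≈ f ω
        integral : List.foldr (λ (a , A) r → a * 𝐏 A + r) 0# atoms ≈ s

    simple-0 : Simple (λ _ → 0#) 0#
    simple-0 = record { atoms = [] ; good = [] ; pointwise = λ _ → refl ; integral = refl }

    simple-atom : ∀ {a A} → 0# ≤ a → Event A → Simple (λ ω → a * 𝟙 (ω ∈ A)) (a * 𝐏 A)
    simple-atom {a} {A} 0≤a eA = record
      { atoms = (a , A) ∷ [] ; good = (0≤a , eA) ∷ [] ; pointwise = λ _ → +-identityʳ _ ; integral = +-identityʳ _ }

    private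
      foldr-++ : (h : ℝ × Pred Ω 0ℓ → ℝ) → ∀ xs ys →
        List.foldr (λ x r → h x + r) 0# (xs ++ ys) ≈ List.foldr (λ x r → h x + r) 0# xs + List.foldr (λ x r → h x + r) 0# ys
      foldr-++ h []       ys = sym (+-identityˡ _)
      foldr-++ h (x ∷ xs) ys = trans (+-congˡ (foldr-++ h xs ys)) (sym (+-assoc _ _ _))

      foldr-sum : (h : ℝ × Pred Ω 0ℓ → ℝ) → ∀ xs →
        sum (λ j → h (List.lookup xs j)) ≈ List.foldr (λ x r → h x + r) 0# xs
      foldr-sum h []       = refl
      foldr-sum h (x ∷ xs) = +-congˡ (foldr-sum h xs)

    simple-+ : ∀ {f g s t} → Simple f s → Simple g t → Simple (λ ω → f ω + g ω) (s + t)
    simple-+ F G = record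
      { atoms     = F.atoms ++ G.atoms
      ; good      = All.++⁺ F.good G.good
      ; pointwise = λ ω → trans (foldr-++ (λ (a , A) → a * 𝟙 (ω ∈ A)) F.atoms G.atoms) (+-cong (F.pointwise ω) (G.pointwise ω))
      ; integral  = trans (foldr-++ (λ (a , A) → a * 𝐏 A) F.atoms G.atoms) (+-cong F.integral G.integral) }
      where
      module F = Simple F
      module G = Simple G

    simple-sum : ∀ {k} {f : Fin k → Ω → ℝ} {s : Fin k → ℝ} → (∀ i → Simple (f i) (s i)) →
                 Simple (λ ω → sum (λ i → f i ω)) (sum s)
    simple-sum {zero}  F = simple-0
    simple-sum {suc k} F = simple-+ (F zero) (simple-sum (F ∘ suc))

    simple-sumVec : ∀ N n {f : Vec ℕ n → Ω → ℝ} {s : Vec ℕ n → ℝ} → (∀ ℓ → Simple (f ℓ) (s ℓ)) →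
                    Simple (λ ω → sumVec N n (λ ℓ → f ℓ ω)) (sumVec N n s)
    simple-sumVec N zero    F = F []
    simple-sumVec N (suc n) F = simple-sum {suc N} (λ a → simple-sumVec N n (λ ℓ → F (toℕ a ∷ ℓ)))

    simple⇒lowerSum : ∀ {f g s} → Simple g s → (∀ ω → g ω ≤ f ω) → IsLowerSum f s
    simple⇒lowerSum G g≤f = record
      { size     = length atoms
      ; a        = λ j → proj₁ (List.lookup atoms j)
      ; A        = λ j → proj₂ (List.lookup atoms j)
      ; a-nonneg = λ j → proj₁ (All.lookup good (∈-lookup j))
      ; A-event  = λ j → proj₂ (All.lookup good (∈-lookup j))
      ; below    = λ ω → ≤-respˡ (sym (trans (foldr-sum (λ (a , A) → a * 𝟙 (ω ∈ A)) atoms) (pointwise ω))) (g≤f ω)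
      ; integral = sym (trans (foldr-sum (λ (a , A) → a * 𝐏 A) atoms) integral) }
      where
      open Simple G

    module _ (N : ℕ) where

      interval-partition : ∀ {m} → Additive m → ∀ k s {C} → Event C → (g : Ω → ℕ) → (∀ a → Event (λ ω → g ω ≡ a)) →
        (∀ ω → ω ∈ C → (s ℕ.≤ g ω) × (g ω ℕ.< s ℕ.+ k)) →
        m C ≈ sum {k} (λ a → m (C ∩ (λ ω → g ω ≡ s ℕ.+ toℕ a)))
      interval-partition add zero s eC g ev h = Additive.empty add eC
        (λ ω ω∈C → ℕ.<⇒≱ (≡.subst (g ω ℕ.<_) (ℕ.+-identityʳ s) (proj₂ (h ω ω∈C))) (proj₁ (h ω ω∈C)))
      interval-partition {m} add (suc k) s {C} eC g ev h = begin-equality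
        m C
          ≈⟨ m-split Z eC (ev s) ⟩
        m (C ∩ Z) + m (C ∩ ∁ Z)
          ≈⟨ +-congˡ (interval-partition add k (suc s) (Event-∩ eC (Event-∁ (ev s))) g ev above) ⟩
        m (C ∩ Z) + sum {k} (λ a → m ((C ∩ ∁ Z) ∩ (λ ω → g ω ≡ suc s ℕ.+ toℕ a)))
          ≈⟨ +-cong (m-resp ((λ (x , y) → x , ≡.trans y (≡.sym (ℕ.+-identityʳ s))) , (λ (x , y) → x , ≡.trans y (ℕ.+-identityʳ s))) (Event-∩ eC (ev s)))
               (sum-cong {k} (λ a → m-resp (forget a , recall a) (Event-∩ (Event-∩ eC (Event-∁ (ev s))) (ev _)))) ⟩
        sum {suc k} (λ a → m (C ∩ (λ ω → g ω ≡ s ℕ.+ toℕ a))) ∎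
        where
        open Additive add
        Z : Pred Ω 0ℓ
        Z ω = g ω ≡ s
        above : ∀ ω → ω ∈ C ∩ ∁ Z → (suc s ℕ.≤ g ω) × (g ω ℕ.< suc s ℕ.+ k)
        above ω (ω∈C , g≢s) = ℕ.≤∧≢⇒< (proj₁ (h ω ω∈C)) (g≢s ∘ ≡.sym) , ≡.subst (g ω ℕ.<_) (ℕ.+-suc s k) (proj₂ (h ω ω∈C))
        forget : ∀ a {ω} → ω ∈ (C ∩ ∁ Z) ∩ (λ ω → g ω ≡ suc s ℕ.+ toℕ a) → ω ∈ C ∩ (λ ω → g ω ≡ s ℕ.+ suc (toℕ a))
        forget a ((x , _) , y) = x , ≡.trans y (≡.sym (ℕ.+-suc s (toℕ a)))
        recall : ∀ a {ω} → ω ∈ C ∩ (λ ω → g ω ≡ s ℕ.+ suc (toℕ a)) → ω ∈ (C ∩ ∁ Z) ∩ (λ ω → g ω ≡ suc s ℕ.+ toℕ a)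
        recall a (x , y) = (x , λ z → ℕ.m≢1+m+n s (≡.trans (≡.sym z) (≡.trans y (ℕ.+-suc s (toℕ a))))) , ≡.trans y (ℕ.+-suc s (toℕ a))

      cell : ∀ {n} → (Fin n → Ω → ℕ) → Vec ℕ n → Pred Ω 0ℓ
      cell g ℓ ω = ∀ i → g i ω ≡ lookup ℓ i

      module _ {n} (g : Fin n → Ω → ℕ) (g≤N : ∀ i ω → g i ω ℕ.≤ N) (ev : ∀ i a → Event (λ ω → g i ω ≡ a)) where

        level-partition : ∀ {m} → Additive m → ∀ {C} → Event C → ∀ i →
          m C ≈ sum {suc N} (λ a → m (C ∩ (λ ω → g i ω ≡ toℕ a)))
        level-partition add eC i = interval-partition add (suc N) 0 eC (g i) (ev i)
          (λ ω _ → ℕ.z≤n , ℕ.s≤s (g≤N i ω))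

      cell-event : ∀ {n} (g : Fin n → Ω → ℕ) → (∀ i a → Event (λ ω → g i ω ≡ a)) → ∀ ℓ → Event (cell g ℓ)
      cell-event g ev []      = Event-resp ((λ _ ()) , λ _ → tt) Event-U
      cell-event g ev (a ∷ ℓ) = Event-resp
        ((λ (x , y) → λ { zero → x ; (suc i) → y i }) , (λ h → h zero , h ∘ suc))
        (Event-∩ (ev zero a) (cell-event (g ∘ suc) (ev ∘ suc) ℓ))

      cell-partition : ∀ {n m} → Additive m → ∀ (g : Fin n → Ω → ℕ) → (∀ i ω → g i ω ℕ.≤ N) →
        (∀ i a → Event (λ ω → g i ω ≡ a)) → ∀ {C} → Event C →
        m C ≈ sumVec N n (λ ℓ → m (C ∩ cell g ℓ))
      cell-partition {zero} add g g≤N ev eC = Additive.m-resp add ((λ x → x , λ ()) , proj₁) eC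
      cell-partition {suc n} {m} add g g≤N ev {C} eC = begin-equality
        m C
          ≈⟨ level-partition g g≤N ev add eC zero ⟩
        sum {suc N} (λ a → m (C ∩ (λ ω → g zero ω ≡ toℕ a)))
          ≈⟨ sum-cong {suc N} (λ a → cell-partition add (g ∘ suc) (g≤N ∘ suc) (ev ∘ suc) (Event-∩ eC (ev zero (toℕ a)))) ⟩
        sum {suc N} (λ a → sumVec N n (λ ℓ → m ((C ∩ (λ ω → g zero ω ≡ toℕ a)) ∩ cell (g ∘ suc) ℓ)))
          ≈⟨ sum-cong {suc N} (λ a → sumVec-cong N n (λ ℓ → Additive.m-resp add (extend a ℓ , restrict a ℓ)
               (Event-∩ (Event-∩ eC (ev zero (toℕ a))) (cell-event (g ∘ suc) (ev ∘ suc) ℓ)))) ⟩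
        sumVec N (suc n) (λ ℓ → m (C ∩ cell g ℓ)) ∎
        where
        extend : ∀ (a : Fin (suc N)) ℓ {ω} → ω ∈ (C ∩ (λ ω → g zero ω ≡ toℕ a)) ∩ cell (g ∘ suc) ℓ → ω ∈ C ∩ cell g (toℕ a ∷ ℓ)
        extend a ℓ ((x , y) , z) = x , λ { zero → y ; (suc i) → z i }
        restrict : ∀ (a : Fin (suc N)) ℓ {ω} → ω ∈ C ∩ cell g (toℕ a ∷ ℓ) → ω ∈ (C ∩ (λ ω → g zero ω ≡ toℕ a)) ∩ cell (g ∘ suc) ℓ
        restrict a ℓ (x , y) = (x , y zero) , y ∘ suc

      module _ {n} (g : Fin n → Ω → ℕ) (g≤N : ∀ i ω → g i ω ℕ.≤ N) (ev : ∀ i a → Event (λ ω → g i ω ≡ a))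
               (independent : ∀ ℓ → 𝐏 (cell g ℓ) ≈ prod (λ i → 𝐏 (λ ω → g i ω ≡ lookup ℓ i))) where

        abstract
          levelMean : Fin n → Mean ℕ
          levelMean i = fromWeights {m = suc N} (λ a → 𝐏 (λ ω → g i ω ≡ toℕ a)) (λ a → 𝐏-nonneg (ev i (toℕ a)))
            (trans (sym (trans (level-partition g g≤N ev 𝐏-additive Event-U i)
              (sum-cong {suc N} (λ a → 𝐏-resp (proj₂ , (λ x → tt , x)) (Event-∩ Event-U (ev i (toℕ a))))))) 𝐏-U) toℕ

          levelMean-mean : ∀ i f → mean (levelMean i) f ≈ sum {suc N} (λ a → 𝐏 (λ ω → g i ω ≡ toℕ a) * f (toℕ a))
          levelMean-mean i f = refl

        levelMean-bounded : ∀ i {f h} → (∀ a → a ℕ.≤ N → f a ≈ h a) → mean (levelMean i) f ≈ mean (levelMean i) h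
        levelMean-bounded i {f} {h} f≈h = trans (levelMean-mean i f) (trans
          (sum-cong {suc N} (λ a → *-congˡ {𝐏 (λ ω → g i ω ≡ toℕ a)} (f≈h (toℕ a) (Fin.toℕ≤pred[n] a)))) (sym (levelMean-mean i h)))

        mean-cells : ∀ G → mean (product levelMean) G ≈ sumVec N n (λ ℓ → 𝐏 (cell g ℓ) * G ℓ)
        mean-cells G = trans (product-mean N n levelMean (λ i a → 𝐏 (λ ω → g i ω ≡ a)) levelMean-mean G)
          (sumVec-cong N n (λ ℓ → *-congʳ (sym (independent ℓ))))

        -- The hypothesis bounds the simple function and not `f`: levels stop at `N`, so on a cell
        -- with a top level `f` can be unbounded.
        lowerSum≤mean : ∀ {f s} (L : IsLowerSum f s) (G : Vec ℕ n → ℝ) →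
          (∀ ω ℓ → ω ∈ cell g ℓ → sum (λ j → IsLowerSum.a L j * 𝟙 (ω ∈ IsLowerSum.A L j)) ≤ G ℓ) →
          s ≤ mean (product levelMean) G
        lowerSum≤mean {s = s} L G h = begin
          s
            ≈⟨ integral ⟩
          sum {size} (λ j → a j * 𝐏 (A j))
            ≈⟨ sum-cong {size} (λ j → *-congˡ (𝐏-resp ((λ x → x , tt) , proj₁) (A-event j))) ⟩
          sum {size} (λ j → a j * 𝐏 (A j ∩ U))
            ≈⟨ cell-partition (sum-additive a A A-event) g g≤N ev Event-U ⟩
          sumVec N n (λ ℓ → sum {size} (λ j → a j * 𝐏 (A j ∩ (U ∩ cell g ℓ))))
            ≈⟨ sumVec-cong N n (λ ℓ → sum-cong {size} (λ j → *-congˡ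
                 (𝐏-resp ((λ (x , _ , y) → x , y) , (λ (x , y) → x , tt , y))
                   (Event-∩ (A-event j) (Event-∩ Event-U (cell-event g ev ℓ)))))) ⟩
          sumVec N n (λ ℓ → sum {size} (λ j → a j * 𝐏 (A j ∩ cell g ℓ)))
            ≤⟨ sumVec-mono N n (λ ℓ → sum≤ a A A-event (G ℓ) (cell-event g ev ℓ) (λ ω → h ω ℓ)) ⟩
          sumVec N n (λ ℓ → G ℓ * 𝐏 (cell g ℓ))
            ≈⟨ sumVec-cong N n (λ ℓ → *-comm _ _) ⟩
          sumVec N n (λ ℓ → 𝐏 (cell g ℓ) * G ℓ)
            ≈⟨ mean-cells G ⟨
          mean (product levelMean) G ∎
          where open IsLowerSum L

        mean-lowerSum : ∀ {f} (G : Vec ℕ n → ℝ) → (∀ ℓ → 0# ≤ G ℓ) → (∀ ω ℓ → ω ∈ cell g ℓ → G ℓ ≤ f ω) →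
          IsLowerSum f (mean (product levelMean) G)
        mean-lowerSum {f} G 0≤G h = record
          { IsLowerSum simple-lower
          ; integral = trans (trans (mean-cells G) (sumVec-cong N n (λ ℓ → *-comm _ _))) (IsLowerSum.integral simple-lower) }
          where
          G≤f : ∀ ω → sumVec N n (λ ℓ → G ℓ * 𝟙 (ω ∈ cell g ℓ)) ≤ f ω
          G≤f ω = begin
            sumVec N n (λ ℓ → G ℓ * 𝟙 (ω ∈ cell g ℓ))
              ≤⟨ sumVec-mono N n on-cell ⟩
            sumVec N n (λ ℓ → f ω * 𝟙 (ω ∈ U ∩ cell g ℓ))
              ≈⟨ sumVec-* N n (f ω) (λ ℓ → 𝟙 (ω ∈ U ∩ cell g ℓ)) ⟩
            f ω * sumVec N n (λ ℓ → 𝟙 (ω ∈ U ∩ cell g ℓ))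
              -- The decomposition for the point mass at `ω`: the indicators of the cells sum to 1.
              ≈⟨ *-congˡ (cell-partition (𝟙-additive ω) g g≤N ev Event-U) ⟨
            f ω * 𝟙 (ω ∈ U)
              ≈⟨ trans (*-congˡ (𝟙-yes tt)) (*-identityʳ _) ⟩
            f ω ∎
            where
            on-cell : ∀ ℓ → G ℓ * 𝟙 (ω ∈ cell g ℓ) ≤ f ω * 𝟙 (ω ∈ U ∩ cell g ℓ)
            on-cell ℓ with lem {P = ω ∈ cell g ℓ}
            ... | yes ω∈ = ≤-respʳ (*-congˡ (sym (𝟙-yes (tt , ω∈)))) (*-monoʳ-≤ 0≤1 (h ω ℓ ω∈))
            ... | no ω∉ = ≤-reflexive (trans (zeroʳ _) (sym (trans (*-congˡ (𝟙-no (ω∉ ∘ proj₂))) (zeroʳ _))))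
          simple-lower : IsLowerSum f (sumVec N n (λ ℓ → G ℓ * 𝐏 (cell g ℓ)))
          simple-lower = simple⇒lowerSum (simple-sumVec N n (λ ℓ → simple-atom (0≤G ℓ) (cell-event g ev ℓ))) G≤f

-- Rounding to the grid, and suprema

True⇒≡true : ∀ {b} → True b → b ≡ true
True⇒≡true {true} _ = ≡.refl

¬True⇒≡false : ∀ {b} → ¬ True b → b ≡ false
¬True⇒≡false {true}  n = contradiction tt n
¬True⇒≡false {false} _ = ≡.refl

module Levels (lem : ∀ {ℓ} → ExcludedMiddle ℓ) (R : CompleteOrderedField) where
  open Prophet lem R hiding (zero)
  open OrderedField R
  open ≤-Reasoning

  Borel-∪ : ∀ {A B} → Borel A → Borel B → Borel (λ x → A x ⊎ B x)
  Borel-∪ {A} {B} a b = resp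
    ((λ { (zero , x) → inj₁ x ; (suc _ , x) → inj₂ x }) , λ { (inj₁ x) → 0 , x ; (inj₂ x) → 1 , x })
    (union {A = λ { zero → A ; (suc _) → B }} λ { zero → a ; (suc _) → b })

  Borel-∩ : ∀ {A B} → Borel A → Borel B → Borel (λ x → A x × B x)
  Borel-∩ a b = resp
    ((λ h → decidable-stable lem (λ ¬a → h (inj₁ ¬a)) , decidable-stable lem (λ ¬b → h (inj₂ ¬b))) ,
     (λ (x , y) → λ { (inj₁ ¬a) → ¬a x ; (inj₂ ¬b) → ¬b y }))
    (compl (Borel-∪ (compl a) (compl b)))

  Borel-const : (P : Set) → Borel (λ _ → P)
  Borel-const P with lem {P = P}
  ... | yes p = resp ((λ _ → p) , λ _ → total′) (Borel-∪ (ray 0#) (compl (ray 0#)))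
    where
    total′ : ∀ {x} → (x ≤ 0#) ⊎ ¬ (x ≤ 0#)
    total′ {x} with lem {P = x ≤ 0#}
    ... | yes q = inj₁ q
    ... | no ¬q = inj₂ ¬q
  ... | no ¬p = resp ((λ (x , ¬x) → contradiction x ¬x) , λ p → contradiction p ¬p) (Borel-∩ (ray 0#) (compl (ray 0#)))

  -- The largest k ≤ N with δ k < x (and 0 if there is none).
  level : ℝ → ℕ → ℝ → ℕ
  level δ zero    x = 0
  level δ (suc N) x = if ⟦ x ≤ δ * ι (suc N) ⟧ then level δ N x else suc N

  level≤ : ∀ δ N x → level δ N x ℕ.≤ N
  level≤ δ zero    x = ℕ.z≤n
  level≤ δ (suc N) x with lem {P = x ≤ δ * ι (suc N)}
  ... | yes _ = ℕ.m≤n⇒m≤1+n (level≤ δ N x)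
  ... | no _  = ℕ.≤-refl

  -- Each level set is a finite Boolean combination of rays; this makes cells events and lets
  -- `X-independent` apply to them.
  level-Borel : ∀ δ N a → Borel (λ x → level δ N x ≡ a)
  level-Borel δ zero    a = Borel-const (0 ≡ a)
  level-Borel δ (suc N) a = resp (to , from)
    (Borel-∪ (Borel-∩ (ray t) (level-Borel δ N a)) (Borel-∩ (compl (ray t)) (Borel-const (suc N ≡ a))))
    where
    t = δ * ι (suc N)
    to : ∀ {x} → ((x ≤ t) × level δ N x ≡ a) ⊎ (¬ (x ≤ t) × suc N ≡ a) → level δ (suc N) x ≡ a
    to {x} h with lem {P = x ≤ t}
    to (inj₁ (_ , e)) | yes _ = e
    to (inj₂ (n , _)) | yes p = contradiction p n
    to (inj₁ (p , _)) | no n  = contradiction p n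
    to (inj₂ (_ , e)) | no _  = e
    from : ∀ {x} → level δ (suc N) x ≡ a → ((x ≤ t) × level δ N x ≡ a) ⊎ (¬ (x ≤ t) × suc N ≡ a)
    from {x} h with lem {P = x ≤ t}
    ... | yes p = inj₁ (p , h)
    ... | no n  = inj₂ (n , h)

  level-exceeds : ∀ δ N x {m} → level δ N x ≡ suc m → ¬ (x ≤ δ * ι (suc m))
  level-exceeds δ (suc N) x e with lem {P = x ≤ δ * ι (suc N)}
  ... | yes _ = level-exceeds δ N x e
  level-exceeds δ (suc N) x ≡.refl | no n = n

  level-reaches : ∀ δ N x {k} → k ℕ.< N → ¬ (x ≤ δ * ι (suc k)) → suc k ℕ.≤ level δ N x
  level-reaches δ (suc N) x {k} k<N x≰ with lem {P = x ≤ δ * ι (suc N)}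
  ... | no _ = k<N
  ... | yes x≤ = level-reaches δ N x (ℕ.≤∧≢⇒< (ℕ.s≤s⁻¹ k<N) (λ { ≡.refl → x≰ x≤ })) x≰

  module _ {δ} (0≤δ : 0# ≤ δ) where

    level-lower : ∀ N {x} → 0# ≤ x → δ * ι (level δ N x) ≤ x
    level-lower N {x} 0≤x with level δ N x in e
    ... | zero  = ≤-respˡ (sym (trans (*-congˡ ι-0) (zeroʳ δ))) 0≤x
    ... | suc m = <⇒≤ (level-exceeds δ N x e)

    level-upper : ∀ N x → level δ N x ℕ.< N → x ≤ δ * ι (level δ N x) + δ
    level-upper N x l<N with lem {P = x ≤ δ * ι (suc (level δ N x))}
    ... | yes p = ≤-respʳ (trans (*-congˡ (ι-suc (level δ N x)))
            (solve 2 (λ d l → d :* (con (+ 1) :+ l) := d :* l :+ d) refl δ (ι (level δ N x)))) p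
    ... | no n  = contradiction (level-reaches δ N x l<N n) ℕ.1+n≰n

    level-threshold : ∀ N x κ → κ ℕ.< N → ¬ (x ≤ δ * ι (suc κ)) → (κ <ᵇ level δ N x) ≡ true
    level-threshold N x κ κ<N n = True⇒≡true (ℕ.<⇒<ᵇ (level-reaches δ N x κ<N n))

    level-threshold⁻ : ∀ N x κ → x ≤ δ * ι (suc κ) → (κ <ᵇ level δ N x) ≡ false
    level-threshold⁻ N x κ x≤ = ¬True⇒≡false (λ t → exceeds (ℕ.<ᵇ⇒< κ (level δ N x) t))
      where
      exceeds : ¬ (κ ℕ.< level δ N x)
      exceeds κ< with level δ N x in e
      exceeds (ℕ.s≤s κ≤m) | suc m =
        level-exceeds δ N x e (≤-trans x≤ (*-monoˡ-≤ 0≤δ (ι-mono (ℕ.s≤s κ≤m))))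

  -- For `κ < N`, having `κ < level δ N x` means that `x` strictly exceeds `δ * ι (suc κ)`, which is
  -- the test made by `isAbove` when the coin shows tails. No level exceeds a `κ ≥ N`, hence the
  -- infinite threshold.
  levelThreshold : ℝ → ℕ → ℕ → ℝ ⁺
  levelThreshold δ N κ = if κ <ᵇ N then [ δ * ι (suc κ) ] else ⊤⁺

  isAbove-level : ∀ {δ} → 0# ≤ δ → ∀ N κ x → isAbove (levelThreshold δ N κ) false x ≡ (κ <ᵇ level δ N x)
  isAbove-level {δ} 0≤δ N κ x with κ <ᵇ N in e
  ... | false = ≡.sym (¬True⇒≡false λ t → ≡.subst True e (ℕ.<⇒<ᵇ (ℕ.<-≤-trans (ℕ.<ᵇ⇒< κ (level δ N x) t) (level≤ δ N x))))
  ... | true with lem {P = x ≤ δ * ι (suc κ)}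
  ...   | yes x≤ = ≡.trans (∧-zeroʳ _) (≡.sym (level-threshold⁻ 0≤δ N x κ x≤))
  ...   | no x≰  = ≡.sym (level-threshold 0≤δ N x κ (ℕ.<ᵇ⇒< κ N (≡.subst True (≡.sym e) tt)) x≰)

  Archimedean : ∀ {δ} → 0# < δ → ∀ K → ∃ λ N → K ≤ δ * ι N
  Archimedean {δ} 0<δ K with lem {P = ∃ λ N → K ≤ δ * ι N}
  ... | yes p = p
  ... | no ¬p = contradiction (IsLUB.least lub (s - δ) below) (λ s≤s-δ → 0<δ (+-cancelʳ-≤ (s - δ)
        (≤-respˡ (solve 2 (λ d s → s := d :+ (s :- d)) refl δ s) (≤-respʳ (sym (+-identityˡ _)) s≤s-δ))))
    where
    Multiple : Pred ℝ (lsuc 0ℓ)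
    Multiple x = Lift (lsuc 0ℓ) (∃ λ N → x ≈ δ * ι N)
    completed = complete Multiple (δ * ι 0 , lift (0 , refl))
      (K , λ x m → let N , e = lower m in ≤-respˡ (sym e) (<⇒≤ (λ K≤ → ¬p (N , K≤))))
    s = proj₁ completed
    lub = proj₂ completed
    below : ∀ x → x ∈ Multiple → x ≤ s - δ
    below x (lift (N , e)) = x+z≤y⇒x≤y-z δ (≤-respˡ
      (trans (*-congˡ (ι-suc N)) (trans (solve 2 (λ d l → d :* (con (+ 1) :+ l) := d :* l :+ d) refl δ (ι N)) (+-congʳ (sym e))))
      (IsLUB.upper lub _ (lift (suc N , refl))))

  ≤sup : ∀ {A : Pred ℝ (lsuc 0ℓ)} {x} → x ∈ A → [ x ] ≤⁺ sup A
  ≤sup {A} {x} x∈A with lem {P = Satisfiable A} | lem {P = Satisfiable (IsUpperBound _≤_ A)}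
  ... | no empty | _ = contradiction (x , x∈A) empty
  ... | yes _ | no _ = _ ≤⊤⁺
  ... | yes ne | yes bdd = [ IsLUB.upper (proj₂ (complete A ne bdd)) x x∈A ]

  sup-unbounded : ∀ {A : Pred ℝ (lsuc 0ℓ)} → Satisfiable A → ¬ Satisfiable (IsUpperBound _≤_ A) → sup A ≡ ⊤⁺
  sup-unbounded {A} ne unbdd with lem {P = Satisfiable A} | lem {P = Satisfiable (IsUpperBound _≤_ A)}
  ... | no empty | _ = contradiction ne empty
  ... | yes _ | no _ = ≡.refl
  ... | yes _ | yes bdd = contradiction bdd unbdd

  sup-bounded : ∀ {A : Pred ℝ (lsuc 0ℓ)} → Satisfiable A → Satisfiable (IsUpperBound _≤_ A) →
                ∃ λ s → IsLUB _≤_ A s × sup A ≡ [ s ]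
  sup-bounded {A} ne bdd with lem {P = Satisfiable A} | lem {P = Satisfiable (IsUpperBound _≤_ A)}
  ... | no empty | _ = contradiction ne empty
  ... | yes _ | no unbdd = contradiction bdd unbdd
  ... | yes ne | yes bdd = _ , proj₂ (complete A ne bdd) , ≡.refl

-- Algorithms whose coins always show tails

∈-allSubsets : ∀ {n} (A : Subset n) → A ∈ˡ allSubsets n
∈-allSubsets []          = here ≡.refl
∈-allSubsets {suc n} (true ∷ A)  = ∈-++⁺ˡ (∈-map⁺ (inside ∷_) (∈-allSubsets A))
∈-allSubsets {suc n} (false ∷ A) = ∈-++⁺ʳ (List.map (inside ∷_) (allSubsets n)) (∈-map⁺ (outside ∷_) (∈-allSubsets A))

module DeterministicThresholds (lem : ∀ {ℓ} → ExcludedMiddle ℓ) (R : CompleteOrderedField) where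
  open Prophet lem R hiding (zero)
  open OrderedField R
  open BestSet lem R using (value-nonneg)
  open ≤-Reasoning

  untied : ∀ {n} (t : Fin n → ℝ ⁺) → (∀ i → [ 0# ] ≤⁺ t i) → NonAdaptive n
  untied t 0≤t = record
    { threshold = t ; threshold-nonneg = 0≤t ; tie = λ _ → 0# ; 0≤tie = λ _ → ≤-refl ; tie≤1 = λ _ → 0≤1 }

  prod-nonneg : ∀ {n} {f : Fin n → ℝ} → (∀ i → 0# ≤ f i) → 0# ≤ prod f
  prod-nonneg {zero}  h = 0≤1
  prod-nonneg {suc n} h = *-nonneg (h zero) (prod-nonneg (h ∘ suc))

  prod-1 : ∀ {n} {f : Fin n → ℝ} → (∀ i → f i ≈ 1#) → prod f ≈ 1#
  prod-1 {zero}  h = refl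
  prod-1 {suc n} h = trans (*-cong (h zero) (prod-1 (h ∘ suc))) (*-identityˡ 1#)

  term≤foldr : ∀ {X : Set} (h : X → ℝ) → (∀ x → 0# ≤ h x) → ∀ {xs x} → x ∈ˡ xs →
    h x ≤ foldr _+_ 0# (List.map h xs)
  term≤foldr h 0≤h {_ ∷ xs} (here ≡.refl) = x≤x+y (nonneg xs)
    where
    nonneg : ∀ xs → 0# ≤ foldr _+_ 0# (List.map h xs)
    nonneg []       = ≤-refl
    nonneg (x ∷ xs) = +-nonneg (0≤h x) (nonneg xs)
  term≤foldr h 0≤h (there x∈) = ≤-trans (term≤foldr h 0≤h x∈) (x≤y+x (0≤h _))

  module _ {n} (M : LaminarMatroid n) (t : Fin n → ℝ ⁺) (0≤t : ∀ i → [ 0# ] ≤⁺ t i)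
           (x : Fin n → ℝ) (0≤x : ∀ i → 0# ≤ x i) where

    private
      lookup-⊥ : ∀ i → lookup (Sub.⊥ {n}) i ≡ false
      lookup-⊥ i = lookup-replicate i false

    -- With all `tie` probabilities 0, the outcome in which every coin shows tails has probability
    -- 1. Only a lower bound on `alg` is wanted, so the other outcomes enter through nonnegativity
    -- alone.
    value-accepted≤alg : value (accepted M (untied t 0≤t) Sub.⊥ x) x ≤ alg M (untied t 0≤t) x
    value-accepted≤alg = ≤-respˡ (trans (*-congʳ tails) (*-identityˡ _))
      (term≤foldr (λ heads → coinProbability M (untied t 0≤t) heads * value (accepted M (untied t 0≤t) heads x) x)
        (λ heads → *-nonneg (prod-nonneg (λ i → coin-nonneg (lookup heads i))) (value-nonneg (accepted M (untied t 0≤t) heads x) 0≤x))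
        (∈-allSubsets Sub.⊥))
      where
      0≤1-0 : 0# ≤ 1# - 0#
      0≤1-0 = 0≤y-x 0≤1
      coin-nonneg : ∀ b → 0# ≤ (if b then 0# else 1# - 0#)
      coin-nonneg true  = ≤-refl
      coin-nonneg false = 0≤1-0
      tails : coinProbability M (untied t 0≤t) Sub.⊥ ≈ 1#
      tails = prod-1 {n} (λ i → trans (reflexive (≡.cong (λ b → if b then 0# else 1# - 0#) (lookup-⊥ i)))
        (solve 0 (con (+ 1) :- con (+ 0) := con (+ 1)) refl))

    accepts : (active : Subset n) → (∀ j → isAbove (t j) false (x j) ≡ true → j Sub.∈ active) →
      ∀ i → isAbove (t i) false (x i) ≡ true → Unblocked M i (active [ i ]≔ outside) →
      lookup (accepted M (untied t 0≤t) Sub.⊥ x) i ≡ true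
    accepts active above⇒active i above unblocked = []=⇒lookup
      (greedy-accepts M (λ j → isAbove (t j) (lookup Sub.⊥ j) (x j)) _ (λ I j → ≡.refl) active
        (λ j h → above⇒active j (≡.trans (≡.cong (λ b → isAbove (t j) b (x j)) (≡.sym (lookup-⊥ j))) h))
        i (≡.trans (≡.cong (λ b → isAbove (t i) b (x i)) (lookup-⊥ i)) above) unblocked)

-- From the grid to the actual values

⁅i⁆-i≡⊥ : ∀ {n} (i : Fin n) → ⁅ i ⁆ [ i ]≔ outside ≡ Sub.⊥
⁅i⁆-i≡⊥ zero    = ≡.refl
⁅i⁆-i≡⊥ (suc i) = ≡.cong (outside ∷_) (⁅i⁆-i≡⊥ i)

module Competitive (lem : ∀ {ℓ} → ExcludedMiddle ℓ) (R : CompleteOrderedField) where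
  open Prophet lem R hiding (zero)
  open OrderedField R
  open Extrema totalOrder using (max≤v⁺; ⊥≤max)
  open Expectation lem R
  open RandomSubsets lem R using (value-mono)
  open BestSet lem R
  open DiscreteProphet lem R
  open Integration lem R
  open Levels lem R
  open DeterministicThresholds lem R
  open Mean using (mean)
  open ≤-Reasoning

  module _ {n} (M : LaminarMatroid n) {δ} (0≤δ : 0# ≤ δ) (N : ℕ) (x : Fin n → ℝ) (0≤x : ∀ i → 0# ≤ x i)
           (ℓ : Vec ℕ n) (level≡ : ∀ i → level δ N (x i) ≡ lookup ℓ i) where
    open LaminarMatroid M

    private
      δℓ≤x : ∀ i → levelValue M δ 0≤δ ℓ i ≤ x i
      δℓ≤x i = ≤-respˡ (*-congˡ (reflexive (≡.cong ι (level≡ i)))) (level-lower 0≤δ N (0≤x i))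

      v : ℝ
      v = optimum-value M δ 0≤δ ℓ

    independent-value≤ : ∀ {I} → Independent I → value I (levelValue M δ 0≤δ ℓ) ≤ v
    independent-value≤ {I} ind = All.lookup (best-max (filter independent? (allSubsets n)) (levelValue M δ 0≤δ ℓ))
      (∈-filter⁺ independent? (∈-allSubsets I) ind)

    -- Truncation at δ N costs nothing, since a single item of value δ N
    -- already accounts for φ; rounding down costs at most δ per item.
    rounding : ∀ {φ} → φ ≤ opt M x → φ ≤ δ * ι N → φ ≤ v + ι n * δ
    rounding {φ} φ≤opt φ≤δN with lem {P = φ ≤ v + ι n * δ}
    ... | yes p = p
    ... | no φ≰ = ≤-trans φ≤opt (max≤v⁺ (+-nonneg 0≤v 0≤nδ)
            (All.map⁺ (All.tabulate (λ {I} I∈ → rounded I (proj₂ (∈-filter⁻ independent? {xs = allSubsets n} I∈))))))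
      where
      0≤v : 0# ≤ v
      0≤v = value-nonneg (optimum M δ 0≤δ ℓ) (levelValue-nonneg M δ 0≤δ ℓ)
      0≤nδ : 0# ≤ ι n * δ
      0≤nδ = *-nonneg (0≤ι n) 0≤δ
      unsaturated : ∀ I → Independent I → ∀ i → lookup I i ≡ true → lookup ℓ i ≢ N
      unsaturated I ind i i∈I ℓ≡N = φ≰ (begin
        φ                               ≤⟨ φ≤δN ⟩
        δ * ι N                         ≡⟨ ≡.cong (λ a → δ * ι a) ℓ≡N ⟨
        δ * ι (lookup ℓ i)              ≡⟨ ≡.cong (λ b → if b then δ * ι (lookup ℓ i) else 0#) i∈I ⟨
        (if lookup I i then δ * ι (lookup ℓ i) else 0#) ≤⟨ term≤sum {f = λ i → if lookup I i then δ * ι (lookup ℓ i) else 0#} (λ i → nonneg (lookup I i) i) i ⟩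
        value I (levelValue M δ 0≤δ ℓ)  ≤⟨ independent-value≤ {I} ind ⟩
        v                               ≤⟨ x≤x+y 0≤nδ ⟩
        v + ι n * δ                     ∎)
        where
        nonneg : ∀ b i → 0# ≤ (if b then δ * ι (lookup ℓ i) else 0#)
        nonneg true  i = levelValue-nonneg M δ 0≤δ ℓ i
        nonneg false i = ≤-refl
      rounded : ∀ I → Independent I → value I x ≤ v + ι n * δ
      rounded I ind = begin
        value I x
          ≤⟨ sum-mono {n} (λ i → term i (lookup I i) ≡.refl) ⟩
        sum {n} (λ i → (if lookup I i then levelValue M δ 0≤δ ℓ i else 0#) + δ)
          ≈⟨ ∑-distrib-+ (λ i → if lookup I i then levelValue M δ 0≤δ ℓ i else 0#) (λ _ → δ) ⟩
        value I (levelValue M δ 0≤δ ℓ) + sum {n} (λ _ → δ)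
          ≤⟨ +-mono-≤ (independent-value≤ {I} ind) (≤-reflexive (sum-const n δ)) ⟩
        v + ι n * δ ∎
        where
        term : ∀ i b → lookup I i ≡ b → (if b then x i else 0#) ≤ (if b then levelValue M δ 0≤δ ℓ i else 0#) + δ
        term i false _ = ≤-respʳ (sym (+-identityˡ δ)) 0≤δ
        term i true i∈I = ≤-respʳ (+-congʳ (*-congˡ (reflexive (≡.cong ι (level≡ i)))))
          (level-upper 0≤δ N (x i) (ℕ.≤∧≢⇒< (level≤ δ N (x i)) (unsaturated I ind i i∈I ∘ ≡.trans (≡.sym (level≡ i)))))

    module _ (κ : Vec ℕ n) (0≤t : ∀ i → [ 0# ] ≤⁺ levelThreshold δ N (lookup κ i)) where

      private
        t : Fin n → ℝ ⁺
        t i = levelThreshold δ N (lookup κ i)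

        above≡ : ∀ i → isAbove (t i) false (x i) ≡ (lookup κ i <ᵇ lookup ℓ i)
        above≡ i = ≡.trans (isAbove-level 0≤δ N (lookup κ i) (x i)) (≡.cong (lookup κ i <ᵇ_) (level≡ i))

      thresholdValue≤alg : thresholdValue M δ 0≤δ κ ℓ ≤ alg M (untied t 0≤t) x
      thresholdValue≤alg = ≤-trans (sum-mono {n} term) (value-accepted≤alg M t 0≤t x 0≤x)
        where
        acc : Subset n
        acc = accepted M (untied t 0≤t) Sub.⊥ x
        act : Subset n
        act = active M δ 0≤δ κ ℓ
        nonneg : ∀ b i → 0# ≤ (if b then x i else 0#)
        nonneg true  i = 0≤x i
        nonneg false i = ≤-refl
        act-lookup : ∀ i → lookup act i ≡ (lookup κ i <ᵇ lookup ℓ i)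
        act-lookup i = lookup-zipWith _<ᵇ_ i κ ℓ
        term : ∀ i → gain M δ 0≤δ i (lookup κ i) (lookup ℓ i) * 𝟙 (Room M δ 0≤δ i act) ≤ (if lookup acc i then x i else 0#)
        term i with lem {P = True (lookup κ i <ᵇ lookup ℓ i)} | lem {P = Room M δ 0≤δ i act}
        ... | no _ | _ = ≤-respˡ (sym (trans (*-congʳ (zeroʳ _)) (zeroˡ _))) (nonneg (lookup acc i) i)
        ... | yes _ | no _ = ≤-respˡ (sym (zeroʳ _)) (nonneg (lookup acc i) i)
        ... | yes κ<ℓ | yes room = ≤-respˡ (sym (trans (*-identityʳ _) (*-identityʳ _)))
              (≤-respʳ (reflexive (≡.cong (λ b → if b then x i else 0#) (≡.sym chosen))) (δℓ≤x i))
          where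
          chosen : lookup acc i ≡ true
          chosen = accepts M t 0≤t x 0≤x act
            (λ j h → lookup⇒[]= j act (≡.trans (act-lookup j) (≡.trans (≡.sym (above≡ j)) h)))
            i (≡.trans (above≡ i) (True⇒≡true κ<ℓ)) room

  levelThreshold-nonneg : ∀ {δ} → 0# ≤ δ → ∀ N κ → [ 0# ] ≤⁺ levelThreshold δ N κ
  levelThreshold-nonneg 0≤δ N κ with κ <ᵇ N
  ... | true  = [ *-nonneg 0≤δ (0≤ι (suc κ)) ]
  ... | false = _ ≤⊤⁺

  module _ {n} (M : LaminarMatroid n) (V : IndependentValues n) where
    open LaminarMatroid M
    open IndependentValues V

    private
      OPT : Ω → ℝ
      OPT ω = opt M (λ i → X i ω)

      ALG : NonAdaptive n → Ω → ℝ
      ALG 𝒜 ω = alg M 𝒜 (λ i → X i ω)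

    zero-lowerSum : ∀ {f} → (∀ ω → 0# ≤ f ω) → IsLowerSum f 0#
    zero-lowerSum 0≤f = record
      { size = 0 ; a = λ () ; A = λ () ; a-nonneg = λ () ; A-event = λ () ; below = 0≤f ; integral = refl }

    lowerSum-mono : ∀ {f g s} → (∀ ω → f ω ≤ g ω) → IsLowerSum f s → IsLowerSum g s
    lowerSum-mono f≤g L = record { IsLowerSum L ; below = λ ω → ≤-trans (IsLowerSum.below L ω) (f≤g ω) }

    OPT-nonneg : ∀ ω → 0# ≤ OPT ω
    OPT-nonneg ω = ⊥≤max 0# (List.map (λ I → value I (λ i → X i ω)) (filter independent? (allSubsets n)))

    module _ {δ} (0≤δ : 0# ≤ δ) (N : ℕ) where

      levels : Fin n → Ω → ℕ
      levels i ω = level δ N (X i ω)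

      private
        levels≤N : ∀ i ω → levels i ω ℕ.≤ N
        levels≤N i ω = level≤ δ N (X i ω)

        levels-event : ∀ i a → Event (λ ω → levels i ω ≡ a)
        levels-event i a = X-measurable i (level-Borel δ N a)

        levels-independent : ∀ ℓ → 𝐏 (cell space N levels ℓ) ≈ prod (λ i → 𝐏 (λ ω → levels i ω ≡ lookup ℓ i))
        levels-independent ℓ = X-independent (λ i x → level δ N x ≡ lookup ℓ i) (λ i → level-Borel δ N (lookup ℓ i))

      π : Fin n → Mean ℕ
      π = levelMean space N levels levels≤N levels-event levels-independent

      -- The simple function nowhere exceeds the sum of its coefficients, so a grid reaching that
      -- sum satisfies the truncation hypothesis of `rounding`. The grid may depend on the lower
      -- sum, because a single one close to the supremum is enough later.
      OPT-upper : ∀ {s} (L : IsLowerSum OPT s) → sum (IsLowerSum.a L) ≤ δ * ι N →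
        s ≤ mean (product π) (optimum-value M δ 0≤δ) + ι n * δ
      OPT-upper {s} L Σa≤δN = ≤-respʳ
        (trans (Mean.+-homo (product π) (optimum-value M δ 0≤δ) (λ _ → ι n * δ)) (+-congˡ (Mean.const (product π) (ι n * δ))))
        (lowerSum≤mean space N levels levels≤N levels-event levels-independent L (λ ℓ → optimum-value M δ 0≤δ ℓ + ι n * δ)
          (λ ω ℓ ω∈ → rounding M 0≤δ N (λ i → X i ω) (λ i → X-nonneg i ω) ℓ ω∈ (below ω)
            (≤-trans (sum-mono {size} (λ j → ≤-respʳ (*-identityʳ (a j)) (*-monoˡ-≤ (a-nonneg j) (𝟙≤1 (ω ∈ A j))))) Σa≤δN)))
        where open IsLowerSum L

      item-lower : ∀ i → IsLowerSum (X i) (mean (product π) (λ ℓ → levelValue M δ 0≤δ ℓ i))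
      item-lower i = mean-lowerSum space N levels levels≤N levels-event levels-independent
        (λ ℓ → levelValue M δ 0≤δ ℓ i) (λ ℓ → levelValue-nonneg M δ 0≤δ ℓ i)
        (λ ω ℓ ω∈ → ≤-respˡ (*-congˡ (reflexive (≡.cong ι (ω∈ i)))) (level-lower 0≤δ N (X-nonneg i ω)))

      thresholds : Vec ℕ n → NonAdaptive n
      thresholds κ = untied (λ i → levelThreshold δ N (lookup κ i)) (λ i → levelThreshold-nonneg 0≤δ N (lookup κ i))

      ALG-lower : ∀ κ → IsLowerSum (ALG (thresholds κ)) (mean (product π) (thresholdValue M δ 0≤δ κ))
      ALG-lower κ = mean-lowerSum space N levels levels≤N levels-event levels-independent
        (thresholdValue M δ 0≤δ κ)
        (λ ℓ → sum-nonneg {n} (λ i → *-nonneg (*-nonneg (levelValue-nonneg M δ 0≤δ ℓ i) (𝟙-nonneg _)) (𝟙-nonneg _)))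
        (λ ω ℓ ω∈ → thresholdValue≤alg M 0≤δ N (λ i → X i ω) (λ i → X-nonneg i ω) ℓ ω∈ κ
          (λ i → levelThreshold-nonneg 0≤δ N (lookup κ i)))

      good-algorithm : ∃ λ 𝒜 → ∃ λ G → IsLowerSum (ALG 𝒜) G × (ι 4 * mean (product π) (optimum-value M δ 0≤δ) ≤ ι 25 * G)
      good-algorithm =
        let κ , bound = good-thresholds M δ 0≤δ N π (levelMean-bounded space N levels levels≤N levels-event levels-independent)
        in thresholds κ , mean (product π) (thresholdValue M δ 0≤δ κ) , ALG-lower κ , bound

    private
      value-term-nonneg : ∀ {x : ℝ} → 0# ≤ x → ∀ b → 0# ≤ (if b then x else 0#)
      value-term-nonneg 0≤x true  = 0≤x
      value-term-nonneg 0≤x false = ≤-refl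

    module _ (i : Fin n) (unloop : Unloop M i) where

      private
        onlyThreshold : Fin n → ℝ ⁺
        onlyThreshold j = if does (j Fin.≟ i) then [ 0# ] else ⊤⁺

        onlyThreshold-nonneg : ∀ j → [ 0# ] ≤⁺ onlyThreshold j
        onlyThreshold-nonneg j with does (j Fin.≟ i)
        ... | true  = [ ≤-refl ]
        ... | false = _ ≤⊤⁺

        above⇒i : ∀ j x → isAbove (onlyThreshold j) false x ≡ true → j ≡ i
        above⇒i j x h with j Fin.≟ i
        ... | yes j≡i = j≡i
        above⇒i j x () | no _

        above-i : ∀ x → ¬ (x ≤ 0#) → isAbove (onlyThreshold i) false x ≡ true
        above-i x x≰0 with i Fin.≟ i
        ... | no i≢i = contradiction ≡.refl i≢i
        ... | yes _ with lem {P = x ≤ 0#}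
        ...   | yes x≤0 = contradiction x≤0 x≰0
        ...   | no _    = ≡.refl

      only : NonAdaptive n
      only = untied onlyThreshold onlyThreshold-nonneg

      X≤ALG-only : ∀ ω → X i ω ≤ ALG only ω
      X≤ALG-only ω = ≤-trans X≤value (value-accepted≤alg M onlyThreshold onlyThreshold-nonneg x (λ j → X-nonneg j ω))
        where
        x : Fin n → ℝ
        x j = X j ω
        acc : Subset n
        acc = accepted M only Sub.⊥ x
        unblocked : Unblocked M i (⁅ i ⁆ [ i ]≔ outside)
        unblocked {S} S∈ i∈S = ≡.subst (λ A → ∣ A Sub.∩ S ∣ ℕ.< rank S) (≡.sym (⁅i⁆-i≡⊥ i))
          (ℕ.≤-<-trans (ℕ.≤-trans (∣p∩q∣≤∣p∣ Sub.⊥ S) (ℕ.≤-reflexive (∣⊥∣≡0 n))) (ℕ.n≢0⇒n>0 (unloop S∈ i∈S)))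
        X≤value : x i ≤ value acc x
        X≤value with lem {P = x i ≤ 0#}
        -- A value equal to the threshold 0 is rejected when the coin shows tails, but it is worth
        -- nothing.
        ... | yes x≤0 = ≤-trans x≤0 (value-nonneg acc (λ j → X-nonneg j ω))
        ... | no x≰0 = ≤-respˡ (reflexive (≡.cong (λ b → if b then x i else 0#) chosen))
              (term≤sum {f = λ j → if lookup acc j then x j else 0#} (λ j → value-term-nonneg (X-nonneg j ω) (lookup acc j)) i)
          where
          chosen : lookup acc i ≡ true
          chosen = accepts M onlyThreshold onlyThreshold-nonneg x (λ j → X-nonneg j ω) ⁅ i ⁆
            (λ j h → ≡.subst (Sub._∈ ⁅ i ⁆) (≡.sym (above⇒i j (x j) h)) (x∈⁅x⁆ i)) i (above-i (x i) x≰0) unblocked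

    Bounded : (Ω → ℝ) → Set (lsuc 0ℓ)
    Bounded f = Satisfiable (IsUpperBound _≤_ (IsLowerSum f))

    -- Step size 1 is fine enough here, but the bound must not depend on `N`. It does not, because
    -- the mean grid value of an item is a lower sum of `X i` for every `N`. A loop may have
    -- infinite expectation; it gets the cap 0 since it never belongs to an optimum.
    items-bounded⇒OPT-bounded : (∀ i → Unloop M i → Bounded (X i)) → Bounded OPT
    items-bounded⇒OPT-bounded bounded = sum B + ι n * 1# , λ s L →
      let N , Σa≤N = Archimedean 0<1 (sum (IsLowerSum.a L))
      in ≤-trans (OPT-upper 0≤1 N L Σa≤N) (+-monoˡ-≤ _ (mean-optimum≤ N))
      where
      cap : ∀ i → ∃ λ b → (0# ≤ b) × (Unloop M i → IsUpperBound _≤_ (IsLowerSum (X i)) b)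
      cap i with lem {P = Unloop M i}
      ... | no loop = 0# , ≤-refl , λ unloop → contradiction (λ {S} → unloop {S}) loop
      ... | yes unloop with bounded i unloop
      ...   | b , upper = b , upper 0# (zero-lowerSum (X-nonneg i)) , λ _ → upper
      B : Fin n → ℝ
      B i = proj₁ (cap i)
      module _ (N : ℕ) where
        private
          module 𝔼 = Mean (product (π 0≤1 N))
          unlooped : Fin n → Vec ℕ n → ℝ
          unlooped i ℓ = 𝟙 (Unloop M i) * levelValue M 1# 0≤1 ℓ i
          item≤ : ∀ i → 𝔼.mean (unlooped i) ≤ B i
          item≤ i = ≤-respˡ (sym (𝔼.*-homo (𝟙 (Unloop M i)) (λ ℓ → levelValue M 1# 0≤1 ℓ i))) (scaled lem)
            where
            scaled : Dec (Unloop M i) → 𝟙 (Unloop M i) * 𝔼.mean (λ ℓ → levelValue M 1# 0≤1 ℓ i) ≤ B i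
            scaled (no loop) = ≤-respˡ (sym (trans (*-congʳ (𝟙-no loop)) (zeroˡ _))) (proj₁ (proj₂ (cap i)))
            scaled (yes unloop) = ≤-respˡ (sym (trans (*-congʳ (𝟙-yes {Unloop M i} unloop)) (*-identityˡ _)))
              (proj₂ (proj₂ (cap i)) unloop _ (item-lower 0≤1 N i))
          term : ∀ ℓ i b → lookup (optimum M 1# 0≤1 ℓ) i ≡ b →
                 (if b then levelValue M 1# 0≤1 ℓ i else 0#) ≤ unlooped i ℓ
          term ℓ i false _ = *-nonneg (𝟙-nonneg _) (levelValue-nonneg M 1# 0≤1 ℓ i)
          term ℓ i true chosen = ≤-reflexive (sym (trans
            (*-congʳ (𝟙-yes {Unloop M i} (independent⇒unloop M {optimum M 1# 0≤1 ℓ} (optimum-independent M 1# 0≤1 ℓ) chosen))) (*-identityˡ _)))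
        mean-optimum≤ : 𝔼.mean (optimum-value M 1# 0≤1) ≤ sum B
        mean-optimum≤ = begin
          𝔼.mean (optimum-value M 1# 0≤1)
            ≤⟨ 𝔼.mono (λ ℓ → sum-mono {n} (λ i → term ℓ i (lookup (optimum M 1# 0≤1 ℓ) i) ≡.refl)) ⟩
          𝔼.mean (λ ℓ → sum {n} (λ i → unlooped i ℓ))
            ≈⟨ 𝔼.sum-homo unlooped ⟩
          sum {n} (λ i → 𝔼.mean (unlooped i))
            ≤⟨ sum-mono {n} item≤ ⟩
          sum B ∎

    OPT-unbounded⇒competitive : ¬ Bounded OPT → ∃ λ 𝒜 → 𝐄[OPT] M V ≤⁺ 6·311 · 𝐄[ALG] M V 𝒜
    OPT-unbounded⇒competitive unbounded with lem {P = ∃ λ i → Unloop M i × ¬ Bounded (X i)}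
    ... | yes (i , unloop , X-unbounded) = only i unloop ,
          ≡.subst (λ e → 𝐄[OPT] M V ≤⁺ 6·311 · e) (≡.sym ALG-infinite) (_ ≤⊤⁺)
      where
      ALG-infinite : 𝐄[ALG] M V (only i unloop) ≡ ⊤⁺
      ALG-infinite = sup-unbounded
        (0# , zero-lowerSum (λ ω → ≤-trans (X-nonneg i ω) (X≤ALG-only i unloop ω)))
        (λ (b , upper) → X-unbounded (b , λ s L → upper s (lowerSum-mono (X≤ALG-only i unloop) L)))
    ... | no none = contradiction (items-bounded⇒OPT-bounded bounded) unbounded
      where
      bounded : ∀ i → Unloop M i → Bounded (X i)
      bounded i unloop with lem {P = Bounded (X i)}
      ... | yes b = b
      ... | no ¬b = contradiction (i , (λ {S} → unloop {S}) , ¬b) none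

    1000*6·311 : ι 1000 * 6·311 ≈ ι 6311
    1000*6·311 = begin-equality
      ι 1000 * (fromℕ 6311 * fromℕ 1000 ⁻¹)
        ≈⟨ *-congʳ (ι≈fromℕ 1000) ⟩
      fromℕ 1000 * (fromℕ 6311 * fromℕ 1000 ⁻¹)
        ≈⟨ rearrange (fromℕ 1000) (fromℕ 6311) (fromℕ 1000 ⁻¹) ⟩
      fromℕ 6311 * (fromℕ 1000 * fromℕ 1000 ⁻¹)
        ≈⟨ *-congˡ (*-inverseʳ (fromℕ 1000) (λ e → 0<⇒≉0 (0<ι 1000) (trans (ι≈fromℕ 1000) e))) ⟩
      fromℕ 6311 * 1#
        ≈⟨ trans (*-identityʳ _) (sym (ι≈fromℕ 6311)) ⟩
      ι 6311 ∎
      where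
      rearrange : ∀ a b c → a * (b * c) ≈ b * (a * c)
      rearrange = solve 3 (λ a b c → a :* (b :* c) := b :* (a :* c)) refl

    0≤6·311 : 0# ≤ 6·311
    0≤6·311 = *-cancelˡ-≤ (0<ι 1000) (≤-respˡ (sym (zeroʳ _)) (≤-respʳ (sym 1000*6·311) (0≤ι 6311)))

    ·-mono : ∀ {o G e} → o ≤ 6·311 * G → [ G ] ≤⁺ e → [ o ] ≤⁺ 6·311 · e
    ·-mono o≤ [ G≤ ]     = [ ≤-trans o≤ (*-monoˡ-≤ 0≤6·311 G≤) ]
    ·-mono o≤ (_ ≤⊤⁺)    = _ ≤⊤⁺

    -- 1/400 of o pays for the lower sum and another 1/400 for the rounding.
    competitive-ratio : ∀ {o e s v d G} → ι 400 * e ≈ o → 0# ≤ G → o - e ≤ s → s ≤ v + d → d ≤ e →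
            ι 4 * v ≤ ι 25 * G → o ≤ 6·311 * G
    competitive-ratio {o} {e} {s} {v} {d} {G} 400e≈o 0≤G o-e≤s s≤v+d d≤e 4v≤25G =
      *-cancelˡ-≤ (0<ι 1000) (*-cancelˡ-≤ (0<ι 398) (begin
        ι 398 * (ι 1000 * o)
          ≈⟨ solve 3 (λ a b o → a :* (b :* o) := b :* (a :* o)) refl (ι 398) (ι 1000) o ⟩
        ι 1000 * (ι 398 * o)
          ≤⟨ *-monoˡ-≤ (0≤ι 1000) 398o≤2500G ⟩
        ι 1000 * (ι 2500 * G)
          ≈⟨ trans (sym (*-assoc _ _ _)) (*-congʳ (sym (ι-* 1000 2500))) ⟩
        ι (1000 ℕ.* 2500) * G
          -- The ratio reached is `25/4 * 400/398 = 2500/398`, about 6.2814.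
          ≤⟨ *-monoʳ-≤ 0≤G (ι-mono (ℕ.≤ᵇ⇒≤ (1000 ℕ.* 2500) (398 ℕ.* 6311) _)) ⟩
        ι (398 ℕ.* 6311) * G
          ≈⟨ trans (*-congʳ (ι-* 398 6311)) (*-assoc _ _ _) ⟩
        ι 398 * (ι 6311 * G)
          ≈⟨ *-congˡ (trans (*-congʳ (sym 1000*6·311)) (*-assoc _ _ _)) ⟩
        ι 398 * (ι 1000 * (6·311 * G)) ∎))
      where
      o≤v+2e : o ≤ (v + e) + e
      o≤v+2e = ≤-respˡ (solve 2 (λ o e → (o :- e) :+ e := o) refl o e)
        (+-monoˡ-≤ e (≤-trans o-e≤s (≤-trans s≤v+d (+-monoʳ-≤ v d≤e))))
      398o≤400v : ι 398 * o ≤ ι 400 * v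
      398o≤400v = +-cancelʳ-≤ (ι 2 * o) (begin
        ι 398 * o + ι 2 * o             ≈⟨ distribʳ o (ι 398) (ι 2) ⟨
        (ι 398 + ι 2) * o               ≈⟨ *-congʳ (ι-+ 398 2) ⟨
        ι 400 * o                       ≤⟨ *-monoˡ-≤ (0≤ι 400) o≤v+2e ⟩
        ι 400 * ((v + e) + e)           ≈⟨ solve 3 (λ a v e → a :* ((v :+ e) :+ e) := a :* v :+ (con (+ 1) :+ con (+ 1)) :* (a :* e)) refl (ι 400) v e ⟩
        ι 400 * v + (1# + 1#) * (ι 400 * e) ≈⟨ +-congˡ (*-cong (sym (trans (ι-suc 1) (+-congˡ ι-1))) 400e≈o) ⟩
        ι 400 * v + ι 2 * o             ∎)
      398o≤2500G : ι 398 * o ≤ ι 2500 * G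
      398o≤2500G = begin
        ι 398 * o           ≤⟨ 398o≤400v ⟩
        ι 400 * v           ≈⟨ trans (*-congʳ (ι-* 100 4)) (*-assoc _ _ _) ⟩
        ι 100 * (ι 4 * v)   ≤⟨ *-monoˡ-≤ (0≤ι 100) 4v≤25G ⟩
        ι 100 * (ι 25 * G)  ≈⟨ trans (sym (*-assoc _ _ _)) (*-congʳ (sym (ι-* 100 25))) ⟩
        ι 2500 * G          ∎

    LUB-approach : ∀ {A : Pred ℝ (lsuc 0ℓ)} {o e} → IsLUB _≤_ A o → 0# < e → ∃ λ s → s ∈ A × (o - e ≤ s)
    LUB-approach {A} {o} {e} lub 0<e with lem {P = ∃ λ s → s ∈ A × (o - e ≤ s)}
    ... | yes p = p
    ... | no ¬p = contradiction (IsLUB.least lub (o - e) (λ s s∈A → <⇒≤ (λ o-e≤s → ¬p (s , s∈A , o-e≤s))))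
      (λ o≤o-e → 0<e (+-cancelʳ-≤ (o - e) (≤-respˡ (solve 2 (λ o e → o := e :+ (o :- e)) refl o e)
        (≤-respʳ (sym (+-identityˡ _)) o≤o-e))))

    positive⇒competitive : ∀ {o} → IsLUB _≤_ (IsLowerSum OPT) o → 0# < o →
      ∃ λ 𝒜 → ∃ λ G → IsLowerSum (ALG 𝒜) G × (o ≤ 6·311 * G)
    positive⇒competitive {o} lub 0<o =
      let s , L , o-e≤s = LUB-approach lub 0<e
          N , Σa≤δN = Archimedean 0<δ (sum (IsLowerSum.a L))
          𝒜 , G , G-lower , bound = good-algorithm 0≤δ N
      in 𝒜 , G , G-lower , competitive-ratio 400e≈o (lower-nonneg G-lower) o-e≤s (OPT-upper 0≤δ N L Σa≤δN) nδ≤e bound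
      where
      e δ : ℝ
      e = o * ι 400 ⁻¹
      -- Dividing by `n + 1` covers `n = 0`, and the total rounding error `n δ` still stays below
      -- `e`.
      δ = e * ι (suc n) ⁻¹
      undo : ∀ k .{{_ : ℕ.NonZero k}} x → ι k * (x * ι k ⁻¹) ≈ x
      undo k x = trans (solve 3 (λ a b c → a :* (b :* c) := b :* (a :* c)) refl (ι k) x (ι k ⁻¹))
        (trans (*-congˡ (*-inverseʳ (ι k) (0<⇒≉0 (0<ι k)))) (*-identityʳ x))
      0<undo : ∀ k .{{_ : ℕ.NonZero k}} {x} → 0# < x → 0# < x * ι k ⁻¹
      0<undo k {x} 0<x q≤0 = 0<x (≤-respˡ (undo k x) (≤-respʳ (zeroʳ (ι k)) (*-monoˡ-≤ (0≤ι k) q≤0)))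
      400e≈o : ι 400 * e ≈ o
      400e≈o = undo 400 o
      0<e : 0# < e
      0<e = 0<undo 400 0<o
      0<δ : 0# < δ
      0<δ = 0<undo (suc n) 0<e
      0≤δ : 0# ≤ δ
      0≤δ = <⇒≤ 0<δ
      nδ≤e : ι n * δ ≤ e
      nδ≤e = ≤-respʳ (undo (suc n) e) (*-monoʳ-≤ 0≤δ (ι-mono (ℕ.n≤1+n n)))
      lower-nonneg : ∀ {f s} → IsLowerSum f s → 0# ≤ s
      lower-nonneg L = ≤-respʳ (sym integral) (sum-nonneg (λ j → *-nonneg (a-nonneg j) (𝐏-nonneg (A-event j))))
        where open IsLowerSum L

    OPT-bounded⇒competitive : Bounded OPT → ∃ λ 𝒜 → 𝐄[OPT] M V ≤⁺ 6·311 · 𝐄[ALG] M V 𝒜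
    OPT-bounded⇒competitive bounded =
      let 𝒜 , G , G-lower , o≤G = choose
      in 𝒜 , ≡.subst (_≤⁺ 6·311 · 𝐄[ALG] M V 𝒜) (≡.sym OPT≡o) (·-mono o≤G (≤sup G-lower))
      where
      supremum = sup-bounded (0# , zero-lowerSum OPT-nonneg) bounded
      o = proj₁ supremum
      lub = proj₁ (proj₂ supremum)
      OPT≡o : 𝐄[OPT] M V ≡ [ o ]
      OPT≡o = proj₂ (proj₂ supremum)
      never : NonAdaptive n
      never = untied (λ _ → ⊤⁺) (λ _ → _ ≤⊤⁺)
      choose : ∃ λ 𝒜 → ∃ λ G → IsLowerSum (ALG 𝒜) G × (o ≤ 6·311 * G)
      choose with lem {P = o ≤ 0#}
      ... | no 0<o  = positive⇒competitive lub 0<o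
      -- A rounding error proportional to `o` is impossible here, but earning nothing is already
      -- enough.
      ... | yes o≤0 = never , 0# ,
            zero-lowerSum (λ ω → ≤-trans (value-nonneg (accepted M never Sub.⊥ (λ i → X i ω)) (λ i → X-nonneg i ω))
              (value-accepted≤alg M (λ _ → ⊤⁺) (λ _ → _ ≤⊤⁺) (λ i → X i ω) (λ i → X-nonneg i ω))) ,
            ≤-respʳ (sym (zeroʳ _)) o≤0

    competitive : ∃ λ 𝒜 → 𝐄[OPT] M V ≤⁺ 6·311 · 𝐄[ALG] M V 𝒜
    competitive = decide lem
      where
      decide : Dec (Bounded OPT) → ∃ λ 𝒜 → 𝐄[OPT] M V ≤⁺ 6·311 · 𝐄[ALG] M V 𝒜
      decide (yes bounded)  = OPT-bounded⇒competitive bounded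
      decide (no unbounded) = OPT-unbounded⇒competitive unbounded

theorem3p9 : (lem : ∀ {ℓ} → ExcludedMiddle ℓ) (R : CompleteOrderedField) →
    let open Prophet lem R in
    ∀ (n : ℕ) (M : LaminarMatroid n) (V : IndependentValues n) →
    ∃ λ (𝒜 : NonAdaptive n) → 𝐄[OPT] M V ≤⁺ 6·311 · 𝐄[ALG] M V 𝒜
theorem3p9 lem R n M V = Competitive.competitive lem R M V
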